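{- For all sufficiently large integers $n$, \[ g_{1,1}(n)>g_{2,1}(n)\quad\text{and}\quad g_{1,2}(n)<g_{2,2}(n). \]
   Context: A partition $\lambda=(\lambda_1\ge \lambda_2\ge\cdots\ge\lambda_k)$ of $n$ is a weakly decreasing sequence of positive integers summing to $n$; its conjugate is $\lambda'$ with $\lambda'_j=\#\{i:\lambda_i\ge j\}$. For the cell in row $i$ and column $j$ of the Young diagram of $\lambda$, its hook length is $h(i,j)=\lambda_i+\lambda'_j-i-j+1$. A $t$-hook is a cell with hook length $t$. For a positive integer $t$, $g_{1,t}(n)$ denotes the total number of $t$-hooks, summed over all partitions of $n$ such that consecutive parts differ by at least $2$ and, whenever $\lambda_i$ is odd, $\lambda_i-\lambda_{i+1}>2$ (i.e. parts differ by at least 2 and no two odd parts differ by exactly 2); $g_{2,t}(n)$ denotes the total number of $t$-hooks, summed over all partitions of $n$ all of whose parts are congruent to $1$, $5$ or $6$ modulo $8$. -}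

module Defs where

open import Data.Nat using (ℕ; zero; suc; _+_; _∸_; _≤ᵇ_; _≡ᵇ_; _%_; _<ᵇ_)
open import Data.Bool using (Bool; true; false; _∧_; _∨_; if_then_else_; not)
open import Data.List using (List; []; _∷_; length; map; concatMap; filter; upTo; applyUpTo; lookup)
open import Data.Nat.ListAction using (sum)
open import Data.List.Relation.Unary.All using (All)
open import Data.List.Relation.Unary.Linked using (Linked)
open import Data.Nat using (_≥_; _>_)
import Data.Nat as ℕ

-- A partition is represented as a list of its parts λ₁ ≥ λ₂ ≥ ... ≥ λₖ > 0.
Partition : Set
Partition = List ℕ

IsPartitionOf : ℕ → Partition → Set
IsPartitionOf n λs = All (λ p → p > 0) λs × Linked _≥_ λs × sum λs ≡ n
  where
  open import Data.Product using (_×_)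
  open import Relation.Binary.PropositionalEquality using (_≡_)

-- partsBounded m n : all partitions of n with every part ≤ m
-- (fuel = n + m guarantees termination; each step decreases n or m)
partsBounded : ℕ → ℕ → ℕ → List Partition
partsBounded zero       m zero    = [] ∷ []
partsBounded zero       m (suc n) = []
partsBounded (suc fuel) m zero    = [] ∷ []
partsBounded (suc fuel) zero (suc n) = []
partsBounded (suc fuel) (suc m) (suc n) =
  (if suc m ≤ᵇ suc n
     then map (suc m ∷_) (partsBounded fuel (suc m) (suc n ∸ suc m))
     else [])
  Data.List.++ partsBounded fuel m (suc n)
  where import Data.List

partitions : ℕ → List Partition
partitions n = partsBounded (n + n + 1) n n

conjPart : Partition → ℕ → ℕ
conjPart λs j = length (filter (λ p → j ℕ.≤? p) λs)

-- Hook lengths of all cells of row with index i (1-based) and part p: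
-- cells (i, j) for j = 1..p, h(i,j) = λ_i + λ'_j - i - j + 1.
rowHooks : Partition → ℕ → ℕ → List ℕ
rowHooks λs i p = applyUpTo (λ j0 → let j = suc j0 in (p + conjPart λs j + 1) ∸ (i + j)) p

hooksFrom : Partition → ℕ → Partition → List ℕ
hooksFrom λs i []       = []
hooksFrom λs i (p ∷ ps) = rowHooks λs i p Data.List.++ hooksFrom λs (suc i) ps
  where import Data.List

hookLengths : Partition → List ℕ
hookLengths λs = hooksFrom λs 1 λs

numHooks : ℕ → Partition → ℕ
numHooks t λs = length (filter (λ h → h ℕ.≟ t) (hookLengths λs))

gapOK : ℕ → ℕ → Bool
gapOK a b = if a % 2 ≡ᵇ 1 then (b + 3 ≤ᵇ a) else (b + 2 ≤ᵇ a)

cond1 : Partition → Bool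
cond1 []            = true
cond1 (a ∷ [])      = true
cond1 (a ∷ b ∷ ps)  = gapOK a b ∧ cond1 (b ∷ ps)

partOK2 : ℕ → Bool
partOK2 p = (p % 8 ≡ᵇ 1) ∨ (p % 8 ≡ᵇ 5) ∨ (p % 8 ≡ᵇ 6)

cond2 : Partition → Bool
cond2 []       = true
cond2 (p ∷ ps) = partOK2 p ∧ cond2 ps

g₁ : ℕ → ℕ → ℕ
g₁ t n = sum (map (numHooks t) (filter (λ λs → Relation.Nullary.Decidable.Core.T? (cond1 λs)) (partitions n)))
  where import Relation.Nullary.Decidable.Core

g₂ : ℕ → ℕ → ℕ
g₂ t n = sum (map (numHooks t) (filter (λ λs → Relation.Nullary.Decidable.Core.T? (cond2 λs)) (partitions n)))
  where import Relation.Nullary.Decidable.Core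

-- By Lebesgue's identity, gap partitions correspond to pairs (α , β), where α has distinct
-- even parts and β distinct parts ≡ 1 mod 4, in such a way that the number of parts of the
-- gap partition is ℓ(β) plus the number of parts of α exceeding 2 ℓ(β). These pairs are
-- equinumerous with the partitions into parts ≡ 1, 5, 6 mod 8. A gap partition has as many
-- 1-hooks as parts and at most as many 2-hooks. Let P be the sequence of the numbers of
-- pairs and S its partial sums. For residue partitions the hooks are counted by sums of P
-- over arithmetic progressions, so their totals are 3/8 S + O(P) for 1-hooks and 1/2 S + O(P)
-- for 2-hooks. Expanding q^j/(1 + q^j) as an alternating series bounds the total number of
-- parts of gap partitions between ((9/16) log 2 - ε) S and ((3/4) log 2 - 1/32 + ε) S up to
-- O(P), that is, strictly between 3/8 S and 1/2 S. Finally S outgrows every multiple of P,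
-- because gap partitions with a bounded number of parts are negligible in number.

module Submission where

open import Data.Nat hiding (_≟_)
open import Data.Nat.Properties
open import Relation.Binary.PropositionalEquality as ≡ using (_≡_; refl; sym; trans; cong; cong₂; subst)
import Data.Nat.Tactic.RingSolver as NS
import Relation.Binary.Reasoning.PartialOrder as POR
import Relation.Binary.Reasoning.Setoid as SetoidReasoning
open import Defs
import Data.List.Relation.Unary.All as All
import Data.Bool as Bool
open import Data.Product using (_×_; _,_; ∃-syntax; proj₁; proj₂)
open import Data.Sum using (_⊎_; inj₁; inj₂)
open import Relation.Binary using (IsEquivalence; Poset)
open import Algebra.Bundles using (CommutativeSemiring)
open import Algebra.Structures.Biased using (isCommutativeSemiringˡ; isCommutativeMonoidˡ)
open import Data.Empty using (⊥-elim)
open import Data.Nat.DivMod using ([m+kn]%n≡m%n; m/n*n≤m; m%n<n; m≡m%n+[m/n]*n)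
open import Data.Bool using (true; false; if_then_else_; Bool; _∨_; _∧_)
open import Data.Nat.ListAction using (sum)
open import Data.Nat.ListAction.Properties using (sum-++)
open import Data.Unit using (⊤; tt)
open import Data.List using (List; []; _∷_; _++_; map; filter; length; applyUpTo)
open import Data.List.Properties using (map-++; map-∘; filter-accept; filter-reject; filter-++; length-++; length-filter; applyUpTo-∷ʳ)
open import Data.List.Relation.Unary.All using (All; []; _∷_)
open import Data.List.Relation.Unary.All.Properties using (++⁺; map⁺)
open import Relation.Nullary.Decidable.Core using (T?)
open import Relation.Nullary using (¬_)
open import Data.Nat using (_≟_)

-- The quantity to control is `Λ`, the number of parts of α that are at most 2 ℓ(β), because D = Y +
-- Z - Λ, where Y and Z count all parts of α and of β. Asymptotically Y is (1/2) log 2 and Z is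
-- (1/4) log 2 times S. There are only ℓ(β) even values up to 2 ℓ(β), so 0 ≤ Λ ≤ Z, but this leaves
-- D between 0.347 S and 0.520 S, an interval containing both 3/8 and 1/2. The gain comes from the
-- parts of α divisible by 4. For ℓ(β) = k the generating function of β has the factors 1/(1 - q⁴ⁱ),
-- i ≤ k, so a part 4i of α can be traded for a change of β. Hence at most half of the pairs contain
-- it, which gives Λ ≤ (3 Z + P)/4, and a similar trade gives Λ ≥ S/32 - O(P). Coefficients stay in
-- ℕ, so that coefficientwise inequalities survive multiplication. Division by 1 - qᵃ becomes
-- uniqueness of the solution of a fixed-point equation, and negative terms move to the other side.
-- No asymptotic formula for P is needed: its coefficients increase, and this alone makes its sum
-- along a progression of difference d equal to S/d + O(P).

-- The semiring of power series with natural coefficients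

Series : Set
Series = ℕ → ℕ

infix 4 _≈_ _≼_ _≈[_]_
-- A record rather than a function type, so that the two series can be inferred from the type of a
-- proof.
record _≈_ (f g : Series) : Set where
  constructor mk≈
  field at : ∀ n → f n ≡ g n
open _≈_ public

record _≼_ (f g : Series) : Set where
  constructor mk≼
  field le : ∀ n → f n ≤ g n
open _≼_ public

record _≈[_]_ (f : Series) (N : ℕ) (g : Series) : Set where
  constructor mk[]
  field upTo : ∀ n → n < N → f n ≡ g n
open _≈[_]_ public

infixl 6 _⊕_
infixl 7 _⊛_

_⊕_ : Series → Series → Series
(f ⊕ g) n = f n + g n

tl : Series → Series
tl f n = f (suc n)

-- The Cauchy product, by recursion on the degree from f = f(0) + q `tl f`.
_⊛_ : Series → Series → Series
(f ⊛ g) zero    = f 0 * g 0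
(f ⊛ g) (suc n) = f 0 * g (suc n) + (tl f ⊛ g) n

O : Series
O _ = 0

X : ℕ → Series
X zero    zero    = 1
X zero    (suc n) = 0
X (suc a) zero    = 0
X (suc a) (suc n) = X a n

I : Series
I = X 0

≈-refl : ∀ {f} → f ≈ f
≈-refl = mk≈ λ _ → refl

≈-sym : ∀ {f g} → f ≈ g → g ≈ f
≈-sym p = mk≈ λ n → sym (at p n)

≈-trans : ∀ {f g h} → f ≈ g → g ≈ h → f ≈ h
≈-trans p r = mk≈ λ n → trans (at p n) (at r n)

≈-isEquivalence : IsEquivalence _≈_
≈-isEquivalence = record { refl = ≈-refl ; sym = ≈-sym ; trans = ≈-trans }

⊛-mono-at : ∀ {f f' g g'} n → (∀ m → m ≤ n → f m ≤ f' m) → (∀ m → m ≤ n → g m ≤ g' m) →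
            (f ⊛ g) n ≤ (f' ⊛ g') n
⊛-mono-at zero    p r = *-mono-≤ (p 0 z≤n) (r 0 z≤n)
⊛-mono-at (suc n) p r = +-mono-≤ (*-mono-≤ (p 0 z≤n) (r (suc n) ≤-refl))
  (⊛-mono-at n (λ m m≤n → p (suc m) (s≤s m≤n)) (λ m m≤n → r m (m≤n⇒m≤1+n m≤n)))

⊛-cong-at : ∀ {f f' g g'} n → (∀ m → m ≤ n → f m ≡ f' m) → (∀ m → m ≤ n → g m ≡ g' m) →
            (f ⊛ g) n ≡ (f' ⊛ g') n
⊛-cong-at n p r = ≤-antisym
  (⊛-mono-at n (λ m m≤n → ≤-reflexive (p m m≤n)) (λ m m≤n → ≤-reflexive (r m m≤n)))
  (⊛-mono-at n (λ m m≤n → ≤-reflexive (sym (p m m≤n))) (λ m m≤n → ≤-reflexive (sym (r m m≤n))))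

⊕-cong : ∀ {f f' g g'} → f ≈ f' → g ≈ g' → f ⊕ g ≈ f' ⊕ g'
⊕-cong p r = mk≈ λ n → cong₂ _+_ (at p n) (at r n)

⊛-cong : ∀ {f f' g g'} → f ≈ f' → g ≈ g' → f ⊛ g ≈ f' ⊛ g'
⊛-cong p r = mk≈ λ n → ⊛-cong-at n (λ m _ → at p m) (λ m _ → at r m)

⊛-distribʳ-at : ∀ f g h n → ((g ⊕ h) ⊛ f) n ≡ (g ⊛ f) n + (h ⊛ f) n
⊛-distribʳ-at f g h zero    = *-distribʳ-+ (f 0) (g 0) (h 0)
⊛-distribʳ-at f g h (suc n) = trans
  (cong ((g 0 + h 0) * f (suc n) +_) (⊛-distribʳ-at f (tl g) (tl h) n))
  (lemma (g 0) (h 0) (f (suc n)) ((tl g ⊛ f) n) ((tl h ⊛ f) n))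
  where
  lemma : ∀ a b c u v → (a + b) * c + (u + v) ≡ a * c + u + (b * c + v)
  lemma = NS.solve-∀

⊛-scale-at : ∀ c f g n → ((λ m → c * f m) ⊛ g) n ≡ c * (f ⊛ g) n
⊛-scale-at c f g zero    = *-assoc c (f 0) (g 0)
⊛-scale-at c f g (suc n) = trans
  (cong (c * f 0 * g (suc n) +_) (⊛-scale-at c (tl f) g n))
  (lemma c (f 0) (g (suc n)) ((tl f ⊛ g) n))
  where
  lemma : ∀ a b c u → a * b * c + a * u ≡ a * (b * c + u)
  lemma = NS.solve-∀

⊛-sucʳ : ∀ f g n → (f ⊛ g) (suc n) ≡ (f ⊛ tl g) n + f (suc n) * g 0
⊛-sucʳ f g zero    = refl
⊛-sucʳ f g (suc n) = trans
  (cong (f 0 * g (2 + n) +_) (⊛-sucʳ (tl f) g n))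
  (sym (+-assoc (f 0 * g (2 + n)) _ _))

⊛-comm-at : ∀ f g n → (f ⊛ g) n ≡ (g ⊛ f) n
⊛-comm-at f g zero    = *-comm (f 0) (g 0)
⊛-comm-at f g (suc n) = trans
  (cong₂ _+_ (*-comm (f 0) (g (suc n))) (⊛-comm-at (tl f) g n))
  (trans (+-comm (g (suc n) * f 0) _) (sym (⊛-sucʳ g f n)))

⊛-assoc-at : ∀ f g h n → ((f ⊛ g) ⊛ h) n ≡ (f ⊛ (g ⊛ h)) n
⊛-assoc-at f g h zero    = *-assoc (f 0) (g 0) (h 0)
⊛-assoc-at f g h (suc n) = trans
  (cong (f 0 * g 0 * h (suc n) +_)
    (trans (⊛-distribʳ-at h (λ m → f 0 * tl g m) (tl f ⊛ g) n)
             (cong₂ _+_ (⊛-scale-at (f 0) (tl g) h n) (⊛-assoc-at (tl f) g h n))))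
  (lemma (f 0) (g 0) (h (suc n)) ((tl g ⊛ h) n) ((tl f ⊛ (g ⊛ h)) n))
  where
  lemma : ∀ a b c u v → a * b * c + (a * u + v) ≡ a * (b * c + u) + v
  lemma = NS.solve-∀

⊛-zeroˡ-at : ∀ f n → (O ⊛ f) n ≡ 0
⊛-zeroˡ-at f zero    = refl
⊛-zeroˡ-at f (suc n) = ⊛-zeroˡ-at f n

⊛-identityˡ-at : ∀ f n → (I ⊛ f) n ≡ f n
⊛-identityˡ-at f zero    = +-identityʳ (f 0)
⊛-identityˡ-at f (suc n) = trans (cong₂ _+_ (+-identityʳ (f (suc n))) (⊛-zeroˡ-at f n)) (+-identityʳ _)

series : CommutativeSemiring _ _
series = record
  { Carrier = Series ; _≈_ = _≈_ ; _+_ = _⊕_ ; _*_ = _⊛_ ; 0# = O ; 1# = I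
  ; isCommutativeSemiring = isCommutativeSemiringˡ record
    { +-isCommutativeMonoid = isCommutativeMonoidˡ record
      { isSemigroup = record
        { isMagma = record { isEquivalence = ≈-isEquivalence ; ∙-cong = ⊕-cong }
        ; assoc = λ f g h → mk≈ λ n → +-assoc (f n) (g n) (h n) }
      ; identityˡ = λ f → mk≈ λ n → refl
      ; comm = λ f g → mk≈ λ n → +-comm (f n) (g n) }
    ; *-isCommutativeMonoid = isCommutativeMonoidˡ record
      { isSemigroup = record
        { isMagma = record { isEquivalence = ≈-isEquivalence ; ∙-cong = ⊛-cong }
        ; assoc = λ f g h → mk≈ λ n → ⊛-assoc-at f g h n }
      ; identityˡ = λ f → mk≈ λ n → ⊛-identityˡ-at f n
      ; comm = λ f g → mk≈ λ n → ⊛-comm-at f g n }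
    ; distribʳ = λ f g h → mk≈ λ n → ⊛-distribʳ-at f g h n
    ; zeroˡ = λ f → mk≈ λ n → ⊛-zeroˡ-at f n } }

module R = CommutativeSemiring series
import Algebra.Solver.Ring.NaturalCoefficients.Default series as Solver
open Solver using (solve; _:=_; _:+_; _:*_; con) public

≼-refl : ∀ {f} → f ≼ f
≼-refl = mk≼ λ _ → ≤-refl

≼-trans : ∀ {f g h} → f ≼ g → g ≼ h → f ≼ h
≼-trans p r = mk≼ λ n → ≤-trans (le p n) (le r n)

≈⇒≼ : ∀ {f g} → f ≈ g → f ≼ g
≈⇒≼ p = mk≼ λ n → ≤-reflexive (at p n)

≼-antisym : ∀ {f g} → f ≼ g → g ≼ f → f ≈ g
≼-antisym p r = mk≈ λ n → ≤-antisym (le p n) (le r n)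

seriesPoset : Poset _ _ _
seriesPoset = record
  { Carrier = Series ; _≈_ = _≈_ ; _≤_ = _≼_
  ; isPartialOrder = record
    { isPreorder = record { isEquivalence = ≈-isEquivalence ; reflexive = ≈⇒≼ ; trans = ≼-trans }
    ; antisym = ≼-antisym } }

module ≼R = POR seriesPoset
module ≈R = SetoidReasoning R.setoid

⊕-mono : ∀ {f f' g g'} → f ≼ f' → g ≼ g' → f ⊕ g ≼ f' ⊕ g'
⊕-mono p r = mk≼ λ n → +-mono-≤ (le p n) (le r n)

⊛-mono : ∀ {f f' g g'} → f ≼ f' → g ≼ g' → f ⊛ g ≼ f' ⊛ g'
⊛-mono p r = mk≼ λ n → ⊛-mono-at n (λ m _ → le p m) (λ m _ → le r m)

⊛-monoˡ : ∀ {f f'} g → f ≼ f' → f ⊛ g ≼ f' ⊛ g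
⊛-monoˡ g p = ⊛-mono p ≼-refl

⊛-monoʳ : ∀ {g g'} f → g ≼ g' → f ⊛ g ≼ f ⊛ g'
⊛-monoʳ f p = ⊛-mono (≼-refl {f}) p

⊛-congˡ : ∀ {g g'} f → g ≈ g' → f ⊛ g ≈ f ⊛ g'
⊛-congˡ f p = ⊛-cong (≈-refl {f}) p

⊛-congʳ : ∀ {f f'} g → f ≈ f' → f ⊛ g ≈ f' ⊛ g
⊛-congʳ g p = ⊛-cong p (≈-refl {g})

⊕-congˡ : ∀ {g g'} f → g ≈ g' → f ⊕ g ≈ f ⊕ g'
⊕-congˡ f p = ⊕-cong (≈-refl {f}) p

⊕-congʳ : ∀ {f f'} g → f ≈ f' → f ⊕ g ≈ f' ⊕ g
⊕-congʳ g p = ⊕-cong p (≈-refl {g})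

≼-⊕ʳ : ∀ f g → f ≼ f ⊕ g
≼-⊕ʳ f g = mk≼ λ n → m≤m+n (f n) (g n)

≼-⊕ˡ : ∀ f g → g ≼ f ⊕ g
≼-⊕ˡ f g = mk≼ λ n → m≤n+m (g n) (f n)

⊕-cancelʳ-≈ : ∀ {f g} h → f ⊕ h ≈ g ⊕ h → f ≈ g
⊕-cancelʳ-≈ {f} {g} h p = mk≈ λ n → +-cancelʳ-≡ (h n) (f n) (g n) (at p n)

-- Monomials, agreement below a given degree, geometric series

X-+ : ∀ a b → X (a + b) ≈ X a ⊛ X b
X-+ zero    b = ≈-sym (R.*-identityˡ (X b))
X-+ (suc a) b = mk≈ λ { zero → refl ; (suc n) → at (X-+ a b) n }

X-shift : ∀ a f n → (X a ⊛ f) (a + n) ≡ f n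
X-shift zero    f n = ⊛-identityˡ-at f n
X-shift (suc a) f n = X-shift a f n

X-low : ∀ a f n → n < a → (X a ⊛ f) n ≡ 0
X-low (suc a) f zero    _       = refl
X-low (suc a) f (suc n) (s≤s p) = X-low a f n p

X-at-≤ : ∀ a f n → a ≤ n → (X a ⊛ f) n ≡ f (n ∸ a)
X-at-≤ a f n a≤n = trans (cong (X a ⊛ f) (sym (m+[n∸m]≡n a≤n))) (X-shift a f (n ∸ a))

X-split : ∀ a n → (n < a) ⊎ (∃[ m ] n ≡ a + m)
X-split a n with ≤-<-connex a n
... | inj₁ a≤n = inj₂ (n ∸ a , sym (m+[n∸m]≡n a≤n))
... | inj₂ n<a = inj₁ n<a

XX : ∀ a b {c} f → a + b ≡ c → X a ⊛ (X b ⊛ f) ≈ X c ⊛ f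
XX a b f refl = ≈-trans (≈-sym (R.*-assoc (X a) (X b) f)) (⊛-congʳ f (≈-sym (X-+ a b)))

[]-refl : ∀ {N f} → f ≈[ N ] f
[]-refl = mk[] λ _ _ → refl

[]-sym : ∀ {N f g} → f ≈[ N ] g → g ≈[ N ] f
[]-sym p = mk[] λ n l → sym (upTo p n l)

[]-trans : ∀ {N f g h} → f ≈[ N ] g → g ≈[ N ] h → f ≈[ N ] h
[]-trans p r = mk[] λ n l → trans (upTo p n l) (upTo r n l)

≈⇒[] : ∀ {N f g} → f ≈ g → f ≈[ N ] g
≈⇒[] p = mk[] λ n _ → at p n

[]⇒≈ : ∀ {f g} → (∀ N → f ≈[ N ] g) → f ≈ g
[]⇒≈ p = mk≈ λ n → upTo (p (suc n)) n ≤-refl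

[]-weaken : ∀ {M N f g} → M ≤ N → f ≈[ N ] g → f ≈[ M ] g
[]-weaken M≤N p = mk[] λ n l → upTo p n (<-≤-trans l M≤N)

[]-⊕ : ∀ {N f f' g g'} → f ≈[ N ] f' → g ≈[ N ] g' → f ⊕ g ≈[ N ] f' ⊕ g'
[]-⊕ p r = mk[] λ n l → cong₂ _+_ (upTo p n l) (upTo r n l)

[]-⊛ : ∀ {N f f' g g'} → f ≈[ N ] f' → g ≈[ N ] g' → f ⊛ g ≈[ N ] f' ⊛ g'
[]-⊛ p r = mk[] λ n l → ⊛-cong-at n (λ m m≤n → upTo p m (≤-<-trans m≤n l)) (λ m m≤n → upTo r m (≤-<-trans m≤n l))

[]-X : ∀ {N f g} a → f ≈[ N ] g → X a ⊛ f ≈[ a + N ] X a ⊛ g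
[]-X {N} {f} {g} a p = mk[] λ n l → go n l (X-split a n)
  where
  go : ∀ n → n < a + N → (n < a) ⊎ (∃[ m ] n ≡ a + m) → (X a ⊛ f) n ≡ (X a ⊛ g) n
  go n l (inj₁ n<a) = trans (X-low a f n n<a) (sym (X-low a g n n<a))
  go .(a + m) l (inj₂ (m , refl)) =
    trans (X-shift a f m) (trans (upTo p m (+-cancelˡ-< a m N l)) (sym (X-shift a g m)))

X≈[]O : ∀ a f → X a ⊛ f ≈[ a ] O
X≈[]O a f = mk[] λ n l → X-low a f n l

-- Since a > 0, the equation f = g + qᵃ f determines each coefficient of f from lower ones. This
-- replaces division by 1 - qᵃ.
fix-unique[] : ∀ {a f g f' g' N} → 0 < a → f ≈ g ⊕ X a ⊛ f → f' ≈ g' ⊕ X a ⊛ f' → g ≈[ N ] g' → f ≈[ N ] f'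
fix-unique[] {suc a} {f} {g} {f'} {g'} {N} _ p p' r = go N ≤-refl
  where
  go : ∀ M → M ≤ N → f ≈[ M ] f'
  go zero    _   = mk[] λ _ ()
  go (suc M) M≤N =
    []-trans (≈⇒[] p) ([]-trans ([]-⊕ ([]-weaken M≤N r)
      ([]-weaken (s≤s (m≤n+m M a)) ([]-X (suc a) (go M (<⇒≤ M≤N))))) ([]-sym (≈⇒[] p')))

fix-unique : ∀ {a f g f'} → 0 < a → f ≈ g ⊕ X a ⊛ f → f' ≈ g ⊕ X a ⊛ f' → f ≈ f'
fix-unique a>0 p p' = []⇒≈ λ N → fix-unique[] {N = N} a>0 p p' []-refl

-- comb b c is the series Σᵢ q^(c + i (b + 1)).
comb : ℕ → ℕ → Series
comb b zero    zero    = 1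
comb b zero    (suc n) = comb b b n
comb b (suc c) zero    = 0
comb b (suc c) (suc n) = comb b c n

geo : ℕ → Series
geo zero    = I
geo (suc b) = comb b 0

geo-unfold : ∀ {a} → 0 < a → geo a ≈ I ⊕ X a ⊛ geo a
geo-unfold {suc b} _ = mk≈ λ { zero → refl ; (suc n) → at (comb-shift b) n }
  where
  comb-shift : ∀ c → comb b c ≈ X c ⊛ comb b 0
  comb-shift zero    = ≈-sym (R.*-identityˡ (comb b 0))
  comb-shift (suc c) = mk≈ λ { zero → refl ; (suc n) → at (comb-shift c) n }


geo-⊛-unfold : ∀ {a} f → 0 < a → geo a ⊛ f ≈ f ⊕ X a ⊛ (geo a ⊛ f)
geo-⊛-unfold {a} f a>0 = ≈-trans (⊛-congʳ f (geo-unfold a>0))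
  (solve 3 (λ x g f → (con 1 :+ x :* g) :* f := f :+ x :* (g :* f)) ≈-refl (X a) (geo a) f)

geo-solves : ∀ {a f g} → 0 < a → f ≈ g ⊕ X a ⊛ f → f ≈ geo a ⊛ g
geo-solves {a} {f} {g} a>0 p = fix-unique a>0 p (geo-⊛-unfold g a>0)

geo≈[]I : ∀ a → geo a ≈[ a ] I
geo≈[]I zero    = []-refl
geo≈[]I (suc b) = []-trans (≈⇒[] (geo-unfold (s≤s z≤n)))
  ([]-trans ([]-⊕ []-refl (X≈[]O (suc b) (geo (suc b)))) (≈⇒[] (R.+-identityʳ I)))

I≼geo : ∀ {a} → 0 < a → I ≼ geo a
I≼geo {a} a>0 = ≼-trans (≼-⊕ʳ I (X a ⊛ geo a)) (≈⇒≼ (≈-sym (geo-unfold a>0)))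

-- Both sides solve f = 1 + qᵃ f.
geo-double : ∀ {a} → 0 < a → geo a ≈ (I ⊕ X a) ⊛ geo (a + a)
geo-double {a} a>0 = fix-unique {a} {g = I} a>0 (geo-unfold a>0) (begin
  (I ⊕ X a) ⊛ g  ≈⟨ solve 2 (λ x g → (con 1 :+ x) :* g := g :+ x :* g) ≈-refl (X a) g ⟩
  g ⊕ X a ⊛ g  ≈⟨ ⊕-congʳ (X a ⊛ g) (geo-unfold (≤-trans a>0 (m≤m+n a a))) ⟩
  I ⊕ X (a + a) ⊛ g ⊕ X a ⊛ g  ≈⟨ ⊕-congʳ (X a ⊛ g) (⊕-congˡ I (⊛-congʳ g (X-+ a a))) ⟩
  I ⊕ X a ⊛ X a ⊛ g ⊕ X a ⊛ g  ≈⟨ solve 2 (λ x g → con 1 :+ x :* x :* g :+ x :* g := con 1 :+ x :* ((con 1 :+ x) :* g)) ≈-refl (X a) g ⟩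
  I ⊕ X a ⊛ ((I ⊕ X a) ⊛ g)  ∎)
  where
  open ≈R
  g = geo (a + a)

-- Summation

Σ< : ℕ → (ℕ → ℕ) → ℕ
Σ< zero    f = 0
Σ< (suc n) f = Σ< n f + f n

Σ<-cong : ∀ n {f g : ℕ → ℕ} → (∀ i → i < n → f i ≡ g i) → Σ< n f ≡ Σ< n g
Σ<-cong zero    p = refl
Σ<-cong (suc n) p = cong₂ _+_ (Σ<-cong n (λ i l → p i (m≤n⇒m≤1+n l))) (p n ≤-refl)

Σ<-mono : ∀ n {f g : ℕ → ℕ} → (∀ i → i < n → f i ≤ g i) → Σ< n f ≤ Σ< n g
Σ<-mono zero    p = z≤n
Σ<-mono (suc n) p = +-mono-≤ (Σ<-mono n (λ i l → p i (m≤n⇒m≤1+n l))) (p n ≤-refl)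

Σ<-+ : ∀ n f g → Σ< n (λ i → f i + g i) ≡ Σ< n f + Σ< n g
Σ<-+ zero    f g = refl
Σ<-+ (suc n) f g = trans (cong (_+ (f n + g n)) (Σ<-+ n f g)) (lemma (Σ< n f) (Σ< n g) (f n) (g n))
  where
  lemma : ∀ a b c d → a + b + (c + d) ≡ a + c + (b + d)
  lemma = NS.solve-∀

Σ<-* : ∀ n c f → Σ< n (λ i → c * f i) ≡ c * Σ< n f
Σ<-* zero    c f = sym (*-zeroʳ c)
Σ<-* (suc n) c f = trans (cong (_+ c * f n) (Σ<-* n c f)) (sym (*-distribˡ-+ c (Σ< n f) (f n)))

Σ<-head : ∀ n f → Σ< (suc n) f ≡ f 0 + Σ< n (λ i → f (suc i))
Σ<-head zero    f = sym (+-identityʳ (f 0))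
Σ<-head (suc n) f = trans (cong (_+ f (suc n)) (Σ<-head n f)) (+-assoc (f 0) _ _)

Σ<-extend : ∀ m n f → (∀ i → m ≤ i → f i ≡ 0) → Σ< (n + m) f ≡ Σ< m f
Σ<-extend m zero    f p = refl
Σ<-extend m (suc n) f p = trans (cong₂ _+_ (Σ<-extend m n f p) (p (n + m) (m≤n+m m n))) (+-identityʳ _)

Σ<-stable : ∀ {m n} f → m ≤ n → (∀ i → m ≤ i → f i ≡ 0) → Σ< n f ≡ Σ< m f
Σ<-stable {m} {n} f m≤n p = trans (cong (λ k → Σ< k f) (sym (m∸n+n≡m m≤n))) (Σ<-extend m (n ∸ m) f p)

Σ<-zero : ∀ n → Σ< n (λ _ → 0) ≡ 0
Σ<-zero zero    = refl
Σ<-zero (suc n) = trans (+-identityʳ _) (Σ<-zero n)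

ΣS : ℕ → (ℕ → Series) → Series
ΣS K F n = Σ< K (λ k → F k n)

ΣS-⊛ : ∀ K F g → ΣS K F ⊛ g ≈ ΣS K (λ k → F k ⊛ g)
ΣS-⊛ zero    F g = R.zeroˡ g
ΣS-⊛ (suc K) F g = ≈-trans (R.distribʳ g (ΣS K F) (F K)) (⊕-congʳ (F K ⊛ g) (ΣS-⊛ K F g))

ΣS-cong : ∀ K {F G} → (∀ k → F k ≈ G k) → ΣS K F ≈ ΣS K G
ΣS-cong K p = mk≈ λ n → Σ<-cong K (λ k _ → at (p k) n)

-- A family summable in the q-adic topology.
Small : (ℕ → Series) → Set
Small F = ∀ k n → n < k → F k n ≡ 0

-- In a `Small` family the terms of index above n vanish in degree n, so cutting the sum off there
-- gives the full sum.
Σ∞ : (ℕ → Series) → Series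
Σ∞ F n = Σ< (suc n) (λ k → F k n)

Σ∞-at : ∀ {F} → Small F → ∀ {n L} → n < L → Σ< L (λ k → F k n) ≡ Σ∞ F n
Σ∞-at {F} s {n} n<L = Σ<-stable (λ k → F k n) n<L (λ k n<k → s k n n<k)

small-⊛ : ∀ {F} → Small F → ∀ g → Small (λ k → F k ⊛ g)
small-⊛ {F} s g k n n<k = trans
  (⊛-cong-at {F k} {O} {g} {g} n (λ m m≤n → s k m (≤-<-trans m≤n n<k)) (λ _ _ → refl)) (⊛-zeroˡ-at g n)

Σ∞-⊛ : ∀ {F} → Small F → ∀ g → Σ∞ F ⊛ g ≈ Σ∞ (λ k → F k ⊛ g)
Σ∞-⊛ {F} s g = mk≈ λ n → trans
  (⊛-cong-at n (λ m m≤n → sym (Σ∞-at s (s≤s m≤n))) (λ _ _ → refl))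
  (at (ΣS-⊛ (suc n) F g) n)

Σ∞-cong : ∀ {F G} → (∀ k → F k ≈ G k) → Σ∞ F ≈ Σ∞ G
Σ∞-cong p = mk≈ λ n → Σ<-cong (suc n) (λ k _ → at (p k) n)

Σ∞-mono : ∀ {F G} → (∀ k → F k ≼ G k) → Σ∞ F ≼ Σ∞ G
Σ∞-mono p = mk≼ λ n → Σ<-mono (suc n) (λ k _ → le (p k) n)

Σ∞-⊕ : ∀ F G → Σ∞ (λ k → F k ⊕ G k) ≈ Σ∞ F ⊕ Σ∞ G
Σ∞-⊕ F G = mk≈ λ n → Σ<-+ (suc n) (λ k → F k n) (λ k → G k n)

Σ∞-head : ∀ {F} → Small F → Σ∞ F ≈ F 0 ⊕ Σ∞ (λ k → F (suc k))
Σ∞-head {F} s = mk≈ λ n → trans (sym (Σ∞-at s (m≤n⇒m≤1+n ≤-refl)))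
  (Σ<-head (suc n) (λ k → F k n))

infixl 7 _·_
_·_ : ℕ → Series → Series
(k · f) n = k * f n

·-⊛ : ∀ k f g → (k · f) ⊛ g ≈ k · (f ⊛ g)
·-⊛ k f g = mk≈ λ n → ⊛-scale-at k f g n

⊛-· : ∀ k f g → f ⊛ (k · g) ≈ k · (f ⊛ g)
⊛-· k f g = ≈-trans (R.*-comm f (k · g)) (≈-trans (·-⊛ k g f)
  (mk≈ λ n → cong (k *_) (⊛-comm-at g f n)))

·-mono : ∀ {f g} k → f ≼ g → k · f ≼ k · g
·-mono k p = mk≼ λ n → *-monoʳ-≤ k (le p n)

·-cong : ∀ {f g} k → f ≈ g → k · f ≈ k · g
·-cong k p = mk≈ λ n → cong (k *_) (at p n)

small-· : ∀ {F} → Small F → Small (λ k → k · F k)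
small-· s k n n<k = trans (cong (k *_) (s k n n<k)) (*-zeroʳ k)

Σ∞-⊛ˡ : ∀ {F} → Small F → ∀ g → Σ∞ (λ k → g ⊛ F k) ≈ g ⊛ Σ∞ F
Σ∞-⊛ˡ {F} s g = ≈-trans (Σ∞-cong (λ k → R.*-comm g (F k))) (≈-trans (≈-sym (Σ∞-⊛ s g)) (R.*-comm (Σ∞ F) g))

-- Distinct parts from an arithmetic progression

≡⇒≈ : ∀ {f g} → f ≡ g → f ≈ g
≡⇒≈ refl = ≈-refl

ord-⊛ : ∀ {k} f g → f ≈[ k ] O → g ⊛ f ≈[ k ] O
ord-⊛ f g o = []-trans ([]-⊛ ([]-refl {f = g}) o) (≈⇒[] (R.zeroʳ g))

ord-X : ∀ {k f a} → 0 < a → f ≈[ k ] O → X a ⊛ f ≈[ suc k ] O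
ord-X {k} {f} {a} a>0 o = []-trans ([]-weaken (+-monoˡ-≤ k a>0) ([]-X a o)) (≈⇒[] (R.zeroʳ (X a)))

-- eul a d m = q^(ma + d m(m-1)/2) / ((1 - q^d) ⋯ (1 - q^(dm))) counts the partitions
-- into m distinct parts from a, a + d, a + 2d, …
eul : ℕ → ℕ → ℕ → Series
eul a d zero    = I
eul a d (suc m) = X (a + d * m) ⊛ (geo (d * suc m) ⊛ eul a d m)

eul-ord : ∀ {a} d → 0 < a → ∀ m → eul a d m ≈[ m ] O
eul-ord d a>0 zero    = mk[] λ _ ()
eul-ord {a} d a>0 (suc m) = ord-X (≤-trans a>0 (m≤m+n a (d * m))) (ord-⊛ (eul a d m) (geo (d * suc m)) (eul-ord d a>0 m))

eul-small : ∀ {a} d → 0 < a → Small (eul a d)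
eul-small d a>0 m n n<m = upTo (eul-ord d a>0 m) n n<m

-- Raising each of the m parts by d adds d m to the size.
eul-scale : ∀ a d m → eul (a + d) d m ≈ X (d * m) ⊛ eul a d m
eul-scale a d zero    = ≈-sym (≈-trans (⊛-congʳ I (≡⇒≈ (cong X (*-zeroʳ d)))) (R.*-identityˡ I))
eul-scale a d (suc m) = begin
  X (a + d + d * m) ⊛ (g ⊛ eul (a + d) d m)  ≈⟨ ⊛-congˡ (X (a + d + d * m)) (⊛-congˡ g (eul-scale a d m)) ⟩
  X (a + d + d * m) ⊛ (g ⊛ (X (d * m) ⊛ e))  ≈⟨ solve 4 (λ x g y e → x :* (g :* (y :* e)) := x :* (y :* (g :* e))) ≈-refl (X (a + d + d * m)) g (X (d * m)) e ⟩
  X (a + d + d * m) ⊛ (X (d * m) ⊛ (g ⊛ e))  ≈⟨ XX (a + d + d * m) (d * m) (g ⊛ e) (exps a d m) ⟩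
  X (d * suc m + (a + d * m)) ⊛ (g ⊛ e)  ≈⟨ XX (d * suc m) (a + d * m) (g ⊛ e) refl ⟨
  X (d * suc m) ⊛ (X (a + d * m) ⊛ (g ⊛ e))  ∎
  where
  open ≈R
  e = eul a d m
  g = geo (d * suc m)
  exps : ∀ a d m → a + d + d * m + d * m ≡ d * suc m + (a + d * m)
  exps = NS.solve-∀

-- The two terms are the partitions without and with the part a.
eul-peel : ∀ a {d} m → 0 < d → eul a d (suc m) ≈ eul (a + d) d (suc m) ⊕ X a ⊛ eul (a + d) d m
eul-peel a {d} m d>0 = begin
  X (a + d * m) ⊛ (g ⊛ e)
    ≈⟨ ⊛-congˡ (X (a + d * m)) (geo-⊛-unfold e (*-mono-≤ d>0 (s≤s z≤n))) ⟩
  X (a + d * m) ⊛ (e ⊕ X D ⊛ (g ⊛ e))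
    ≈⟨ solve 4 (λ x d g e → x :* (e :+ d :* (g :* e)) := d :* (x :* (g :* e)) :+ x :* e) ≈-refl (X (a + d * m)) (X D) g e ⟩
  X D ⊛ (X (a + d * m) ⊛ (g ⊛ e)) ⊕ X (a + d * m) ⊛ e
    ≈⟨ ⊕-cong (eul-scale a d (suc m)) (XX a (d * m) e refl) ⟨
  eul (a + d) d (suc m) ⊕ X a ⊛ (X (d * m) ⊛ e)
    ≈⟨ ⊕-congˡ (eul (a + d) d (suc m)) (⊛-congˡ (X a) (eul-scale a d m)) ⟨
  eul (a + d) d (suc m) ⊕ X a ⊛ eul (a + d) d m ∎
  where
  open ≈R
  e = eul a d m
  D = d * suc m
  g = geo D

-- Dist a d = (1 + q^a)(1 + q^(a+d))(1 + q^(a+2d))⋯, and Len a d weights each of the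
-- partitions it counts by its number of parts.
Dist : ℕ → ℕ → Series
Dist a d = Σ∞ (eul a d)

Len : ℕ → ℕ → Series
Len a d = Σ∞ (λ m → m · eul a d m)

Dist-unfold : ∀ {a d} → 0 < a → 0 < d → Dist a d ≈ (I ⊕ X a) ⊛ Dist (a + d) d
Dist-unfold {a} {d} a>0 d>0 = begin
  Σ∞ (eul a d)  ≈⟨ Σ∞-head (eul-small d a>0) ⟩
  I ⊕ Σ∞ (λ m → eul a d (suc m))  ≈⟨ ⊕-congˡ I (Σ∞-cong λ m → eul-peel a m d>0) ⟩
  I ⊕ Σ∞ (λ m → e' (suc m) ⊕ X a ⊛ e' m)  ≈⟨ ⊕-congˡ I (Σ∞-⊕ (λ m → e' (suc m)) (λ m → X a ⊛ e' m)) ⟩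
  I ⊕ (Σ∞ (λ m → e' (suc m)) ⊕ Σ∞ (λ m → X a ⊛ e' m))  ≈⟨ R.+-assoc I (Σ∞ (λ m → e' (suc m))) (Σ∞ (λ m → X a ⊛ e' m)) ⟨
  I ⊕ Σ∞ (λ m → e' (suc m)) ⊕ Σ∞ (λ m → X a ⊛ e' m)  ≈⟨ ⊕-cong (≈-sym (Σ∞-head small')) (Σ∞-⊛ˡ small' (X a)) ⟩
  Σ∞ e' ⊕ X a ⊛ Σ∞ e'  ≈⟨ solve 2 (λ x e → e :+ x :* e := (con 1 :+ x) :* e) ≈-refl (X a) (Σ∞ e') ⟩
  (I ⊕ X a) ⊛ Σ∞ e'  ∎
  where
  open ≈R
  e' = eul (a + d) d
  small' = eul-small d (≤-trans a>0 (m≤m+n a d))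

Len-unfold : ∀ {a d} → 0 < a → 0 < d → Len a d ≈ (I ⊕ X a) ⊛ Len (a + d) d ⊕ X a ⊛ Dist (a + d) d
Len-unfold {a} {d} a>0 d>0 = begin
  Σ∞ (λ m → m · eul a d m)  ≈⟨ Σ∞-head (small-· (eul-small d a>0)) ⟩
  O ⊕ Σ∞ (λ m → suc m · eul a d (suc m))  ≈⟨ R.+-identityˡ (Σ∞ (λ m → suc m · eul a d (suc m))) ⟩
  Σ∞ (λ m → suc m · eul a d (suc m))  ≈⟨ Σ∞-cong step ⟩
  Σ∞ (λ m → F (suc m) ⊕ (X a ⊛ F m ⊕ X a ⊛ e' m))  ≈⟨ Σ∞-⊕ (λ m → F (suc m)) (λ m → X a ⊛ F m ⊕ X a ⊛ e' m) ⟩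
  Σ∞ (λ m → F (suc m)) ⊕ Σ∞ (λ m → X a ⊛ F m ⊕ X a ⊛ e' m)
    ≈⟨ ⊕-cong (≈-sym (Σ∞-head smallF)) (Σ∞-⊕ (λ m → X a ⊛ F m) (λ m → X a ⊛ e' m)) ⟩
  Σ∞ F ⊕ (Σ∞ (λ m → X a ⊛ F m) ⊕ Σ∞ (λ m → X a ⊛ e' m))
    ≈⟨ ⊕-congˡ (Σ∞ F) (⊕-cong (Σ∞-⊛ˡ smallF (X a)) (Σ∞-⊛ˡ small' (X a))) ⟩
  Σ∞ F ⊕ (X a ⊛ Σ∞ F ⊕ X a ⊛ Σ∞ e')
    ≈⟨ solve 3 (λ x f e → f :+ (x :* f :+ x :* e) := (con 1 :+ x) :* f :+ x :* e) ≈-refl (X a) (Σ∞ F) (Σ∞ e') ⟩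
  (I ⊕ X a) ⊛ Σ∞ F ⊕ X a ⊛ Σ∞ e'  ∎
  where
  open ≈R
  e' = eul (a + d) d
  F : ℕ → Series
  F m = m · e' m
  small' = eul-small d (≤-trans a>0 (m≤m+n a d))
  smallF = small-· small'
  alg : ∀ m u v → suc m * (u + v) ≡ suc m * u + (m * v + v)
  alg = NS.solve-∀
  step : ∀ m → suc m · eul a d (suc m) ≈ F (suc m) ⊕ (X a ⊛ F m ⊕ X a ⊛ e' m)
  step m = begin
    suc m · eul a d (suc m)  ≈⟨ ·-cong (suc m) (eul-peel a m d>0) ⟩
    suc m · (e' (suc m) ⊕ X a ⊛ e' m)  ≈⟨ mk≈ (λ n → alg m (e' (suc m) n) ((X a ⊛ e' m) n)) ⟩
    F (suc m) ⊕ (m · (X a ⊛ e' m) ⊕ X a ⊛ e' m) ≈⟨ ⊕-congˡ (F (suc m)) (⊕-congʳ (X a ⊛ e' m) (⊛-· m (X a) (e' m))) ⟨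
    F (suc m) ⊕ (X a ⊛ F m ⊕ X a ⊛ e' m)  ∎

Dist≈[]I : ∀ {a} d → 0 < a → Dist a d ≈[ a ] I
Dist≈[]I {a} d a>0 = []-trans (≈⇒[] (Σ∞-head (eul-small d a>0)))
  ([]-trans ([]-⊕ ([]-refl {f = I}) (mk[] vanish)) (≈⇒[] (R.+-identityʳ I)))
  where
  vanish : ∀ n → n < a → Σ∞ (λ m → eul a d (suc m)) n ≡ 0
  vanish n n<a = trans
    (Σ<-cong (suc n) (λ m _ → X-low (a + d * m) (geo (d * suc m) ⊛ eul a d m) n (<-≤-trans n<a (m≤m+n a (d * m)))))
    (Σ<-zero (suc n))

Len≈[]O : ∀ {a} d → 0 < a → Len a d ≈[ a ] O
Len≈[]O {a} d a>0 = []-trans (≈⇒[] (≈-trans (Σ∞-head (small-· (eul-small d a>0))) (R.+-identityˡ (Σ∞ (λ m → suc m · eul a d (suc m))))))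
  (mk[] λ n n<a → trans
    (Σ<-cong (suc n) (λ m _ → trans (cong (suc m *_) (X-low (a + d * m) (geo (d * suc m) ⊛ eul a d m) n (<-≤-trans n<a (m≤m+n a (d * m))))) (*-zeroʳ (suc m))))
    (Σ<-zero (suc n)))

-- Infinite products and Euler's theorem

-- Unfolding both families peels off the same factors, and the remaining tails agree with 1 to ever
-- higher degree because `μ` increases along `s`. All product identities below are instances.
product-unique : ∀ {J : Set} (μ : J → ℕ) (s : J → J) (c F G : J → Series) → (∀ j → μ j < μ (s j)) →
  (∀ j → F j ≈ c j ⊛ F (s j)) → (∀ j → G j ≈ c j ⊛ G (s j)) →
  (∀ j → F j ≈[ μ j ] I) → (∀ j → G j ≈[ μ j ] I) → ∀ j → F j ≈ G j
product-unique μ s c F G inc uF uG iF iG j = []⇒≈ λ N → go N N j (m≤n+m N (μ j))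
  where
  go : ∀ N k j → N ≤ μ j + k → F j ≈[ N ] G j
  go N zero    j l = []-weaken (subst (N ≤_) (+-identityʳ (μ j)) l) ([]-trans (iF j) ([]-sym (iG j)))
  go N (suc k) j l = []-trans (≈⇒[] (uF j))
    ([]-trans ([]-⊛ ([]-refl {f = c j}) (go N k (s j)
      (≤-trans (subst (N ≤_) (+-suc (μ j) k) l) (+-monoˡ-≤ k (inc j))))) ([]-sym (≈⇒[] (uG j))))

module InfiniteProduct (φ : ℕ → Series) (φ≈I : ∀ j → φ j ≈[ j ] I) where

  Pr : ℕ → ℕ → ℕ → Series
  Pr a d zero    = I
  Pr a d (suc T) = φ a ⊛ Pr (a + d) d T

  -- For a, d > 0 the factors after the first n are 1 up to degree n, so n of them determine the
  -- coefficient of degree n.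
  Pr∞ : ℕ → ℕ → Series
  Pr∞ a d n = Pr a d n n

  Pr≈[]I : ∀ a d T → Pr a d T ≈[ a ] I
  Pr≈[]I a d zero    = []-refl
  Pr≈[]I a d (suc T) = []-trans ([]-⊛ (φ≈I a) ([]-weaken (m≤m+n a d) (Pr≈[]I (a + d) d T))) (≈⇒[] (R.*-identityˡ I))

  Pr-stable : ∀ a {d} T k → 0 < d → Pr a d (T + k) ≈[ a + T ] Pr a d T
  Pr-stable a {d} zero    k d>0 = []-weaken (≤-reflexive (+-identityʳ a)) (Pr≈[]I a d k)
  Pr-stable a {d} (suc T) k d>0 = []-⊛ ([]-refl {f = φ a}) ([]-weaken
    (≤-trans (≤-reflexive (+-suc a T)) (+-monoˡ-≤ T (≤-trans (≤-reflexive (+-comm 1 a)) (+-monoʳ-≤ a d>0))))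
    (Pr-stable (a + d) T k d>0))

  Pr≈[]Pr∞ : ∀ {a d} T → 0 < a → 0 < d → Pr a d T ≈[ a + T ] Pr∞ a d
  Pr≈[]Pr∞ {a} {d} T a>0 d>0 = mk[] go
    where
    go : ∀ n → n < a + T → Pr a d T n ≡ Pr a d n n
    go n l with ≤-total T n
    ... | inj₁ T≤n = sym (trans (cong (λ u → Pr a d u n) (sym (m+[n∸m]≡n T≤n))) (upTo (Pr-stable a T (n ∸ T) d>0) n l))
    ... | inj₂ n≤T = trans (cong (λ u → Pr a d u n) (sym (m+[n∸m]≡n n≤T)))
                       (upTo (Pr-stable a n (T ∸ n) d>0) n (+-monoˡ-≤ n a>0))

  Pr∞-unfold : ∀ {a d} → 0 < a → 0 < d → Pr∞ a d ≈ φ a ⊛ Pr∞ (a + d) d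
  Pr∞-unfold {a} {d} a>0 d>0 = []⇒≈ λ N → []-trans
    ([]-weaken (≤-trans (n≤1+n N) (m≤n+m (suc N) a)) ([]-sym (Pr≈[]Pr∞ (suc N) a>0 d>0)))
    ([]-⊛ ([]-refl {f = φ a}) ([]-weaken (m≤n+m N (a + d)) (Pr≈[]Pr∞ N (≤-trans a>0 (m≤m+n a d)) d>0)))

  Pr∞≈[]I : ∀ {a d} → 0 < a → 0 < d → Pr∞ a d ≈[ a ] I
  Pr∞≈[]I {a} a>0 d>0 = []-weaken (m≤m+n a 0) ([]-sym (Pr≈[]Pr∞ 0 a>0 d>0))

  -- The left side is unfolded twice per step, each factor on the right once.
  Pr∞-split : ∀ {a d} → 0 < a → 0 < d → Pr∞ a d ≈ Pr∞ a (d + d) ⊛ Pr∞ (a + d) (d + d)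
  Pr∞-split {a} {d} a>0 d>0 = product-unique {J = ∃[ b ] 0 < b} proj₁ (λ (b , b>0) → b + (d + d) , ≤-trans b>0 (m≤m+n b (d + d)))
    (λ (b , _) → φ b ⊛ φ (b + d)) (λ (b , _) → Pr∞ b d) (λ (b , _) → Pr∞ b (d + d) ⊛ Pr∞ (b + d) (d + d))
    (λ (b , _) → ≤-trans (≤-reflexive (+-comm 1 b)) (+-monoʳ-≤ b dd>0))
    (λ (b , b>0) → begin
      Pr∞ b d  ≈⟨ Pr∞-unfold b>0 d>0 ⟩
      φ b ⊛ Pr∞ (b + d) d  ≈⟨ ⊛-congˡ (φ b) (Pr∞-unfold (b+ b>0) d>0) ⟩
      φ b ⊛ (φ (b + d) ⊛ Pr∞ (b + d + d) d)  ≈⟨ R.*-assoc (φ b) (φ (b + d)) (Pr∞ (b + d + d) d) ⟨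
      φ b ⊛ φ (b + d) ⊛ Pr∞ (b + d + d) d  ≡⟨ cong (λ u → φ b ⊛ φ (b + d) ⊛ Pr∞ u d) (+-assoc b d d) ⟩
      φ b ⊛ φ (b + d) ⊛ Pr∞ (b + (d + d)) d  ∎)
    (λ (b , b>0) → begin
      Pr∞ b (d + d) ⊛ Pr∞ (b + d) (d + d)  ≈⟨ ⊛-cong (Pr∞-unfold b>0 dd>0) (Pr∞-unfold (b+ b>0) dd>0) ⟩
      (φ b ⊛ Pr∞ (b + (d + d)) (d + d)) ⊛ (φ (b + d) ⊛ Pr∞ (b + d + (d + d)) (d + d))
        ≈⟨ solve 4 (λ x y z w → (x :* y) :* (z :* w) := x :* z :* (y :* w)) ≈-refl (φ b) (Pr∞ (b + (d + d)) (d + d)) (φ (b + d)) (Pr∞ (b + d + (d + d)) (d + d)) ⟩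
      φ b ⊛ φ (b + d) ⊛ (Pr∞ (b + (d + d)) (d + d) ⊛ Pr∞ (b + d + (d + d)) (d + d))
        ≡⟨ cong (λ u → φ b ⊛ φ (b + d) ⊛ (Pr∞ (b + (d + d)) (d + d) ⊛ Pr∞ u (d + d))) (exps b d) ⟩
      φ b ⊛ φ (b + d) ⊛ (Pr∞ (b + (d + d)) (d + d) ⊛ Pr∞ (b + (d + d) + d) (d + d)) ∎)
    (λ (b , b>0) → Pr∞≈[]I b>0 d>0)
    (λ (b , b>0) → []-trans ([]-⊛ (Pr∞≈[]I b>0 dd>0) ([]-weaken (m≤m+n b d) (Pr∞≈[]I (b+ b>0) dd>0))) (≈⇒[] (R.*-identityˡ I)))
    (a , a>0)
    where
    open ≈R
    dd>0 : 0 < d + d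
    dd>0 = ≤-trans d>0 (m≤m+n d d)
    b+ : ∀ {b} → 0 < b → 0 < b + d
    b+ {b} b>0 = ≤-trans b>0 (m≤m+n b d)
    exps : ∀ b d → b + d + (d + d) ≡ b + (d + d) + d
    exps = NS.solve-∀

module Geo = InfiniteProduct geo geo≈[]I

I⊕X≈[]I : ∀ j → I ⊕ X j ≈[ j ] I
I⊕X≈[]I j = []-trans ([]-⊕ ([]-refl {f = I}) (mk[] λ n l → trans (sym (trans (⊛-comm-at (X j) I n) (⊛-identityˡ-at (X j) n))) (X-low j I n l)))
  (≈⇒[] (R.+-identityʳ I))

module DistPr = InfiniteProduct (λ j → I ⊕ X j) I⊕X≈[]I

Dist≈Pr∞ : ∀ {a d} → 0 < a → 0 < d → Dist a d ≈ DistPr.Pr∞ a d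
Dist≈Pr∞ {a} {d} a>0 d>0 = product-unique {J = ∃[ b ] 0 < b} proj₁ (λ (b , b>0) → b + d , ≤-trans b>0 (m≤m+n b d))
  (λ (b , _) → I ⊕ X b) (λ (b , _) → Dist b d) (λ (b , _) → DistPr.Pr∞ b d)
  (λ (b , _) → ≤-trans (≤-reflexive (+-comm 1 b)) (+-monoʳ-≤ b d>0))
  (λ (b , b>0) → Dist-unfold b>0 d>0) (λ (b , b>0) → DistPr.Pr∞-unfold b>0 d>0)
  (λ (b , b>0) → Dist≈[]I d b>0) (λ (b , b>0) → DistPr.Pr∞≈[]I b>0 d>0) (a , a>0)

Dist-split : ∀ {a d} → 0 < a → 0 < d → Dist a d ≈ Dist a (d + d) ⊛ Dist (a + d) (d + d)
Dist-split {a} {d} a>0 d>0 = ≈-trans (Dist≈Pr∞ a>0 d>0) (≈-trans (DistPr.Pr∞-split a>0 d>0)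
  (⊛-cong (≈-sym (Dist≈Pr∞ a>0 dd>0)) (≈-sym (Dist≈Pr∞ (≤-trans a>0 (m≤m+n a d)) dd>0))))
  where dd>0 = ≤-trans d>0 (m≤m+n d d)

-- Each factor is 1/(1 - qᵃ) = (1 + qᵃ)/(1 - q²ᵃ).
Dist-geo : ∀ {a d} → 0 < a → 0 < d → Dist a d ⊛ Geo.Pr∞ (a + a) (d + d) ≈ Geo.Pr∞ a d
Dist-geo {a} {d} a>0 d>0 = product-unique {J = ∃[ b ] 0 < b} proj₁ (λ (b , b>0) → b + d , ≤-trans b>0 (m≤m+n b d))
  (λ (b , _) → geo b) (λ (b , _) → Dist b d ⊛ Geo.Pr∞ (b + b) (d + d)) (λ (b , _) → Geo.Pr∞ b d)
  (λ (b , _) → ≤-trans (≤-reflexive (+-comm 1 b)) (+-monoʳ-≤ b d>0))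
  (λ (b , b>0) → begin
    Dist b d ⊛ Geo.Pr∞ (b + b) (d + d)
      ≈⟨ ⊛-cong (Dist-unfold b>0 d>0) (Geo.Pr∞-unfold (bb b>0) dd>0) ⟩
    ((I ⊕ X b) ⊛ Dist (b + d) d) ⊛ (geo (b + b) ⊛ Geo.Pr∞ (b + b + (d + d)) (d + d))
      ≈⟨ solve 4 (λ x y z w → (x :* y) :* (z :* w) := x :* z :* (y :* w)) ≈-refl (I ⊕ X b) (Dist (b + d) d) (geo (b + b)) (Geo.Pr∞ (b + b + (d + d)) (d + d)) ⟩
    (I ⊕ X b) ⊛ geo (b + b) ⊛ (Dist (b + d) d ⊛ Geo.Pr∞ (b + b + (d + d)) (d + d))
      ≈⟨ ⊛-cong (≈-sym (geo-double b>0)) (≡⇒≈ (cong (λ u → Dist (b + d) d ⊛ Geo.Pr∞ u (d + d)) (exps b d))) ⟩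
    geo b ⊛ (Dist (b + d) d ⊛ Geo.Pr∞ (b + d + (b + d)) (d + d)) ∎)
  (λ (b , b>0) → Geo.Pr∞-unfold b>0 d>0)
  (λ (b , b>0) → []-trans ([]-⊛ (Dist≈[]I d b>0) ([]-weaken (m≤m+n b b) (Geo.Pr∞≈[]I (bb b>0) dd>0))) (≈⇒[] (R.*-identityˡ I)))
  (λ (b , b>0) → Geo.Pr∞≈[]I b>0 d>0) (a , a>0)
  where
  open ≈R
  dd>0 : 0 < d + d
  dd>0 = ≤-trans d>0 (m≤m+n d d)
  bb : ∀ {b} → 0 < b → 0 < b + b
  bb {b} b>0 = ≤-trans b>0 (m≤m+n b b)
  exps : ∀ b d → b + b + (d + d) ≡ b + d + (b + d)
  exps = NS.solve-∀

-- Euler's theorem: both sides are F(q) with F(q) = (-q; q²)∞ F(q²).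
euler : ∀ {a} → 0 < a → Dist a a ≈ Geo.Pr∞ a (a + a)
euler {a} a>0 = product-unique {J = ∃[ b ] 0 < b} proj₁ (λ (b , b>0) → b + b , ≤-trans b>0 (m≤m+n b b))
  (λ (b , _) → Dist b (b + b)) (λ (b , _) → Dist b b) (λ (b , _) → Geo.Pr∞ b (b + b))
  (λ (b , b>0) → ≤-trans (≤-reflexive (+-comm 1 b)) (+-monoʳ-≤ b b>0))
  (λ (b , b>0) → Dist-split b>0 b>0)
  (λ (b , b>0) → ≈-sym (Dist-geo b>0 (≤-trans b>0 (m≤m+n b b))))
  (λ (b , b>0) → Dist≈[]I b b>0) (λ (b , b>0) → Geo.Pr∞≈[]I b>0 (≤-trans b>0 (m≤m+n b b))) (a , a>0)

-- The product for parts congruent to 1, 5, 6 modulo 8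

partOK2-periodic : ∀ r t → partOK2 (r + t * 8) ≡ partOK2 r
partOK2-periodic r t = cong (λ u → (u ≡ᵇ 1) ∨ (u ≡ᵇ 5) ∨ (u ≡ᵇ 6)) ([m+kn]%n≡m%n r t 8)

resFactor : ℕ → Series
resFactor p = if partOK2 p then geo p else I

resFactor≈[]I : ∀ j → resFactor j ≈[ j ] I
resFactor≈[]I j with partOK2 j
... | true  = geo≈[]I j
... | false = []-refl

module Res = InfiniteProduct resFactor resFactor≈[]I

next : ∀ {a} → 0 < a → Res.Pr∞ a 1 ≈ resFactor a ⊛ Res.Pr∞ (suc a) 1
next {a} a>0 = ≈-trans (Res.Pr∞-unfold a>0 (s≤s z≤n)) (≡⇒≈ (cong (λ u → resFactor a ⊛ Res.Pr∞ u 1) (+-comm a 1)))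

next-geo : ∀ r t f → partOK2 (suc r) ≡ true → Res.Pr∞ (suc (suc r + t * 8)) 1 ≈ f →
           Res.Pr∞ (suc r + t * 8) 1 ≈ geo (suc r + t * 8) ⊛ f
next-geo r t f ok p = ≈-trans (next (s≤s z≤n)) (⊛-cong
  (≡⇒≈ (cong (λ b → if b then geo (suc r + t * 8) else I) (trans (partOK2-periodic (suc r) t) ok))) p)

next-I : ∀ r t f → partOK2 (suc r) ≡ false → Res.Pr∞ (suc (suc r + t * 8)) 1 ≈ f → Res.Pr∞ (suc r + t * 8) 1 ≈ f
next-I r t f ok p = ≈-trans (next (s≤s z≤n)) (≈-trans (⊛-cong
  (≡⇒≈ (cong (λ b → if b then geo (suc r + t * 8) else I) (trans (partOK2-periodic (suc r) t) ok))) p) (R.*-identityˡ f))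

-- One step consumes a full period of eight factors on the left, of which five are 1.
residue-product : Res.Pr∞ 1 1 ≈ Geo.Pr∞ 1 8 ⊛ Geo.Pr∞ 5 8 ⊛ Geo.Pr∞ 6 8
residue-product = product-unique (λ t → 1 + t * 8) suc
  (λ t → geo (1 + t * 8) ⊛ geo (5 + t * 8) ⊛ geo (6 + t * 8))
  (λ t → Res.Pr∞ (1 + t * 8) 1)
  (λ t → Geo.Pr∞ (1 + t * 8) 8 ⊛ Geo.Pr∞ (5 + t * 8) 8 ⊛ Geo.Pr∞ (6 + t * 8) 8)
  (λ t → s≤s (s≤s (m≤n+m (t * 8) 7)))
  (λ t → let F = Res.Pr∞ (9 + t * 8) 1 in ≈-trans
    (next-geo 0 t (geo (5 + t * 8) ⊛ (geo (6 + t * 8) ⊛ F)) refl (next-I 1 t (geo (5 + t * 8) ⊛ (geo (6 + t * 8) ⊛ F)) refl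
      (next-I 2 t (geo (5 + t * 8) ⊛ (geo (6 + t * 8) ⊛ F)) refl (next-I 3 t (geo (5 + t * 8) ⊛ (geo (6 + t * 8) ⊛ F)) refl
      (next-geo 4 t (geo (6 + t * 8) ⊛ F) refl (next-geo 5 t F refl (next-I 6 t F refl (next-I 7 t F refl ≈-refl))))))))
    (solve 4 (λ x y z w → x :* (y :* (z :* w)) := x :* y :* z :* w) ≈-refl (geo (1 + t * 8)) (geo (5 + t * 8)) (geo (6 + t * 8)) F))
  (λ t → ≈-trans (⊛-cong (⊛-cong (step 0 t) (step 4 t)) (step 5 t))
    (solve 6 (λ x y z u v w → (x :* u) :* (y :* v) :* (z :* w) := x :* y :* z :* (u :* v :* w)) ≈-refl
      (geo (1 + t * 8)) (geo (5 + t * 8)) (geo (6 + t * 8)) (Geo.Pr∞ (9 + t * 8) 8) (Geo.Pr∞ (13 + t * 8) 8) (Geo.Pr∞ (14 + t * 8) 8)))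
  (λ t → Res.Pr∞≈[]I (s≤s z≤n) (s≤s z≤n))
  (λ t → []-trans ([]-⊛ ([]-⊛ (Geo.Pr∞≈[]I (s≤s z≤n) (s≤s z≤n))
      ([]-weaken (s≤s (m≤n+m (t * 8) 4)) (Geo.Pr∞≈[]I (s≤s z≤n) (s≤s z≤n))))
      ([]-weaken (s≤s (m≤n+m (t * 8) 5)) (Geo.Pr∞≈[]I (s≤s z≤n) (s≤s z≤n))))
    (≈⇒[] (solve 0 (con 1 :* con 1 :* con 1 := con 1) ≈-refl)))
  0
  where
  step : ∀ r t → Geo.Pr∞ (suc r + t * 8) 8 ≈ geo (suc r + t * 8) ⊛ Geo.Pr∞ (suc r + suc t * 8) 8
  step r t = ≈-trans (Geo.Pr∞-unfold {suc r + t * 8} (s≤s z≤n) (s≤s z≤n))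
    (≡⇒≈ (cong (λ u → geo (suc r + t * 8) ⊛ Geo.Pr∞ u 8) (lemma r (t * 8))))
    where
    lemma : ∀ r u → suc r + u + 8 ≡ suc r + (8 + u)
    lemma = NS.solve-∀

-- Counts pairs of a partition into distinct parts ≡ 1 mod 4 and one into distinct even parts.
P : Series
P = Dist 1 4 ⊛ Dist 2 2

pos : ∀ {n} → 0 < suc n
pos = s≤s z≤n

-- By Euler's theorem the distinct even parts become parts congruent to 2 modulo 4, that is, to 2 or
-- 6 modulo 8. Those congruent to 2 modulo 8 combine with the distinct parts congruent to 1 modulo 4
-- into arbitrary parts congruent to 1 modulo 4.
P≈geos : P ≈ Geo.Pr∞ 1 8 ⊛ Geo.Pr∞ 5 8 ⊛ Geo.Pr∞ 6 8
P≈geos = begin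
  Dist 1 4 ⊛ Dist 2 2  ≈⟨ ⊛-congˡ (Dist 1 4) (≈-trans (euler pos) (Geo.Pr∞-split pos pos)) ⟩
  Dist 1 4 ⊛ (Geo.Pr∞ 2 8 ⊛ Geo.Pr∞ 6 8)  ≈⟨ R.*-assoc (Dist 1 4) (Geo.Pr∞ 2 8) (Geo.Pr∞ 6 8) ⟨
  Dist 1 4 ⊛ Geo.Pr∞ 2 8 ⊛ Geo.Pr∞ 6 8  ≈⟨ ⊛-congʳ (Geo.Pr∞ 6 8) (≈-trans (Dist-geo pos pos) (Geo.Pr∞-split pos pos)) ⟩
  Geo.Pr∞ 1 8 ⊛ Geo.Pr∞ 5 8 ⊛ Geo.Pr∞ 6 8  ∎
  where open ≈R

P≈Res : P ≈ Res.Pr∞ 1 1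
P≈Res = ≈-trans P≈geos (≈-sym residue-product)

-- f n ≤ f (suc n) for all n
Mono : Series → Set
Mono f = X 1 ⊛ f ≼ f

X-mono : ∀ a {f} → Mono f → X a ⊛ f ≼ f
X-mono zero    {f} m = ≈⇒≼ (R.*-identityˡ f)
X-mono (suc a) {f} m = ≼-trans (≈⇒≼ (≈-sym (XX 1 a f refl))) (≼-trans (⊛-monoʳ (X 1) (X-mono a m)) m)

geo-shift : ∀ {a} f → 0 < a → X a ⊛ (geo a ⊛ f) ≼ geo a ⊛ f
geo-shift {a} f a>0 = ≼-trans (≼-⊕ˡ f (X a ⊛ (geo a ⊛ f))) (≈⇒≼ (≈-sym (geo-⊛-unfold f a>0)))

Mono-geo1 : ∀ f → Mono (geo 1 ⊛ f)
Mono-geo1 f = geo-shift f pos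

Mono-cong : ∀ {f g} → f ≈ g → Mono f → Mono g
Mono-cong f≈g m = ≼-trans (≈⇒≼ (⊛-congˡ (X 1) (≈-sym f≈g))) (≼-trans m (≈⇒≼ f≈g))

Mono-⊛ : ∀ {f} g → Mono f → Mono (g ⊛ f)
Mono-⊛ {f} g m = ≼-trans (≈⇒≼ (solve 3 (λ x g f → x :* (g :* f) := g :* (x :* f)) ≈-refl (X 1) g f)) (⊛-monoʳ g m)

P-noOnes : Series
P-noOnes = Geo.Pr∞ 9 8 ⊛ Geo.Pr∞ 5 8 ⊛ Geo.Pr∞ 6 8

P≈geo1 : P ≈ geo 1 ⊛ P-noOnes
P≈geo1 = begin
  P  ≈⟨ P≈geos ⟩
  Geo.Pr∞ 1 8 ⊛ Geo.Pr∞ 5 8 ⊛ Geo.Pr∞ 6 8  ≈⟨ ⊛-congʳ (Geo.Pr∞ 6 8) (⊛-congʳ (Geo.Pr∞ 5 8) (Geo.Pr∞-unfold pos pos)) ⟩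
  geo 1 ⊛ Geo.Pr∞ 9 8 ⊛ Geo.Pr∞ 5 8 ⊛ Geo.Pr∞ 6 8  ≈⟨ solve 4 (λ x y z w → x :* y :* z :* w := x :* (y :* z :* w)) ≈-refl (geo 1) (Geo.Pr∞ 9 8) (Geo.Pr∞ 5 8) (Geo.Pr∞ 6 8) ⟩
  geo 1 ⊛ P-noOnes  ∎
  where open ≈R

P-mono : Mono P
P-mono = Mono-cong (≈-sym P≈geo1) (Mono-geo1 P-noOnes)

-- P' = P / (1 + q)
P' : Series
P' = Dist 5 4 ⊛ Dist 2 2

P≈P' : P ≈ P' ⊕ X 1 ⊛ P'
P≈P' = ≈-trans (⊛-congʳ (Dist 2 2) (Dist-unfold {1} {4} pos pos))
  (solve 3 (λ x f g → (con 1 :+ x) :* f :* g := f :* g :+ x :* (f :* g)) ≈-refl (X 1) (Dist 5 4) (Dist 2 2))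

1+X-cancel : ∀ {f g} → f ⊕ X 1 ⊛ f ≈ g ⊕ X 1 ⊛ g → f ≈ g
1+X-cancel {f} {g} p = mk≈ go
  where
  go : ∀ n → f n ≡ g n
  go zero    = trans (sym (+-identityʳ (f 0))) (trans (at p 0) (+-identityʳ (g 0)))
  go (suc n) = +-cancelʳ-≡ (g n) (f (suc n)) (g (suc n)) (trans (cong (f (suc n) +_) (sym (go n)))
    (trans (cong (f (suc n) +_) (sym (X-shift 1 f n))) (trans (at p (suc n)) (cong (g (suc n) +_) (X-shift 1 g n)))))

P'≈geo2 : P' ≈ geo 2 ⊛ P-noOnes
P'≈geo2 = 1+X-cancel (begin
  P' ⊕ X 1 ⊛ P'  ≈⟨ P≈P' ⟨
  P  ≈⟨ P≈geo1 ⟩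
  geo 1 ⊛ P-noOnes  ≈⟨ ⊛-congʳ P-noOnes (geo-double {1} pos) ⟩
  (I ⊕ X 1) ⊛ geo 2 ⊛ P-noOnes  ≈⟨ solve 3 (λ x g f → (con 1 :+ x) :* g :* f := g :* f :+ x :* (g :* f)) ≈-refl (X 1) (geo 2) P-noOnes ⟩
  geo 2 ⊛ P-noOnes ⊕ X 1 ⊛ (geo 2 ⊛ P-noOnes)  ∎)
  where open ≈R

-- `P'` is not monotone, because dividing by 1 + q turns the factor 1/(1 - q) of `P` into 1/(1 -
-- q²). The factor 1/(1 - q⁵) is still there.
P'-shift5 : X 5 ⊛ P' ≼ P'
P'-shift5 = ≼-trans (≈⇒≼ (⊛-congˡ (X 5) eq)) (≼-trans (geo-shift rest pos) (≈⇒≼ (≈-sym eq)))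
  where
  rest = geo 2 ⊛ Geo.Pr∞ 9 8 ⊛ Geo.Pr∞ 13 8 ⊛ Geo.Pr∞ 6 8
  eq : P' ≈ geo 5 ⊛ rest
  eq = ≈-trans P'≈geo2 (≈-trans (⊛-congˡ (geo 2) (⊛-congʳ (Geo.Pr∞ 6 8) (⊛-congˡ (Geo.Pr∞ 9 8) (Geo.Pr∞-unfold {5} {8} pos pos))))
    (solve 5 (λ t x y z w → t :* (x :* (y :* z) :* w) := y :* (t :* x :* z :* w)) ≈-refl
      (geo 2) (Geo.Pr∞ 9 8) (geo 5) (Geo.Pr∞ 13 8) (Geo.Pr∞ 6 8)))

-- Sums along progressions and asymptotics modulo multiples of P

S : Series
S = geo 1 ⊛ P

-- 1/(1 - q) = (1 + q + ⋯ + q^(d-1))/(1 - q^d)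
module Blocks {d f} (d>0 : 0 < d) (m : Mono f) where

  block : ℕ → Series
  block zero    = O
  block (suc k) = block k ⊕ X k ⊛ (geo d ⊛ f)

  block-shift : ∀ k → block k ⊕ X k ⊛ (geo d ⊛ f) ≈ geo d ⊛ f ⊕ X 1 ⊛ block k
  block-shift zero    = ≈-trans (≈-trans (R.+-identityˡ (X 0 ⊛ (geo d ⊛ f))) (R.*-identityˡ (geo d ⊛ f)))
    (≈-sym (≈-trans (⊕-congˡ (geo d ⊛ f) (R.zeroʳ (X 1))) (R.+-identityʳ (geo d ⊛ f))))
  block-shift (suc k) = ≈-trans (⊕-cong (block-shift k) (≈-sym (XX 1 k (geo d ⊛ f) refl)))
    (solve 4 (λ g x w y → g :+ x :* w :+ x :* y := g :+ x :* (w :+ y)) ≈-refl (geo d ⊛ f) (X 1) (block k) (X k ⊛ (geo d ⊛ f)))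

  block≈ : block d ≈ geo 1 ⊛ f
  block≈ = geo-solves {1} pos (⊕-cancelʳ-≈ (X d ⊛ (geo d ⊛ f)) (≈-trans (block-shift d)
    (≈-trans (⊕-congʳ (X 1 ⊛ block d) (geo-⊛-unfold f d>0))
    (solve 3 (λ f x w → f :+ x :+ w := f :+ w :+ x) ≈-refl f (X d ⊛ (geo d ⊛ f)) (X 1 ⊛ block d)))))

  block≼ : ∀ k → block k ≼ k · (geo d ⊛ f)
  block≼ zero    = mk≼ λ n → ≤-refl
  block≼ (suc k) = mk≼ λ n → ≤-trans (+-mono-≤ (le (block≼ k) n) (le (X-mono k (Mono-⊛ (geo d) m)) n))
    (≤-reflexive (+-comm (k * (geo d ⊛ f) n) _))

  block≽ : ∀ k → k ≤ d → k · (X d ⊛ (geo d ⊛ f)) ≼ block k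
  block≽ zero    _   = mk≼ λ n → ≤-refl
  block≽ (suc k) k<d = mk≼ λ n → ≤-trans (≤-reflexive (+-comm _ (k * (X d ⊛ (geo d ⊛ f)) n)))
    (+-mono-≤ (le (block≽ k (<⇒≤ k<d)) n) (le last n))
    where
    last : X d ⊛ (geo d ⊛ f) ≼ X k ⊛ (geo d ⊛ f)
    last = ≼-trans (≈⇒≼ (≈-sym (XX k (d ∸ k) (geo d ⊛ f) (m+[n∸m]≡n (<⇒≤ k<d)))))
      (⊛-monoʳ (X k) (X-mono (d ∸ k) (Mono-⊛ (geo d) m)))

geo1≼ : ∀ {d f} → 0 < d → Mono f → geo 1 ⊛ f ≼ d · (geo d ⊛ f)
geo1≼ {d} d>0 m = ≼-trans (≈⇒≼ (≈-sym block≈)) (block≼ d)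
  where open Blocks d>0 m

-- The d interleaved progressions lag by less than d, so by monotonicity they differ from one
-- another by a boundary term at most. With `geo1≼`, the sum along one progression is 1/d of the
-- full sum up to O(f).
geo1≽ : ∀ {d f} → 0 < d → Mono f → d · (geo d ⊛ f) ≼ geo 1 ⊛ f ⊕ d · f
geo1≽ {d} {f} d>0 m = ≼-trans (·-mono d (≈⇒≼ (geo-⊛-unfold f d>0)))
  (mk≼ λ n → ≤-trans (≤-reflexive (trans (*-distribˡ-+ d (f n) _) (+-comm (d * f n) _)))
    (+-monoˡ-≤ (d * f n) (≤-trans (le (block≽ d ≤-refl) n) (≤-reflexive (at block≈ n)))))
  where open Blocks d>0 m

-- S is of larger order than P, so f ≳ c and f ≲ c bound f / S asymptotically, in units of 1/scale.
module Asymptotic (scale : ℕ) where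

  infix 4 _≳_ _≲_
  record _≳_ (f : Series) (c : ℕ) : Set where
    constructor by
    field
      const : ℕ
      bound : c · S ≼ scale · f ⊕ const · P

  record _≲_ (f : Series) (c : ℕ) : Set where
    constructor by
    field
      const : ℕ
      bound : scale · f ≼ c · S ⊕ const · P

  progression : ℕ → ℕ → Series
  progression a d = X a ⊛ (geo d ⊛ P)

  -- The shift drops the last a values of `P` from the partial sum, and each is at most the current
  -- one.
  S-shift : ∀ a → S ≼ X a ⊛ S ⊕ a · P
  S-shift zero    = mk≼ λ n → ≤-reflexive (sym (trans (+-identityʳ _) (⊛-identityˡ-at S n)))
  S-shift (suc a) = ≼-trans (S-shift a) (≼-trans (⊕-mono step ≼-refl)
    (mk≼ λ n → ≤-reflexive (lemma (P n) ((X (suc a) ⊛ S) n) (a * P n))))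
    where
    lemma : ∀ p x u → p + x + u ≡ x + (p + u)
    lemma = NS.solve-∀
    step : X a ⊛ S ≼ P ⊕ X (suc a) ⊛ S
    step = ≼-trans (≈⇒≼ (≈-trans (⊛-congˡ (X a) (geo-⊛-unfold P (pos {0})))
        (≈-trans (R.distribˡ (X a) P (X 1 ⊛ S)) (⊕-congˡ (X a ⊛ P) (XX a 1 S (+-comm a 1))))))
      (⊕-mono (X-mono a P-mono) ≼-refl)

  progression≳ : ∀ a d c → 0 < d → c * d ≤ scale → progression a d ≳ c
  progression≳ a d c d>0 l = by (c * a) (mk≼ λ n → begin
    c * S n  ≤⟨ *-monoʳ-≤ c (le (S-shift a) n) ⟩
    c * ((X a ⊛ S) n + a * P n)  ≡⟨ *-distribˡ-+ c _ _ ⟩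
    c * (X a ⊛ S) n + c * (a * P n)  ≤⟨ +-monoˡ-≤ _ (*-monoʳ-≤ c (le (≼-trans (⊛-monoʳ (X a) (geo1≼ d>0 P-mono)) (≈⇒≼ (⊛-· d (X a) (geo d ⊛ P)))) n)) ⟩
    c * (d * progression a d n) + c * (a * P n)  ≡⟨ cong₂ _+_ (*-assoc c d _) (*-assoc c a _) ⟨
    c * d * progression a d n + c * a * P n  ≤⟨ +-monoˡ-≤ _ (*-monoˡ-≤ _ l) ⟩
    scale * progression a d n + c * a * P n  ∎)
    where open ≤-Reasoning

  progression≲ : ∀ a d c → 0 < d → scale ≤ c * d → progression a d ≲ c
  progression≲ a d c d>0 l = by (c * d) (mk≼ λ n → begin
    scale * progression a d n  ≤⟨ *-monoˡ-≤ _ l ⟩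
    c * d * progression a d n  ≤⟨ *-monoʳ-≤ (c * d) (le (X-mono a (Mono-⊛ (geo d) P-mono)) n) ⟩
    c * d * (geo d ⊛ P) n  ≡⟨ *-assoc c d _ ⟩
    c * (d * (geo d ⊛ P) n)  ≤⟨ *-monoʳ-≤ c (le (geo1≽ d>0 P-mono) n) ⟩
    c * (S n + d * P n)  ≡⟨ *-distribˡ-+ c _ _ ⟩
    c * S n + c * (d * P n)  ≡⟨ cong (c * S n +_) (*-assoc c d _) ⟨
    c * S n + c * d * P n  ∎)
    where open ≤-Reasoning

  private
    exchange : ∀ s f g c d p → s * f + c * p + (s * g + d * p) ≡ s * (f + g) + (c + d) * p
    exchange = NS.solve-∀
    exchange' : ∀ a b s c d p → a * s + c * p + (b * s + d * p) ≡ (a + b) * s + (c + d) * p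
    exchange' = NS.solve-∀

  ≳-⊕ : ∀ {f g a b} → f ≳ a → g ≳ b → f ⊕ g ≳ a + b
  ≳-⊕ {f} {g} {a} {b} (by C p) (by C' p') = by (C + C') (mk≼ λ n → ≤-trans (≤-reflexive (*-distribʳ-+ (S n) a b))
    (≤-trans (+-mono-≤ (le p n) (le p' n)) (≤-reflexive (exchange scale (f n) (g n) C C' (P n)))))

  ≲-⊕ : ∀ {f g a b} → f ≲ a → g ≲ b → f ⊕ g ≲ a + b
  ≲-⊕ {f} {g} {a} {b} (by C p) (by C' p') = by (C + C') (mk≼ λ n → ≤-trans (≤-reflexive (*-distribˡ-+ scale (f n) (g n)))
    (≤-trans (+-mono-≤ (le p n) (le p' n)) (≤-reflexive (exchange' a b (S n) C C' (P n)))))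

  ≳-mono : ∀ {f g a} c → f ≼ g ⊕ c · P → f ≳ a → g ≳ a
  ≳-mono {f} {g} {a} c q (by C p) = by (scale * c + C) (mk≼ λ n → ≤-trans (le p n)
    (≤-trans (+-monoˡ-≤ (C * P n) (*-monoʳ-≤ scale (le q n))) (≤-reflexive (lemma scale (g n) c C (P n)))))
    where
    lemma : ∀ s g c d p → s * (g + c * p) + d * p ≡ s * g + (s * c + d) * p
    lemma = NS.solve-∀

  ≲-mono : ∀ {f g a} c → f ≼ g ⊕ c · P → g ≲ a → f ≲ a
  ≲-mono {f} {g} {a} c q (by C p) = by (C + scale * c) (mk≼ λ n → ≤-trans (*-monoʳ-≤ scale (le q n))
    (≤-trans (≤-reflexive (*-distribˡ-+ scale (g n) (c * P n))) (≤-trans (+-monoˡ-≤ (scale * (c * P n)) (le p n))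
    (≤-reflexive (lemma scale (a * S n) c C (P n))))))
    where
    lemma : ∀ s g c d p → g + d * p + s * (c * p) ≡ g + (d + s * c) * p
    lemma = NS.solve-∀

  -- A lower bound for o - e, with `b · S` cancelled instead of subtracted.
  ≳-minus : ∀ {f e o a} b c → o ≼ f ⊕ e → o ≳ a → e ≲ b → c + b ≤ a → f ≳ c
  ≳-minus {f} {e} {o} {a} b c q (by C p) (by C' p') l = by (C + C') (mk≼ λ n → +-cancelʳ-≤ (b * S n) _ _ (begin
    c * S n + b * S n  ≡⟨ *-distribʳ-+ (S n) c b ⟨
    (c + b) * S n  ≤⟨ *-monoˡ-≤ (S n) l ⟩
    a * S n  ≤⟨ le p n ⟩
    scale * o n + C * P n  ≤⟨ +-monoˡ-≤ _ (*-monoʳ-≤ scale (le q n)) ⟩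
    scale * (f n + e n) + C * P n  ≡⟨ cong (_+ C * P n) (*-distribˡ-+ scale (f n) (e n)) ⟩
    scale * f n + scale * e n + C * P n  ≤⟨ +-monoˡ-≤ _ (+-monoʳ-≤ (scale * f n) (le p' n)) ⟩
    scale * f n + (b * S n + C' * P n) + C * P n  ≡⟨ lemma (scale * f n) (b * S n) C' C (P n) ⟩
    scale * f n + (C + C') * P n + b * S n  ∎))
    where
    open ≤-Reasoning
    lemma : ∀ x y c' c p → x + (y + c' * p) + c * p ≡ x + (c + c') * p + y
    lemma = NS.solve-∀

  ≲-minus : ∀ {f e o a} b c → f ⊕ e ≼ o → o ≲ a → e ≳ b → a ≤ c + b → f ≲ c
  ≲-minus {f} {e} {o} {a} b c q (by C p) (by C' p') l = by (C + C') (mk≼ λ n → +-cancelʳ-≤ (b * S n) _ _ (begin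
    scale * f n + b * S n  ≤⟨ +-monoʳ-≤ (scale * f n) (le p' n) ⟩
    scale * f n + (scale * e n + C' * P n)  ≡⟨ lemma₁ scale (f n) (e n) (C' * P n) ⟩
    scale * (f n + e n) + C' * P n  ≤⟨ +-monoˡ-≤ _ (*-monoʳ-≤ scale (le q n)) ⟩
    scale * o n + C' * P n  ≤⟨ +-monoˡ-≤ _ (le p n) ⟩
    a * S n + C * P n + C' * P n  ≤⟨ +-monoˡ-≤ _ (+-monoˡ-≤ _ (*-monoˡ-≤ (S n) l)) ⟩
    (c + b) * S n + C * P n + C' * P n  ≡⟨ lemma₂ c b (S n) C C' (P n) ⟩
    c * S n + (C + C') * P n + b * S n  ∎))
    where
    open ≤-Reasoning
    lemma₁ : ∀ s f e x → s * f + (s * e + x) ≡ s * (f + e) + x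
    lemma₁ = NS.solve-∀
    lemma₂ : ∀ c b s d d' p → (c + b) * s + d * p + d' * p ≡ c * s + (d + d') * p + b * s
    lemma₂ = NS.solve-∀

  ≳-divide : ∀ {f a} k c → k * c ≤ a → k · f ≳ a → 0 < k → f ≳ c
  ≳-divide {f} {a} (suc k) c l (by C p) _ = by C (mk≼ λ n → *-cancelˡ-≤ (suc k) (begin
    suc k * (c * S n)  ≡⟨ *-assoc (suc k) c (S n) ⟨
    suc k * c * S n  ≤⟨ *-monoˡ-≤ (S n) l ⟩
    a * S n  ≤⟨ le p n ⟩
    scale * (suc k * f n) + C * P n  ≤⟨ +-monoʳ-≤ (scale * (suc k * f n)) (m≤n*m (C * P n) (suc k)) ⟩
    scale * (suc k * f n) + suc k * (C * P n)  ≡⟨ lemma scale (suc k) (f n) (C * P n) ⟩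
    suc k * (scale * f n + C * P n)  ∎))
    where
    open ≤-Reasoning
    lemma : ∀ s k f x → s * (k * f) + k * x ≡ k * (s * f + x)
    lemma = NS.solve-∀

  ≲-divide : ∀ {f a} k c → a ≤ k * c → k · f ≲ a → 0 < k → f ≲ c
  ≲-divide {f} {a} (suc k) c l (by C p) _ = by C (mk≼ λ n → *-cancelˡ-≤ (suc k) (begin
    suc k * (scale * f n)  ≡⟨ lemma (suc k) scale (f n) ⟩
    scale * (suc k * f n)  ≤⟨ le p n ⟩
    a * S n + C * P n  ≤⟨ +-mono-≤ (*-monoˡ-≤ (S n) l) (m≤n*m (C * P n) (suc k)) ⟩
    suc k * c * S n + suc k * (C * P n)  ≡⟨ lemma₂ (suc k) c (S n) (C * P n) ⟩
    suc k * (c * S n + C * P n)  ∎))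
    where
    open ≤-Reasoning
    lemma : ∀ k s f → k * (s * f) ≡ s * (k * f)
    lemma = NS.solve-∀
    lemma₂ : ∀ k c s x → k * c * s + k * x ≡ k * (c * s + x)
    lemma₂ = NS.solve-∀

  ≳-· : ∀ {f a} k → f ≳ a → k · f ≳ k * a
  ≳-· {f} {a} k (by C p) = by (k * C) (mk≼ λ n → ≤-trans (≤-reflexive (*-assoc k a (S n))) (≤-trans (*-monoʳ-≤ k (le p n))
    (≤-reflexive (lemma k scale (f n) C (P n)))))
    where
    lemma : ∀ k s f c p → k * (s * f + c * p) ≡ s * (k * f) + k * c * p
    lemma = NS.solve-∀

  ≲-· : ∀ {f a} k → f ≲ a → k · f ≲ k * a
  ≲-· {f} {a} k (by C p) = by (k * C) (mk≼ λ n → ≤-trans (≤-reflexive (lemma k scale (f n))) (≤-trans (*-monoʳ-≤ k (le p n))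
    (≤-reflexive (lemma₂ k a (S n) C (P n)))))
    where
    lemma : ∀ k s f → s * (k * f) ≡ k * (s * f)
    lemma = NS.solve-∀
    lemma₂ : ∀ k a s c p → k * (a * s + c * p) ≡ k * a * s + k * c * p
    lemma₂ = NS.solve-∀

  -- The bounds differ by at least one `S`, which eventually exceeds both error terms together.
  ≳≲⇒> : ∀ {f g a b} → f ≳ a → g ≲ b → b < a → (∀ K → ∃[ N ] (∀ n → n ≥ N → K * P n < S n)) →
         ∃[ N ] (∀ n → n ≥ N → f n > g n)
  ≳≲⇒> {f} {g} {a} {b} (by C p) (by C' p') l growth with growth (C + C')
  ... | N , q = N , λ n n≥N → *-cancelˡ-< scale _ _ (+-cancelʳ-< (C * P n) _ _ (begin-strict
    scale * g n + C * P n  ≤⟨ +-monoˡ-≤ (C * P n) (le p' n) ⟩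
    b * S n + C' * P n + C * P n  ≡⟨ lemma (b * S n) C' C (P n) ⟩
    b * S n + (C + C') * P n  <⟨ +-monoʳ-< (b * S n) (q n n≥N) ⟩
    b * S n + S n  ≡⟨ +-comm (b * S n) (S n) ⟩
    suc b * S n  ≤⟨ *-monoˡ-≤ (S n) l ⟩
    a * S n  ≤⟨ le p n ⟩
    scale * f n + C * P n  ∎))
    where
    open ≤-Reasoning
    lemma : ∀ x c' c p → x + c' * p + c * p ≡ x + (c + c') * p
    lemma = NS.solve-∀

-- Total number of parts by alternating power sums

infix 4 _≼[_]_
record _≼[_]_ (f : Series) (N : ℕ) (g : Series) : Set where
  constructor mk≼[]
  field leUpTo : ∀ n → n < N → f n ≤ g n
open _≼[_]_ public

≼⇒[] : ∀ {N f g} → f ≼ g → f ≼[ N ] g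
≼⇒[] p = mk≼[] λ n _ → le p n

≼[]-trans : ∀ {N f g h} → f ≼[ N ] g → g ≼[ N ] h → f ≼[ N ] h
≼[]-trans p r = mk≼[] λ n l → ≤-trans (leUpTo p n l) (leUpTo r n l)

≼[]-⊕ : ∀ {N f f' g g'} → f ≼[ N ] f' → g ≼[ N ] g' → f ⊕ g ≼[ N ] f' ⊕ g'
≼[]-⊕ p r = mk≼[] λ n l → +-mono-≤ (leUpTo p n l) (leUpTo r n l)

≼[]-⊛ : ∀ {N f g} h → f ≼[ N ] g → h ⊛ f ≼[ N ] h ⊛ g
≼[]-⊛ h p = mk≼[] λ n l → ⊛-mono-at n (λ _ _ → ≤-refl) (λ m m≤n → leUpTo p m (≤-<-trans m≤n l))

-- The power sum Σ xᵐ over x = qᵃ, q^(a+d), q^(a+2d), .... As `Len` is `Dist` times Σ x/(1 + x), it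
-- is the alternating sum of these power sums times `Dist`; `odds` and `evens` collect the two
-- signs.
multiples : ℕ → ℕ → ℕ → Series
multiples m a d = X (m * a) ⊛ geo (m * d)

odds : ℕ → ℕ → ℕ → Series
odds r a d = ΣS r (λ i → multiples (1 + 2 * i) a d)

evens : ℕ → ℕ → ℕ → Series
evens r a d = ΣS r (λ i → multiples (2 + 2 * i) a d)

multiples-step : ∀ m a {d} → 0 < m → 0 < d → multiples m a d ≈ X (m * a) ⊕ multiples m (a + d) d
multiples-step m a {d} m>0 d>0 = begin
  X (m * a) ⊛ geo (m * d)  ≈⟨ ⊛-congˡ (X (m * a)) (geo-unfold (*-mono-≤ m>0 d>0)) ⟩
  X (m * a) ⊛ (I ⊕ X (m * d) ⊛ geo (m * d))  ≈⟨ solve 3 (λ x y g → x :* (con 1 :+ y :* g) := x :+ x :* (y :* g)) ≈-refl (X (m * a)) (X (m * d)) (geo (m * d)) ⟩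
  X (m * a) ⊕ X (m * a) ⊛ (X (m * d) ⊛ geo (m * d))  ≈⟨ ⊕-congˡ (X (m * a)) (XX (m * a) (m * d) (geo (m * d)) (sym (*-distribˡ-+ m a d))) ⟩
  X (m * a) ⊕ multiples m (a + d) d  ∎
  where open ≈R

ΣS-⊕ : ∀ K F G → ΣS K (λ k → F k ⊕ G k) ≈ ΣS K F ⊕ ΣS K G
ΣS-⊕ K F G = mk≈ λ n → Σ<-+ K (λ k → F k n) (λ k → G k n)

module Alternating (r : ℕ) where

  oddX evenX : ℕ → ℕ → Series
  oddX r a  = ΣS r (λ i → X ((1 + 2 * i) * a))
  evenX r a = ΣS r (λ i → X ((2 + 2 * i) * a))

  -- With Π = (1 + x) Π', x Π' is approximated by (x - x² + ⋯) Π.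
  telescope : ∀ r a f → X a ⊛ f ⊕ evenX r a ⊛ ((I ⊕ X a) ⊛ f) ≈ oddX r a ⊛ ((I ⊕ X a) ⊛ f) ⊕ X ((1 + 2 * r) * a) ⊛ f
  telescope zero a f = begin
    X a ⊛ f ⊕ O ⊛ Π  ≈⟨ ⊕-cong (⊛-congʳ f (≡⇒≈ (cong X (sym (+-identityʳ a))))) (R.zeroˡ Π) ⟩
    X (1 * a) ⊛ f ⊕ O  ≈⟨ R.+-comm (X (1 * a) ⊛ f) O ⟩
    O ⊕ X (1 * a) ⊛ f  ≈⟨ ⊕-congʳ (X (1 * a) ⊛ f) (R.zeroˡ Π) ⟨
    O ⊛ Π ⊕ X (1 * a) ⊛ f  ∎
    where open ≈R ; Π = (I ⊕ X a) ⊛ f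
  telescope (suc r) a f = begin
    X a ⊛ f ⊕ (evenX r a ⊕ z) ⊛ Π  ≈⟨ solve 4 (λ u e z p → u :+ (e :+ z) :* p := u :+ e :* p :+ z :* p) ≈-refl (X a ⊛ f) (evenX r a) z Π ⟩
    X a ⊛ f ⊕ evenX r a ⊛ Π ⊕ z ⊛ Π  ≈⟨ ⊕-cong (telescope r a f) (⊛-congʳ Π z≈) ⟩
    oddX r a ⊛ Π ⊕ y ⊛ f ⊕ X a ⊛ y ⊛ Π  ≈⟨ solve 4 (λ o y f x → o :* ((con 1 :+ x) :* f) :+ y :* f :+ x :* y :* ((con 1 :+ x) :* f)
                                                := (o :+ y) :* ((con 1 :+ x) :* f) :+ x :* (x :* y) :* f) ≈-refl (oddX r a) y f (X a) ⟩
    (oddX r a ⊕ y) ⊛ Π ⊕ X a ⊛ (X a ⊛ y) ⊛ f ≈⟨ ⊕-congˡ ((oddX r a ⊕ y) ⊛ Π) (⊛-congʳ f (≈-trans (⊛-congˡ (X a) (≈-sym z≈)) w≈)) ⟩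
    (oddX r a ⊕ y) ⊛ Π ⊕ X ((1 + 2 * suc r) * a) ⊛ f ∎
    where
    open ≈R
    Π = (I ⊕ X a) ⊛ f
    y = X ((1 + 2 * r) * a)
    z = X ((2 + 2 * r) * a)
    z≈ : z ≈ X a ⊛ y
    z≈ = X-+ a ((1 + 2 * r) * a)
    w≈ : X a ⊛ z ≈ X ((1 + 2 * suc r) * a)
    w≈ = ≈-trans (≈-sym (X-+ a ((2 + 2 * r) * a))) (≡⇒≈ (cong X (lemma r a)))
      where
      lemma : ∀ r a → a + (2 + 2 * r) * a ≡ (1 + 2 * suc r) * a
      lemma = NS.solve-∀

  odds-step : ∀ k a {d} → 0 < d → odds k a d ≈ oddX k a ⊕ odds k (a + d) d
  odds-step k a {d} d>0 = ≈-trans (ΣS-cong k (λ i → multiples-step (1 + 2 * i) a (s≤s z≤n) d>0))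
    (ΣS-⊕ k (λ i → X ((1 + 2 * i) * a)) (λ i → multiples (1 + 2 * i) (a + d) d))

  evens-step : ∀ k a {d} → 0 < d → evens k a d ≈ evenX k a ⊕ evens k (a + d) d
  evens-step k a {d} d>0 = ≈-trans (ΣS-cong k (λ i → multiples-step (2 + 2 * i) a (s≤s z≤n) d>0))
    (ΣS-⊕ k (λ i → X ((2 + 2 * i) * a)) (λ i → multiples (2 + 2 * i) (a + d) d))

  module _ {d} (d>0 : 0 < d) where

    private
      big : ℕ → Series
      big a = Len a d ⊕ evens r a d ⊛ Dist a d

    len-step : ∀ {a} → 0 < a → big a ≈ (I ⊕ X a) ⊛ big (a + d) ⊕ (oddX r a ⊛ Dist a d ⊕ X ((1 + 2 * r) * a) ⊛ Dist (a + d) d)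
    len-step {a} a>0 = begin
      Len a d ⊕ evens r a d ⊛ Dist a d
        ≈⟨ ⊕-cong (Len-unfold a>0 d>0) (⊛-cong (evens-step r a d>0) (Dist-unfold a>0 d>0)) ⟩
      (I ⊕ X a) ⊛ Len (a + d) d ⊕ X a ⊛ Π' ⊕ (evenX r a ⊕ evens r (a + d) d) ⊛ ((I ⊕ X a) ⊛ Π')
        ≈⟨ solve 5 (λ x l p e f → (con 1 :+ x) :* l :+ x :* p :+ (e :+ f) :* ((con 1 :+ x) :* p)
             := (con 1 :+ x) :* (l :+ f :* p) :+ (x :* p :+ e :* ((con 1 :+ x) :* p))) ≈-refl (X a) (Len (a + d) d) Π' (evenX r a) (evens r (a + d) d) ⟩
      (I ⊕ X a) ⊛ big (a + d) ⊕ (X a ⊛ Π' ⊕ evenX r a ⊛ ((I ⊕ X a) ⊛ Π'))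
        ≈⟨ ⊕-congˡ ((I ⊕ X a) ⊛ big (a + d)) (≈-trans (telescope r a Π') (⊕-congʳ (X ((1 + 2 * r) * a) ⊛ Π') (⊛-congˡ (oddX r a) (≈-sym (Dist-unfold a>0 d>0))))) ⟩
      (I ⊕ X a) ⊛ big (a + d) ⊕ (oddX r a ⊛ Dist a d ⊕ X ((1 + 2 * r) * a) ⊛ Π') ∎
      where open ≈R ; Π' = Dist (a + d) d

    odds-Dist : ∀ k {a} → 0 < a → odds k a d ⊛ Dist a d ≈ (I ⊕ X a) ⊛ (odds k (a + d) d ⊛ Dist (a + d) d) ⊕ oddX k a ⊛ Dist a d
    odds-Dist k {a} a>0 = begin
      odds k a d ⊛ Dist a d  ≈⟨ ⊛-congʳ (Dist a d) (odds-step k a d>0) ⟩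
      (oddX k a ⊕ odds k (a + d) d) ⊛ Dist a d  ≈⟨ solve 3 (λ o s p → (o :+ s) :* p := s :* p :+ o :* p) ≈-refl (oddX k a) (odds k (a + d) d) (Dist a d) ⟩
      odds k (a + d) d ⊛ Dist a d ⊕ oddX k a ⊛ Dist a d  ≈⟨ ⊕-congʳ (oddX k a ⊛ Dist a d) (≈-trans (⊛-congˡ (odds k (a + d) d) (Dist-unfold a>0 d>0))
             (solve 3 (λ o x p → o :* (x :* p) := x :* (o :* p)) ≈-refl (odds k (a + d) d) (I ⊕ X a) (Dist (a + d) d))) ⟩
      (I ⊕ X a) ⊛ (odds k (a + d) d ⊛ Dist (a + d) d) ⊕ oddX k a ⊛ Dist a d ∎
      where open ≈R

    -- Both sides obey the same recursion in a, with a surplus on the right. After T steps the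
    -- smallest part is at least a + T, and below that degree the left side vanishes.
    lower[] : ∀ T {a} N → 0 < a → N ≤ a + T → odds r a d ⊛ Dist a d ≼[ N ] big a
    lower[] zero {a} N a>0 l = mk≼[] λ n n<N → subst (_≤ big a n) (sym (upTo
      ([]-trans ([]-⊛ zeros ([]-refl {f = Dist a d})) (≈⇒[] (R.zeroˡ (Dist a d)))) n (<-≤-trans n<N (≤-trans l (≤-reflexive (+-identityʳ a)))))) z≤n
      where
      zeros : odds r a d ≈[ a ] O
      zeros = mk[] λ n n<a → trans (Σ<-cong r (λ i _ → X-low ((1 + 2 * i) * a) (geo ((1 + 2 * i) * d)) n (<-≤-trans n<a (m≤n*m a (1 + 2 * i))))) (Σ<-zero r)
    lower[] (suc T) {a} N a>0 l = ≼[]-trans (≼⇒[] (≈⇒≼ (odds-Dist r a>0))) (≼[]-trans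
      (≼[]-⊕ (≼[]-⊛ (I ⊕ X a) (lower[] T N (≤-trans a>0 (m≤m+n a d)) (≤-trans (≤-trans l (≤-reflexive (+-suc a T))) (+-monoˡ-≤ T (≤-trans (≤-reflexive (+-comm 1 a)) (+-monoʳ-≤ a d>0))))))
        (≼⇒[] (≼-⊕ʳ (oddX r a ⊛ Dist a d) (X ((1 + 2 * r) * a) ⊛ Dist (a + d) d))))
      (≼⇒[] (≈⇒≼ (≈-sym (len-step a>0)))))

    upper[] : ∀ T {a} N → 0 < a → N ≤ a + T → big a ≼[ N ] odds (suc r) a d ⊛ Dist a d
    upper[] zero {a} N a>0 l = mk≼[] λ n n<N → subst (_≤ (odds (suc r) a d ⊛ Dist a d) n) (sym (upTo
      ([]-trans ([]-⊕ (Len≈[]O d a>0) ([]-trans ([]-⊛ zeros ([]-refl {f = Dist a d})) (≈⇒[] (R.zeroˡ (Dist a d))))) (≈⇒[] (R.+-identityˡ O)))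
      n (<-≤-trans n<N (≤-trans l (≤-reflexive (+-identityʳ a)))))) z≤n
      where
      zeros : evens r a d ≈[ a ] O
      zeros = mk[] λ n n<a → trans (Σ<-cong r (λ i _ → X-low ((2 + 2 * i) * a) (geo ((2 + 2 * i) * d)) n (<-≤-trans n<a (m≤n*m a (2 + 2 * i))))) (Σ<-zero r)
    upper[] (suc T) {a} N a>0 l = ≼[]-trans (≼⇒[] (≈⇒≼ (len-step a>0))) (≼[]-trans
      (≼[]-⊕ (≼[]-⊛ (I ⊕ X a) (upper[] T N (≤-trans a>0 (m≤m+n a d)) (≤-trans (≤-trans l (≤-reflexive (+-suc a T))) (+-monoˡ-≤ T (≤-trans (≤-reflexive (+-comm 1 a)) (+-monoʳ-≤ a d>0))))))
        (≼⇒[] last))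
      (≼⇒[] (≈⇒≼ (≈-sym (odds-Dist (suc r) a>0)))))
      where
      y = X ((1 + 2 * r) * a)
      -- The remainder of the telescoping is absorbed by the next odd power.
      last : oddX r a ⊛ Dist a d ⊕ y ⊛ Dist (a + d) d ≼ oddX (suc r) a ⊛ Dist a d
      last = ≼-trans (⊕-mono ≼-refl (⊛-monoʳ y (≼-trans (≼-⊕ʳ (Dist (a + d) d) (X a ⊛ Dist (a + d) d))
          (≈⇒≼ (≈-trans (solve 2 (λ x p → p :+ x :* p := (con 1 :+ x) :* p) ≈-refl (X a) (Dist (a + d) d)) (≈-sym (Dist-unfold a>0 d>0)))))))
        (≈⇒≼ (≈-sym (R.distribʳ (Dist a d) (oddX r a) y)))

    lower : ∀ {a} → 0 < a → odds r a d ⊛ Dist a d ≼ big a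
    lower {a} a>0 = mk≼ λ n → leUpTo (lower[] (suc n) (suc n) a>0 (m≤n+m (suc n) a)) n ≤-refl

    upper : ∀ {a} → 0 < a → big a ≼ odds (suc r) a d ⊛ Dist a d
    upper {a} a>0 = mk≼ λ n → leUpTo (upper[] (suc n) (suc n) a>0 (m≤n+m (suc n) a)) n ≤-refl

-- P outgrows every power of 1/(1 - q)

-- This is (1 - q)⁻ʳ; its coefficients grow like n^(r-1) for r ≥ 1.
U : ℕ → Series
U zero    = I
U (suc r) = geo 1 ⊛ U r

I≼ : ∀ {k f} → f ≈[ suc k ] I → I ≼ f
I≼ p = mk≼ λ { zero → ≤-reflexive (sym (upTo p 0 (s≤s z≤n))) ; (suc n) → z≤n }

-- Each factor 1/(1 - q) is exchanged for the next factor 1/(1 - q^(a+1)) of the product at the cost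
-- of a + 1. One extra factor 1/(1 - q) is kept to supply the monotonicity that the exchange needs.
U≼geos : ∀ r a → ∃[ c ] geo 1 ⊛ U r ≼ c · (geo 1 ⊛ Geo.Pr∞ (suc a) 8)
U≼geos zero    a = 1 , ≼-trans (⊛-monoʳ (geo 1) (I≼ (Geo.Pr∞≈[]I {suc a} pos pos))) (mk≼ λ n → ≤-reflexive (sym (+-identityʳ _)))
U≼geos (suc r) a with U≼geos r (a + 8)
... | c , p = c * suc a , (begin
  geo 1 ⊛ (geo 1 ⊛ U r)  ≤⟨ ⊛-monoʳ (geo 1) p ⟩
  geo 1 ⊛ (c · (geo 1 ⊛ Π))  ≈⟨ ⊛-· c (geo 1) (geo 1 ⊛ Π) ⟩
  c · (geo 1 ⊛ (geo 1 ⊛ Π))  ≤⟨ ·-mono c (geo1≼ {suc a} pos (Mono-geo1 Π)) ⟩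
  c · (suc a · (geo (suc a) ⊛ (geo 1 ⊛ Π)))  ≈⟨ mk≈ (λ n → *-assoc c (suc a) _) ⟨
  c * suc a · (geo (suc a) ⊛ (geo 1 ⊛ Π))  ≈⟨ ·-cong (c * suc a) (solve 3 (λ x y p → x :* (y :* p) := y :* (x :* p)) ≈-refl (geo (suc a)) (geo 1) Π) ⟩
  c * suc a · (geo 1 ⊛ (geo (suc a) ⊛ Π))  ≈⟨ ·-cong (c * suc a) (⊛-congˡ (geo 1) (Geo.Pr∞-unfold {suc a} pos pos)) ⟨
  c * suc a · (geo 1 ⊛ Geo.Pr∞ (suc a) 8)  ∎)
  where open ≼R ; Π = Geo.Pr∞ (suc a + 8) 8

U≼P : ∀ r → ∃[ c ] U r ≼ c · P
U≼P r = c , (begin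
  U r  ≈⟨ R.*-identityˡ (U r) ⟨
  I ⊛ U r  ≤⟨ ⊛-monoˡ (U r) (I≼geo {1} pos) ⟩
  geo 1 ⊛ U r  ≤⟨ proj₂ (U≼geos r 8) ⟩
  c · (geo 1 ⊛ E)  ≈⟨ ·-cong c (⊛-congˡ (geo 1) (solve 1 (λ e → e :* con 1 :* con 1 := e) ≈-refl E)) ⟨
  c · (geo 1 ⊛ (E ⊛ I ⊛ I))  ≤⟨ ·-mono c (⊛-monoʳ (geo 1) (⊛-mono (⊛-monoʳ E (I≼ {4} (Geo.Pr∞≈[]I {5} {8} pos pos))) (I≼ {5} (Geo.Pr∞≈[]I {6} {8} pos pos)))) ⟩
  c · (geo 1 ⊛ P-noOnes)  ≈⟨ ·-cong c P≈geo1 ⟨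
  c · P  ∎)
  where open ≼R ; E = Geo.Pr∞ 9 8 ; c = proj₁ (U≼geos r 8)

-- A form of the identity (n + r) C(n+r-1, r-1) = r C(n+r, r).
U-ratio : ∀ r n → n * U r n ≤ r * U (suc r) n
U-ratio zero    zero    = z≤n
U-ratio zero    (suc n) = ≤-reflexive (*-zeroʳ n)
U-ratio (suc r) zero    = z≤n
U-ratio (suc r) (suc n) = begin
  suc n * U (suc r) (suc n)  ≡⟨ cong (suc n *_) (U-suc r) ⟩
  suc n * (A + B)  ≡⟨ lemma₁ n A B ⟩
  n * A + (A + suc n * B)  ≤⟨ +-mono-≤ (U-ratio (suc r) n) (+-monoʳ-≤ A (U-ratio r (suc n))) ⟩
  suc r * C + (A + r * U (suc r) (suc n))  ≡⟨ cong (λ u → suc r * C + (A + r * u)) (U-suc r) ⟩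
  suc r * C + (A + r * (A + B))  ≤⟨ +-monoʳ-≤ (suc r * C) (+-monoˡ-≤ (r * (A + B)) (m≤m+n A B)) ⟩
  suc r * C + suc r * (A + B)  ≡⟨ *-distribˡ-+ (suc r) C (A + B) ⟨
  suc r * (C + (A + B))  ≡⟨ cong (λ u → suc r * (C + u)) (U-suc r) ⟨
  suc r * (C + U (suc r) (suc n))  ≡⟨ cong (suc r *_) (U-suc (suc r)) ⟨
  suc r * U (suc (suc r)) (suc n)  ∎
  where
  open ≤-Reasoning
  U-suc : ∀ r → U (suc r) (suc n) ≡ U (suc r) n + U r (suc n)
  U-suc r = trans (at (geo-⊛-unfold {1} (U r) pos) (suc n)) (trans (+-comm (U r (suc n)) _) (cong (_+ U r (suc n)) (X-shift 1 (U (suc r)) n)))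
  A = U (suc r) n
  B = U r (suc n)
  C = U (suc (suc r)) n
  lemma₁ : ∀ n a b → suc n * (a + b) ≡ n * a + (a + suc n * b)
  lemma₁ = NS.solve-∀

-- `U r` is at most r/n times `U (suc r)`, which is at most a multiple of `P`. The successors in the
-- witness keep the cancelled factor nonzero.
U≪P : ∀ r C → ∃[ N ] (∀ n → n ≥ N → C * U r n ≤ P n)
U≪P r C = C * (suc r * suc c) , λ n l → *-cancelˡ-≤ (suc r * suc c) (begin
  suc r * suc c * (C * U r n)  ≡⟨ lemma (suc r * suc c) C (U r n) ⟩
  C * (suc r * suc c) * U r n  ≤⟨ *-monoˡ-≤ (U r n) l ⟩
  n * U r n  ≤⟨ U-ratio r n ⟩
  r * U (suc r) n  ≤⟨ *-mono-≤ (n≤1+n r) (≤-trans (le (proj₂ (U≼P (suc r))) n) (*-monoˡ-≤ (P n) (n≤1+n c))) ⟩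
  suc r * (suc c * P n)  ≡⟨ *-assoc (suc r) (suc c) (P n) ⟨
  suc r * suc c * P n  ∎)
  where
  open ≤-Reasoning
  c = proj₁ (U≼P (suc r))
  lemma : ∀ m c u → m * (c * u) ≡ c * m * u
  lemma = NS.solve-∀

-- Pairs (α , β) and the decomposition of their parts

-- B k, Φ k and C k = B k Φ k are q^(2k²-k)/((1-q⁴)⋯(1-q⁴ᵏ)), (1+q²)⋯(1+q²ᵏ) and
-- q^(2k²-k)/((1-q²)⋯(1-q²ᵏ)); w k counts the parts of the partitions counted by Φ k.
B C Φ w : ℕ → Series
B = eul 1 4

C zero    = I
C (suc k) = X (1 + 4 * k) ⊛ (geo (2 * suc k) ⊛ C k)

Φ zero    = I
Φ (suc k) = (I ⊕ X (2 * suc k)) ⊛ Φ k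

w zero    = O
w (suc k) = (I ⊕ X (2 * suc k)) ⊛ w k ⊕ X (2 * suc k) ⊛ Φ k

tailDist tailLen : ℕ → Series
tailDist k = Dist (2 * suc k) 2
tailLen k  = Len (2 * suc k) 2

Even : Series
Even = Dist 2 2

B-small : Small B
B-small = eul-small 4 pos

C≈ : ∀ k → C k ≈ B k ⊛ Φ k
C≈ zero    = ≈-sym (R.*-identityˡ I)
C≈ (suc k) = begin
  x ⊛ (geo (2 * suc k) ⊛ C k)  ≈⟨ ⊛-congˡ x (⊛-cong (≈-trans (geo-double {2 * suc k} pos) (⊛-congˡ (I ⊕ y) (≡⇒≈ (cong geo (double k))))) (C≈ k)) ⟩
  x ⊛ ((I ⊕ y) ⊛ geo (4 * suc k) ⊛ (B k ⊛ Φ k))  ≈⟨ solve 5 (λ x y g b f → x :* (y :* g :* (b :* f)) := x :* (g :* b) :* (y :* f)) ≈-refl x (I ⊕ y) (geo (4 * suc k)) (B k) (Φ k) ⟩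
  x ⊛ (geo (4 * suc k) ⊛ B k) ⊛ ((I ⊕ y) ⊛ Φ k)  ∎
  where
  open ≈R
  x = X (1 + 4 * k)
  y = X (2 * suc k)
  double : ∀ k → 2 * suc k + 2 * suc k ≡ 4 * suc k
  double = NS.solve-∀

tailDist-unfold : ∀ k → tailDist k ≈ (I ⊕ X (2 * suc k)) ⊛ tailDist (suc k)
tailDist-unfold k = ≈-trans (Dist-unfold {2 * suc k} {2} pos pos)
  (⊛-congˡ (I ⊕ X (2 * suc k)) (≡⇒≈ (cong (λ u → Dist u 2) (lemma k))))
  where
  lemma : ∀ k → 2 * suc k + 2 ≡ 2 * suc (suc k)
  lemma = NS.solve-∀

tailLen-unfold : ∀ k → tailLen k ≈ (I ⊕ X (2 * suc k)) ⊛ tailLen (suc k) ⊕ X (2 * suc k) ⊛ tailDist (suc k)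
tailLen-unfold k = ≈-trans (Len-unfold {2 * suc k} {2} pos pos)
  (≡⇒≈ (cong (λ u → (I ⊕ X (2 * suc k)) ⊛ Len u 2 ⊕ X (2 * suc k) ⊛ Dist u 2) (lemma k)))
  where
  lemma : ∀ k → 2 * suc k + 2 ≡ 2 * suc (suc k)
  lemma = NS.solve-∀

Even≈ : ∀ k → Even ≈ Φ k ⊛ tailDist k
Even≈ zero    = ≈-sym (R.*-identityˡ Even)
Even≈ (suc k) = ≈-trans (Even≈ k) (≈-trans (⊛-congˡ (Φ k) (tailDist-unfold k))
  (solve 3 (λ f x t → f :* (x :* t) := x :* f :* t) ≈-refl (Φ k) (I ⊕ X (2 * suc k)) (tailDist (suc k))))

EvenLen≈ : ∀ k → Len 2 2 ≈ Φ k ⊛ tailLen k ⊕ w k ⊛ tailDist k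
EvenLen≈ zero    = ≈-sym (≈-trans (⊕-cong (R.*-identityˡ (tailLen 0)) (R.zeroˡ (tailDist 0))) (R.+-identityʳ (tailLen 0)))
EvenLen≈ (suc k) = ≈-trans (EvenLen≈ k) (≈-trans (⊕-cong (⊛-congˡ (Φ k) (tailLen-unfold k)) (⊛-congˡ (w k) (tailDist-unfold k)))
  (solve 5 (λ f x l t w → f :* ((con 1 :+ x) :* l :+ x :* t) :+ w :* ((con 1 :+ x) :* t)
      := (con 1 :+ x) :* f :* l :+ ((con 1 :+ x) :* w :+ x :* f) :* t) ≈-refl
    (Φ k) (X (2 * suc k)) (tailLen (suc k)) (tailDist (suc k)) (w k)))

-- Total number of parts of α and of β over the pairs (α , β) counted by P, where α is
-- the partition into even parts.
Y Z : Series
Y = Dist 1 4 ⊛ Len 2 2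
Z = Len 1 4 ⊛ Even

-- D weights a pair (α , β) by the number of parts of β plus the number of parts of α
-- exceeding twice that number; Λ takes the remaining parts of α.
Dterm Λterm : ℕ → Series
Dterm k = k · (C k ⊛ tailDist k) ⊕ C k ⊛ tailLen k
Λterm k = B k ⊛ w k ⊛ tailDist k

D Λ : Series
D = Σ∞ Dterm
Λ = Σ∞ Λterm

-- The factor `Φ k` of `C k` supplies the even parts up to 2k missing from `tailDist k`. This is the
-- mechanism of Lebesgue's identity.
CtailDist≈ : ∀ k → C k ⊛ tailDist k ≈ B k ⊛ Even
CtailDist≈ k = ≈-trans (⊛-congʳ (tailDist k) (C≈ k)) (≈-trans (R.*-assoc (B k) (Φ k) (tailDist k)) (⊛-congˡ (B k) (≈-sym (Even≈ k))))

-- For k = ℓ(β), the parts of β, those of α above 2k and those of α up to 2k together exhaust all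
-- parts of the pair.
D⊕Λ≈ : D ⊕ Λ ≈ Z ⊕ Y
D⊕Λ≈ = begin
  D ⊕ Λ  ≈⟨ Σ∞-⊕ Dterm Λterm ⟨
  Σ∞ (λ k → Dterm k ⊕ Λterm k)  ≈⟨ Σ∞-cong term ⟩
  Σ∞ (λ k → (k · B k) ⊛ Even ⊕ B k ⊛ Len 2 2)  ≈⟨ Σ∞-⊕ (λ k → (k · B k) ⊛ Even) (λ k → B k ⊛ Len 2 2) ⟩
  Σ∞ (λ k → (k · B k) ⊛ Even) ⊕ Σ∞ (λ k → B k ⊛ Len 2 2)  ≈⟨ ⊕-cong (Σ∞-⊛ (small-· B-small) Even) (Σ∞-⊛ B-small (Len 2 2)) ⟨
  Z ⊕ Y  ∎
  where
  open ≈R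
  term : ∀ k → Dterm k ⊕ Λterm k ≈ (k · B k) ⊛ Even ⊕ B k ⊛ Len 2 2
  term k = begin
    k · (C k ⊛ tailDist k) ⊕ C k ⊛ tailLen k ⊕ Λterm k
      ≈⟨ ⊕-congʳ (Λterm k) (⊕-cong (≈-trans (·-cong k (CtailDist≈ k)) (≈-sym (·-⊛ k (B k) Even))) (⊛-congʳ (tailLen k) (C≈ k))) ⟩
    (k · B k) ⊛ Even ⊕ B k ⊛ Φ k ⊛ tailLen k ⊕ B k ⊛ w k ⊛ tailDist k
      ≈⟨ solve 6 (λ e b f l w t → e :+ b :* f :* l :+ b :* w :* t := e :+ b :* (f :* l :+ w :* t)) ≈-refl
           ((k · B k) ⊛ Even) (B k) (Φ k) (tailLen k) (w k) (tailDist k) ⟩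
    (k · B k) ⊛ Even ⊕ B k ⊛ (Φ k ⊛ tailLen k ⊕ w k ⊛ tailDist k)
      ≈⟨ ⊕-congˡ ((k · B k) ⊛ Even) (⊛-congˡ (B k) (EvenLen≈ k)) ⟨
    (k · B k) ⊛ Even ⊕ B k ⊛ Len 2 2 ∎

-- Bounds for the parts of α up to 2 ℓ(β)

-- B k has the factor 1/(1 - q⁴ⁱ) for 1 ≤ i ≤ k.
B-shift : ∀ i k → i ≤ k → X (4 * i) ⊛ B k ≼ B k
B-shift zero    k       _   = ≈⇒≼ (R.*-identityˡ (B k))
B-shift (suc i) (suc k) (s≤s i≤k) with m≤n⇒m<n∨m≡n i≤k
... | inj₂ refl = ≼-trans (≈⇒≼ (solve 3 (λ x y g → x :* (y :* g) := y :* (x :* g)) ≈-refl (X (4 * suc i)) (X (1 + 4 * i)) (geo (4 * suc i) ⊛ B i)))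
                    (⊛-monoʳ (X (1 + 4 * i)) (geo-shift {4 * suc i} (B i) pos))
... | inj₁ i<k = ≼-trans (≈⇒≼ (solve 4 (λ x y g b → x :* (y :* (g :* b)) := y :* (g :* (x :* b))) ≈-refl (X (4 * suc i)) (X (1 + 4 * k)) (geo (4 * suc k)) (B k)))
                    (⊛-monoʳ (X (1 + 4 * k)) (⊛-monoʳ (geo (4 * suc k)) (B-shift (suc i) k i<k)))

-- The sum q⁴ + q⁸ + ⋯ + q⁴ᵐ is the comparison series for the lower bound on `Λ`, chosen because its
-- sum against the `B k` has a closed form, `Θ-eq`.
θ : ℕ → Series
θ zero    = O
θ (suc m) = θ m ⊕ X (4 * suc m)

module Row (k : ℕ) where

  f h : ℕ → Series
  f t = B k ⊛ w t
  h t = B k ⊛ Φ t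

  f-suc : ∀ t → f (suc t) ≈ f t ⊕ X (2 * suc t) ⊛ f t ⊕ X (2 * suc t) ⊛ h t
  f-suc t = solve 4 (λ b x w p → b :* ((con 1 :+ x) :* w :+ x :* p) := b :* w :+ x :* (b :* w) :+ x :* (b :* p)) ≈-refl
    (B k) (X (2 * suc t)) (w t) (Φ t)

  h-suc : ∀ t → h (suc t) ≈ h t ⊕ X (2 * suc t) ⊛ h t
  h-suc t = solve 3 (λ b x p → b :* ((con 1 :+ x) :* p) := b :* p :+ x :* (b :* p)) ≈-refl (B k) (X (2 * suc t)) (Φ t)

  h-shift : ∀ i t → i ≤ k → X (4 * i) ⊛ h t ≼ h t
  h-shift i t i≤k = ≼-trans (≈⇒≼ (≈-sym (R.*-assoc (X (4 * i)) (B k) (Φ t)))) (⊛-monoˡ (Φ t) (B-shift i k i≤k))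

  4[i+1]≡ : ∀ i → 2 * suc (suc (2 * i)) ≡ 4 * suc i
  4[i+1]≡ = NS.solve-∀

  -- The ratio f/h is an average number of parts, counted in quarters. A new part raises it by at
  -- most 1.
  upper-step : ∀ c t → 4 · f t ≼ c · h t → 4 · f (suc t) ≼ (c + 4) · h (suc t)
  upper-step c t p = mk≼ λ n → begin
    4 * f (suc t) n  ≡⟨ cong (4 *_) (at (f-suc t) n) ⟩
    4 * (f t n + (v ⊛ f t) n + (v ⊛ h t) n)  ≡⟨ lemma₁ (f t n) ((v ⊛ f t) n) ((v ⊛ h t) n) ⟩
    4 * f t n + 4 * (v ⊛ f t) n + 4 * (v ⊛ h t) n  ≤⟨ +-monoˡ-≤ (4 * (v ⊛ h t) n) (+-mono-≤ (le p n) (le vp n)) ⟩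
    c * h t n + c * (v ⊛ h t) n + 4 * (v ⊛ h t) n  ≤⟨ m≤m+n _ (4 * h t n) ⟩
    c * h t n + c * (v ⊛ h t) n + 4 * (v ⊛ h t) n + 4 * h t n  ≡⟨ lemma₂ c (h t n) ((v ⊛ h t) n) ⟩
    (c + 4) * (h t n + (v ⊛ h t) n)  ≡⟨ cong ((c + 4) *_) (at (h-suc t) n) ⟨
    (c + 4) * h (suc t) n  ∎
    where
    open ≤-Reasoning
    v = X (2 * suc t)
    vp : 4 · (v ⊛ f t) ≼ c · (v ⊛ h t)
    vp = ≼-trans (≈⇒≼ (≈-sym (⊛-· 4 v (f t)))) (≼-trans (⊛-monoʳ v p) (≈⇒≼ (⊛-· c v (h t))))
    lemma₁ : ∀ a b c → 4 * (a + b + c) ≡ 4 * a + 4 * b + 4 * c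
    lemma₁ = NS.solve-∀
    lemma₂ : ∀ c a b → c * a + c * b + 4 * b + 4 * a ≡ (c + 4) * (a + b)
    lemma₂ = NS.solve-∀

  -- If the partitions with the new part are no more numerous than those without it, the average
  -- rises by at most 1/2.
  upper-step' : ∀ c t → X (2 * suc t) ⊛ h t ≼ h t → 4 · f t ≼ c · h t → 4 · f (suc t) ≼ (c + 2) · h (suc t)
  upper-step' c t s p = mk≼ λ n → begin
    4 * f (suc t) n  ≡⟨ cong (4 *_) (at (f-suc t) n) ⟩
    4 * (f t n + (v ⊛ f t) n + (v ⊛ h t) n)  ≡⟨ lemma₁ (f t n) ((v ⊛ f t) n) ((v ⊛ h t) n) ⟩
    4 * f t n + 4 * (v ⊛ f t) n + 2 * (v ⊛ h t) n + 2 * (v ⊛ h t) n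
      ≤⟨ +-mono-≤ (+-monoˡ-≤ (2 * (v ⊛ h t) n) (+-mono-≤ (le p n) (le vp n))) (*-monoʳ-≤ 2 (le s n)) ⟩
    c * h t n + c * (v ⊛ h t) n + 2 * (v ⊛ h t) n + 2 * h t n  ≡⟨ lemma₂ c (h t n) ((v ⊛ h t) n) ⟩
    (c + 2) * (h t n + (v ⊛ h t) n)  ≡⟨ cong ((c + 2) *_) (at (h-suc t) n) ⟨
    (c + 2) * h (suc t) n  ∎
    where
    open ≤-Reasoning
    v = X (2 * suc t)
    vp : 4 · (v ⊛ f t) ≼ c · (v ⊛ h t)
    vp = ≼-trans (≈⇒≼ (≈-sym (⊛-· 4 v (f t)))) (≼-trans (⊛-monoʳ v p) (≈⇒≼ (⊛-· c v (h t))))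
    lemma₁ : ∀ a b c → 4 * (a + b + c) ≡ 4 * a + 4 * b + 2 * c + 2 * c
    lemma₁ = NS.solve-∀
    lemma₂ : ∀ c a b → c * a + c * b + 2 * b + 2 * a ≡ (c + 2) * (a + b)
    lemma₂ = NS.solve-∀

  -- Of two consecutive even parts the one divisible by 4 can be traded, so the two contribute 1 +
  -- 1/2, that is 6 quarters.
  upper-even : ∀ i → i ≤ k → 4 · f (2 * i) ≼ (6 * i) · h (2 * i)
  upper-even zero    _   = mk≼ λ n → ≤-reflexive (cong (4 *_) (trans (⊛-comm-at (B k) O n) (⊛-zeroˡ-at (B k) n)))
  upper-even (suc i) i<k = subst (λ t → 4 · f t ≼ (6 * suc i) · h t) (sym (lemma i))
    (≼-trans (upper-step' (6 * i + 4) (suc (2 * i)) shift (upper-step (6 * i) (2 * i) (upper-even i (<⇒≤ i<k))))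
      (mk≼ λ n → ≤-reflexive (cong (_* h (2 + 2 * i) n) (lemma₂ i))))
    where
    lemma : ∀ i → 2 * suc i ≡ 2 + 2 * i
    lemma = NS.solve-∀
    lemma₂ : ∀ i → 6 * i + 4 + 2 ≡ 6 * suc i
    lemma₂ = NS.solve-∀
    shift : X (2 * suc (suc (2 * i))) ⊛ h (suc (2 * i)) ≼ h (suc (2 * i))
    shift = subst (λ e → X e ⊛ h (suc (2 * i)) ≼ h (suc (2 * i))) (sym (4[i+1]≡ i)) (h-shift (suc i) (suc (2 * i)) i<k)

  -- Admitting the part multiplies the old inequality by 1 + v, and the occurrences of the new part
  -- leave four times `v ⊛ h t` to spare.
  lower-step : ∀ m t → θ m ⊛ h t ≼ 4 · f t ⊕ X 4 ⊛ h t →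
    θ m ⊛ h (suc t) ⊕ 4 · (X (2 * suc t) ⊛ h t) ≼ 4 · f (suc t) ⊕ X 4 ⊛ h (suc t)
  lower-step m t p = mk≼ λ n → begin
    (θ m ⊛ h (suc t)) n + 4 * (v ⊛ h t) n  ≡⟨ cong (_+ 4 * (v ⊛ h t) n) (at split n) ⟩
    (θ m ⊛ h t) n + (v ⊛ (θ m ⊛ h t)) n + 4 * (v ⊛ h t) n  ≤⟨ +-monoˡ-≤ (4 * (v ⊛ h t) n) (+-mono-≤ (le p n) (le vp n)) ⟩
    4 * f t n + (X 4 ⊛ h t) n + (4 * (v ⊛ f t) n + (X 4 ⊛ (v ⊛ h t)) n) + 4 * (v ⊛ h t) n
      ≡⟨ lemma (f t n) ((v ⊛ f t) n) ((v ⊛ h t) n) ((X 4 ⊛ h t) n) ((X 4 ⊛ (v ⊛ h t)) n) ⟩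
    4 * (f t n + (v ⊛ f t) n + (v ⊛ h t) n) + ((X 4 ⊛ h t) n + (X 4 ⊛ (v ⊛ h t)) n)
      ≡⟨ cong₂ _+_ (cong (4 *_) (at (f-suc t) n)) (trans (at (⊛-congˡ (X 4) (h-suc t)) n) (at (R.distribˡ (X 4) (h t) (v ⊛ h t)) n)) ⟨
    4 * f (suc t) n + (X 4 ⊛ h (suc t)) n  ∎
    where
    open ≤-Reasoning
    v = X (2 * suc t)
    split : θ m ⊛ h (suc t) ≈ θ m ⊛ h t ⊕ v ⊛ (θ m ⊛ h t)
    split = ≈-trans (⊛-congˡ (θ m) (h-suc t)) (solve 3 (λ a b x → a :* (b :+ x :* b) := a :* b :+ x :* (a :* b)) ≈-refl (θ m) (h t) v)
    vp : v ⊛ (θ m ⊛ h t) ≼ 4 · (v ⊛ f t) ⊕ X 4 ⊛ (v ⊛ h t)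
    vp = ≼-trans (⊛-monoʳ v p) (≈⇒≼ (≈-trans (R.distribˡ v (4 · f t) (X 4 ⊛ h t)) (⊕-cong (⊛-· 4 v (f t))
      (solve 3 (λ x y b → x :* (y :* b) := y :* (x :* b)) ≈-refl v (X 4) (h t)))))
    lemma : ∀ a b c d e → 4 * a + d + (4 * b + e) + 4 * c ≡ 4 * (a + b + c) + (d + e)
    lemma = NS.solve-∀

  -- Only parts divisible by 4 are used; the surplus of the others is dropped. With v = q^(4(i+1)),
  -- the two new terms v² and q⁴ v² of `θ` cost at most 2 v h each, since v h ≼ h and q⁴ h ≼ h, and
  -- the surplus is 4 v h. The index of `θ` runs one ahead of the number of parts, which serves odd
  -- k; the term `X 4 ⊛ h` starts the induction.
  lower-even : ∀ i → i ≤ k → θ (suc (2 * i)) ⊛ h (2 * i) ≼ 4 · f (2 * i) ⊕ X 4 ⊛ h (2 * i)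
  lower-even zero    _   = ≼-⊕ˡ (4 · f 0) (X 4 ⊛ h 0)
  lower-even (suc i) i<k = subst (λ t → θ (suc t) ⊛ h t ≼ 4 · f t ⊕ X 4 ⊛ h t) (sym (lemma i))
    (≼-trans step₂ (lower-step (suc (2 * i)) (suc (2 * i)) (≼-trans (≼-⊕ʳ _ _) (lower-step (suc (2 * i)) (2 * i) (lower-even i (<⇒≤ i<k))))))
    where
    lemma : ∀ i → 2 * suc i ≡ 2 + 2 * i
    lemma = NS.solve-∀
    t = suc (2 * i)
    v = X (2 * suc t)
    v≈ : v ≈ X (4 * suc i)
    v≈ = ≡⇒≈ (cong X (4[i+1]≡ i))
    vh : v ⊛ h t ≼ h t
    vh = ≼-trans (≈⇒≼ (⊛-congʳ (h t) v≈)) (h-shift (suc i) t i<k)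
    4h : X 4 ⊛ h t ≼ h t
    4h = h-shift 1 t (≤-trans (s≤s z≤n) i<k)
    v²≈ : X (4 * suc t) ≈ v ⊛ v
    v²≈ = ≈-trans (≡⇒≈ (cong X (e t))) (X-+ (2 * suc t) (2 * suc t))
      where
      e : ∀ t → 4 * suc t ≡ 2 * suc t + 2 * suc t
      e = NS.solve-∀
    4v²≈ : X (4 * suc (suc t)) ≈ X 4 ⊛ (v ⊛ v)
    4v²≈ = ≈-trans (≡⇒≈ (cong X (e t))) (≈-trans (X-+ 4 (4 * suc t)) (⊛-congˡ (X 4) v²≈))
      where
      e : ∀ t → 4 * suc (suc t) ≡ 4 + 4 * suc t
      e = NS.solve-∀
    vvh : v ⊛ v ⊛ h (suc t) ≼ 2 · (v ⊛ h t)
    vvh = ≼-trans (≈⇒≼ (≈-trans (⊛-congˡ (v ⊛ v) (h-suc t)) (solve 2 (λ v h → v :* v :* (h :+ v :* h) := v :* (v :* h :+ v :* (v :* h))) ≈-refl v (h t))))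
      (≼-trans (⊛-monoʳ v (⊕-mono vh (≼-trans (⊛-monoʳ v vh) vh))) (≈⇒≼ (≈-trans (R.distribˡ v (h t) (h t))
        (mk≈ λ n → cong ((v ⊛ h t) n +_) (sym (+-identityʳ _))))))
    4vvh : X 4 ⊛ (v ⊛ v) ⊛ h (suc t) ≼ 2 · (v ⊛ h t)
    4vvh = ≼-trans (≈⇒≼ (R.*-assoc (X 4) (v ⊛ v) (h (suc t)))) (≼-trans (⊛-monoʳ (X 4) vvh)
      (≼-trans (≈⇒≼ (⊛-· 2 (X 4) (v ⊛ h t))) (·-mono 2 (≼-trans (≈⇒≼ (solve 3 (λ x v h → x :* (v :* h) := v :* (x :* h)) ≈-refl (X 4) v (h t))) (⊛-monoʳ v 4h)))))
    step₂ : θ (suc (suc t)) ⊛ h (suc t) ≼ θ t ⊛ h (suc t) ⊕ 4 · (v ⊛ h t)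
    step₂ = ≼-trans (≈⇒≼ (≈-trans (⊛-congʳ (h (suc t)) (⊕-cong (⊕-congˡ (θ t) v²≈) 4v²≈))
        (solve 4 (λ a b c h → (a :+ b :+ c) :* h := a :* h :+ (b :* h :+ c :* h)) ≈-refl (θ t) (v ⊛ v) (X 4 ⊛ (v ⊛ v)) (h (suc t)))))
      (⊕-mono (≼-refl {θ t ⊛ h (suc t)}) (≼-trans (⊕-mono vvh 4vvh) (mk≼ λ n → ≤-reflexive (e ((v ⊛ h t) n)))))
      where
      e : ∀ x → 2 * x + 2 * x ≡ 4 * x
      e = NS.solve-∀

half : ∀ k → (∃[ i ] k ≡ 2 * i) ⊎ (∃[ i ] k ≡ suc (2 * i))
half zero    = inj₁ (0 , refl)
half (suc k) with half k
... | inj₁ (i , refl) = inj₂ (i , refl)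
... | inj₂ (i , refl) = inj₁ (suc i , lemma i)
  where
  lemma : ∀ i → suc (suc (2 * i)) ≡ 2 * suc i
  lemma = NS.solve-∀

-- For odd k the part 2k has no partner divisible by 4; the extra 1 covers it.
Bw≼ : ∀ k → 4 · (B k ⊛ w k) ≼ suc (3 * k) · (B k ⊛ Φ k)
Bw≼ k with half k
... | inj₁ (i , refl) = ≼-trans (Row.upper-even (2 * i) i (m≤m+n i (i + 0)))
  (mk≼ λ n → *-monoˡ-≤ ((B (2 * i) ⊛ Φ (2 * i)) n) (≤-trans (≤-reflexive (lemma i)) (n≤1+n (3 * (2 * i)))))
  where
  lemma : ∀ i → 6 * i ≡ 3 * (2 * i)
  lemma = NS.solve-∀
... | inj₂ (i , refl) = ≼-trans (Row.upper-step (suc (2 * i)) (6 * i) (2 * i) (Row.upper-even (suc (2 * i)) i (m≤n⇒m≤1+n (m≤m+n i (i + 0)))))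
  (mk≼ λ n → ≤-reflexive (cong (_* (B (suc (2 * i)) ⊛ Φ (suc (2 * i))) n) (lemma i)))
  where
  lemma : ∀ i → 6 * i + 4 ≡ suc (3 * suc (2 * i))
  lemma = NS.solve-∀

θ≼Bw : ∀ k → θ k ⊛ (B k ⊛ Φ k) ≼ 4 · (B k ⊛ w k) ⊕ X 4 ⊛ (B k ⊛ Φ k)
θ≼Bw k with half k
... | inj₁ (i , refl) = ≼-trans (⊛-monoˡ (B (2 * i) ⊛ Φ (2 * i)) (≼-⊕ʳ (θ (2 * i)) (X (4 * suc (2 * i)))))
  (Row.lower-even (2 * i) i (m≤m+n i (i + 0)))
... | inj₂ (i , refl) = ≼-trans (≼-⊕ʳ _ _) (Row.lower-step (suc (2 * i)) (suc (2 * i)) (2 * i)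
  (Row.lower-even (suc (2 * i)) i (m≤n⇒m≤1+n (m≤m+n i (i + 0)))))

Σ∞-· : ∀ c F → Σ∞ (λ k → c · F k) ≈ c · Σ∞ F
Σ∞-· c F = mk≈ λ n → Σ<-* (suc n) c (λ k → F k n)

4Λ≼ : 4 · Λ ≼ 3 · Z ⊕ P
4Λ≼ = begin
  4 · Λ  ≈⟨ Σ∞-· 4 Λterm ⟨
  Σ∞ (λ k → 4 · Λterm k)  ≤⟨ Σ∞-mono term ⟩
  Σ∞ (λ k → 3 · ((k · B k) ⊛ Even) ⊕ B k ⊛ Even)  ≈⟨ Σ∞-⊕ (λ k → 3 · ((k · B k) ⊛ Even)) (λ k → B k ⊛ Even) ⟩
  Σ∞ (λ k → 3 · ((k · B k) ⊛ Even)) ⊕ Σ∞ (λ k → B k ⊛ Even)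
    ≈⟨ ⊕-cong (≈-trans (Σ∞-· 3 (λ k → (k · B k) ⊛ Even)) (·-cong 3 (≈-sym (Σ∞-⊛ (small-· B-small) Even)))) (≈-sym (Σ∞-⊛ B-small Even)) ⟩
  3 · Z ⊕ P  ∎
  where
  open ≼R
  lemma : ∀ k x → suc (3 * k) * x ≡ 3 * (k * x) + x
  lemma = NS.solve-∀
  term : ∀ k → 4 · Λterm k ≼ 3 · ((k · B k) ⊛ Even) ⊕ B k ⊛ Even
  term k = begin
    4 · (B k ⊛ w k ⊛ tailDist k)  ≈⟨ ·-⊛ 4 (B k ⊛ w k) (tailDist k) ⟨
    (4 · (B k ⊛ w k)) ⊛ tailDist k  ≤⟨ ⊛-monoˡ (tailDist k) (Bw≼ k) ⟩
    (suc (3 * k) · (B k ⊛ Φ k)) ⊛ tailDist k  ≈⟨ ·-⊛ (suc (3 * k)) (B k ⊛ Φ k) (tailDist k) ⟩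
    suc (3 * k) · (B k ⊛ Φ k ⊛ tailDist k)  ≈⟨ ·-cong (suc (3 * k)) (≈-trans (R.*-assoc (B k) (Φ k) (tailDist k)) (⊛-congˡ (B k) (≈-sym (Even≈ k)))) ⟩
    suc (3 * k) · (B k ⊛ Even)  ≈⟨ mk≈ (λ n → lemma k ((B k ⊛ Even) n)) ⟩
    3 · (k · (B k ⊛ Even)) ⊕ B k ⊛ Even  ≈⟨ ⊕-congʳ (B k ⊛ Even) (·-cong 3 (·-⊛ k (B k) Even)) ⟨
    3 · ((k · B k) ⊛ Even) ⊕ B k ⊛ Even  ∎

Θterm : ℕ → Series
Θterm k = θ k ⊛ (B k ⊛ Even)

Θ : Series
Θ = Σ∞ Θterm

Θ≼ : Θ ≼ 4 · Λ ⊕ X 4 ⊛ P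
Θ≼ = begin
  Σ∞ Θterm  ≤⟨ Σ∞-mono term ⟩
  Σ∞ (λ k → 4 · Λterm k ⊕ X 4 ⊛ (B k ⊛ Even))  ≈⟨ Σ∞-⊕ (λ k → 4 · Λterm k) (λ k → X 4 ⊛ (B k ⊛ Even)) ⟩
  Σ∞ (λ k → 4 · Λterm k) ⊕ Σ∞ (λ k → X 4 ⊛ (B k ⊛ Even))
    ≈⟨ ⊕-cong (Σ∞-· 4 Λterm) (≈-trans (Σ∞-⊛ˡ (small-⊛ B-small Even) (X 4)) (⊛-congˡ (X 4) (≈-sym (Σ∞-⊛ B-small Even)))) ⟩
  4 · Λ ⊕ X 4 ⊛ P  ∎
  where
  open ≼R
  Φtail : ∀ k → B k ⊛ Φ k ⊛ tailDist k ≈ B k ⊛ Even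
  Φtail k = ≈-trans (R.*-assoc (B k) (Φ k) (tailDist k)) (⊛-congˡ (B k) (≈-sym (Even≈ k)))
  term : ∀ k → Θterm k ≼ 4 · Λterm k ⊕ X 4 ⊛ (B k ⊛ Even)
  term k = begin
    θ k ⊛ (B k ⊛ Even)  ≈⟨ ⊛-congˡ (θ k) (Φtail k) ⟨
    θ k ⊛ (B k ⊛ Φ k ⊛ tailDist k)  ≈⟨ R.*-assoc (θ k) (B k ⊛ Φ k) (tailDist k) ⟨
    θ k ⊛ (B k ⊛ Φ k) ⊛ tailDist k  ≤⟨ ⊛-monoˡ (tailDist k) (θ≼Bw k) ⟩
    (4 · (B k ⊛ w k) ⊕ X 4 ⊛ (B k ⊛ Φ k)) ⊛ tailDist k ≈⟨ R.distribʳ (tailDist k) (4 · (B k ⊛ w k)) (X 4 ⊛ (B k ⊛ Φ k)) ⟩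
    (4 · (B k ⊛ w k)) ⊛ tailDist k ⊕ X 4 ⊛ (B k ⊛ Φ k) ⊛ tailDist k
      ≈⟨ ⊕-cong (·-⊛ 4 (B k ⊛ w k) (tailDist k)) (≈-trans (R.*-assoc (X 4) (B k ⊛ Φ k) (tailDist k)) (⊛-congˡ (X 4) (Φtail k))) ⟩
    4 · Λterm k ⊕ X 4 ⊛ (B k ⊛ Even)  ∎

θ-shift : ∀ k → θ k ⊕ X (4 * suc k) ≈ X 4 ⊕ X 4 ⊛ θ k
θ-shift zero    = ≈-trans (R.+-comm O (X 4)) (⊕-congˡ (X 4) (≈-sym (R.zeroʳ (X 4))))
θ-shift (suc k) = ≈-trans (⊕-cong (θ-shift k) (≈-trans (≡⇒≈ (cong X (lemma k))) (X-+ 4 (4 * suc k))))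
  (solve 3 (λ x t y → x :+ x :* t :+ x :* y := x :+ x :* (t :+ y)) ≈-refl (X 4) (θ k) (X (4 * suc k)))
  where
  lemma : ∀ k → 4 * suc (suc k) ≡ 4 + 4 * suc k
  lemma = NS.solve-∀

-- By `eul-scale`, q⁴ᵏ `B k` is the k-th term of `Dist 5 4`. Summing the geometric progression `θ k`
-- therefore gives (1 - q⁴) Θ = q⁴ (P - P') = q⁵ P'.
Θ-eq : Θ ≈ geo 4 ⊛ (X 5 ⊛ P')
Θ-eq = geo-solves {4} pos (⊕-cancelʳ-≈ (X 4 ⊛ P') (begin
  Θ ⊕ X 4 ⊛ P'  ≈⟨ ⊕-congˡ Θ (≈-trans (⊛-congˡ (X 4) (Σ∞-⊛ (eul-small 4 pos) Even)) (≈-sym (Σ∞-⊛ˡ (small-⊛ (eul-small 4 pos) Even) (X 4)))) ⟩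
  Θ ⊕ Σ∞ (λ k → X 4 ⊛ (eul 5 4 k ⊛ Even))  ≈⟨ Σ∞-⊕ Θterm (λ k → X 4 ⊛ (eul 5 4 k ⊛ Even)) ⟨
  Σ∞ (λ k → Θterm k ⊕ X 4 ⊛ (eul 5 4 k ⊛ Even))  ≈⟨ Σ∞-cong term ⟩
  Σ∞ (λ k → X 4 ⊛ (B k ⊛ Even) ⊕ X 4 ⊛ Θterm k)  ≈⟨ Σ∞-⊕ (λ k → X 4 ⊛ (B k ⊛ Even)) (λ k → X 4 ⊛ Θterm k) ⟩
  Σ∞ (λ k → X 4 ⊛ (B k ⊛ Even)) ⊕ Σ∞ (λ k → X 4 ⊛ Θterm k)
    ≈⟨ ⊕-cong (≈-trans (Σ∞-⊛ˡ (small-⊛ B-small Even) (X 4)) (⊛-congˡ (X 4) (≈-sym (Σ∞-⊛ B-small Even)))) (Σ∞-⊛ˡ Θ-small (X 4)) ⟩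
  X 4 ⊛ P ⊕ X 4 ⊛ Θ  ≈⟨ ⊕-congʳ (X 4 ⊛ Θ) (≈-trans (⊛-congˡ (X 4) P≈P') (R.distribˡ (X 4) P' (X 1 ⊛ P'))) ⟩
  X 4 ⊛ P' ⊕ X 4 ⊛ (X 1 ⊛ P') ⊕ X 4 ⊛ Θ  ≈⟨ ⊕-congʳ (X 4 ⊛ Θ) (⊕-congˡ (X 4 ⊛ P') (XX 4 1 P' refl)) ⟩
  X 4 ⊛ P' ⊕ X 5 ⊛ P' ⊕ X 4 ⊛ Θ  ≈⟨ solve 3 (λ a b c → a :+ b :+ c := b :+ c :+ a) ≈-refl (X 4 ⊛ P') (X 5 ⊛ P') (X 4 ⊛ Θ) ⟩
  X 5 ⊛ P' ⊕ X 4 ⊛ Θ ⊕ X 4 ⊛ P'  ∎))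
  where
  open ≈R
  Θ-small : Small Θterm
  Θ-small k n n<k = upTo ([]-trans ([]-⊛ ([]-refl {f = θ k}) (mk[] (small-⊛ B-small Even k))) (≈⇒[] (R.zeroʳ (θ k)))) n n<k
  term : ∀ k → Θterm k ⊕ X 4 ⊛ (eul 5 4 k ⊛ Even) ≈ X 4 ⊛ (B k ⊛ Even) ⊕ X 4 ⊛ Θterm k
  term k = begin
    θ k ⊛ (B k ⊛ Even) ⊕ X 4 ⊛ (eul 5 4 k ⊛ Even)  ≈⟨ ⊕-congˡ (Θterm k) (⊛-congˡ (X 4) (⊛-congʳ Even (eul-scale 1 4 k))) ⟩
    θ k ⊛ (B k ⊛ Even) ⊕ X 4 ⊛ (X (4 * k) ⊛ B k ⊛ Even)
      ≈⟨ solve 5 (λ t b e x y → t :* (b :* e) :+ x :* (y :* b :* e) := (t :+ x :* y) :* (b :* e)) ≈-refl (θ k) (B k) Even (X 4) (X (4 * k)) ⟩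
    (θ k ⊕ X 4 ⊛ X (4 * k)) ⊛ (B k ⊛ Even)  ≈⟨ ⊛-congʳ (B k ⊛ Even) (≈-trans (⊕-congˡ (θ k) (≈-trans (≈-sym (X-+ 4 (4 * k))) (≡⇒≈ (cong X (sym (*-suc 4 k)))))) (θ-shift k)) ⟩
    (X 4 ⊕ X 4 ⊛ θ k) ⊛ (B k ⊛ Even)  ≈⟨ solve 3 (λ x t b → (x :+ x :* t) :* b := x :* b :+ x :* (t :* b)) ≈-refl (X 4) (θ k) (B k ⊛ Even) ⟩
    X 4 ⊛ (B k ⊛ Even) ⊕ X 4 ⊛ Θterm k  ∎

-- Since P = P' + q P', the left side consists of q⁹ P' and q¹⁰ P', each divided by 1 - q⁴. The
-- first is q⁴ Θ; for the second one q⁵ is dropped by `P'-shift5`. So Θ is at least S/8 up to O(P).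
progression≼Θ : X 9 ⊛ (geo 4 ⊛ P) ≼ 2 · Θ
progression≼Θ = begin
  X 9 ⊛ (geo 4 ⊛ P)  ≈⟨ ⊛-congˡ (X 9) (⊛-congˡ (geo 4) P≈P') ⟩
  X 9 ⊛ (geo 4 ⊛ (P' ⊕ X 1 ⊛ P'))  ≈⟨ solve 4 (λ x g p y → x :* (g :* (p :+ y :* p)) := g :* (x :* p) :+ g :* (x :* (y :* p))) ≈-refl (X 9) (geo 4) P' (X 1) ⟩
  geo 4 ⊛ (X 9 ⊛ P') ⊕ geo 4 ⊛ (X 9 ⊛ (X 1 ⊛ P'))  ≤⟨ ⊕-mono first second ⟩
  Θ ⊕ Θ  ≈⟨ mk≈ (λ n → cong (Θ n +_) (sym (+-identityʳ (Θ n)))) ⟩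
  2 · Θ  ∎
  where
  open ≼R
  first : geo 4 ⊛ (X 9 ⊛ P') ≼ Θ
  first = ≼-trans (≈⇒≼ (≈-trans (⊛-congˡ (geo 4) (≈-sym (XX 4 5 P' refl)))
      (solve 3 (λ g x p → g :* (x :* p) := x :* (g :* p)) ≈-refl (geo 4) (X 4) (X 5 ⊛ P'))))
    (≼-trans (geo-shift {4} (X 5 ⊛ P') pos) (≈⇒≼ (≈-sym Θ-eq)))
  second : geo 4 ⊛ (X 9 ⊛ (X 1 ⊛ P')) ≼ Θ
  second = ≼-trans (⊛-monoʳ (geo 4) (≼-trans (≈⇒≼ (≈-trans (XX 9 1 P' refl) (≈-sym (XX 5 5 P' refl)))) (⊛-monoʳ (X 5) P'-shift5)))
    (≈⇒≼ (≈-sym Θ-eq))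

Z⊕4Y≼ : Z ⊕ 4 · Y ≼ 4 · D ⊕ P
Z⊕4Y≼ = mk≼ λ n → +-cancelʳ-≤ (3 * Z n) _ _ (begin
  Z n + 4 * Y n + 3 * Z n  ≡⟨ lemma₁ (Z n) (Y n) ⟩
  4 * (Z n + Y n)  ≡⟨ cong (4 *_) (at D⊕Λ≈ n) ⟨
  4 * (D n + Λ n)  ≡⟨ *-distribˡ-+ 4 (D n) (Λ n) ⟩
  4 * D n + 4 * Λ n  ≤⟨ +-monoʳ-≤ (4 * D n) (le 4Λ≼ n) ⟩
  4 * D n + (3 * Z n + P n)  ≡⟨ lemma₂ (4 * D n) (3 * Z n) (P n) ⟩
  4 * D n + P n + 3 * Z n  ∎)
  where
  open ≤-Reasoning
  lemma₁ : ∀ z y → z + 4 * y + 3 * z ≡ 4 * (z + y)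
  lemma₁ = NS.solve-∀
  lemma₂ : ∀ d z p → d + (z + p) ≡ d + p + z
  lemma₂ = NS.solve-∀

progression≼8Λ : X 9 ⊛ (geo 4 ⊛ P) ≼ 8 · Λ ⊕ 2 · P
progression≼8Λ = mk≼ λ n → begin
  (X 9 ⊛ (geo 4 ⊛ P)) n  ≤⟨ le progression≼Θ n ⟩
  2 * Θ n  ≤⟨ *-monoʳ-≤ 2 (≤-trans (le Θ≼ n) (+-monoʳ-≤ (4 * Λ n) (le (X-mono 4 P-mono) n))) ⟩
  2 * (4 * Λ n + P n)  ≡⟨ lemma (Λ n) (P n) ⟩
  8 * Λ n + 2 * P n  ∎
  where
  open ≤-Reasoning
  lemma : ∀ l p → 2 * (4 * l + p) ≡ 8 * l + 2 * p
  lemma = NS.solve-∀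

-- Gap partitions with a given number of parts

q : Series
q = X 1

-- The monomial q²ᵗ, written so that a successor exposes its factors to the ring solver.
Q : ℕ → Series
Q zero    = I
Q (suc t) = q ⊛ (q ⊛ Q t)

Q≈X : ∀ t → X (2 * t) ≈ Q t
Q≈X zero    = ≈-refl
Q≈X (suc t) = ≈-trans (≡⇒≈ (cong X (*-suc 2 t))) (≈-trans (X-+ 1 (suc (2 * t)))
  (⊛-congˡ q (≈-trans (X-+ 1 (2 * t)) (⊛-congˡ q (Q≈X t)))))

-- b I (suc t) ℓ counts the gap partitions with ℓ parts, all at most 2t; b O (suc t) ℓ
-- those without part 1. The index 0 provides the initial value of the recursion.
b : Series → ℕ → ℕ → Series
b s zero          zero    = s
b s zero          (suc ℓ) = O
b s (suc zero)    zero    = I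
b s (suc zero)    (suc ℓ) = O
b s (suc (suc t)) zero    = I
b s (suc (suc t)) (suc ℓ) = b s (suc t) (suc ℓ) ⊕ q ⊛ Q t ⊛ b s t ℓ ⊕ Q (suc t) ⊛ b s (suc t) ℓ

b-zero : ∀ s t → b s (suc t) zero ≡ I
b-zero s zero    = refl
b-zero s (suc t) = refl

-- This is (1 - q²ᵗ)(1 - `b O t 0`) = 0 times q, rearranged: for t = 0 the first factor vanishes,
-- otherwise the second.
b-zero-mixed : ∀ t → q ⊛ b O t 0 ⊕ q ⊛ Q t ≈ q ⊛ Q t ⊛ b O t 0 ⊕ q
b-zero-mixed zero    = solve 1 (λ q → q :* con 0 :+ q :* con 1 := q :* con 1 :* con 0 :+ q) ≈-refl q
b-zero-mixed (suc t) = ≈-trans (⊕-congʳ (q ⊛ Q (suc t)) (⊛-congˡ q (≡⇒≈ (b-zero O t))))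
  (≈-trans (solve 2 (λ q x → q :* con 1 :+ q :* x := q :* x :* con 1 :+ q) ≈-refl q (Q (suc t)))
    (⊕-congʳ q (⊛-congˡ (q ⊛ Q (suc t)) (≡⇒≈ (sym (b-zero O t))))))

before : ℕ → ℕ → Series
before zero    ℓ = O
before (suc t) ℓ = b O t ℓ

-- The recursion of `b` one index lower. The factor q² keeps the exponent 2t - 1 from being negative
-- at t = 0, where `before` supplies the missing value.
b-back : ∀ t ℓ → q ⊛ q ⊛ b O (suc t) (suc ℓ) ≈ q ⊛ q ⊛ b O t (suc ℓ) ⊕ q ⊛ Q t ⊛ before t ℓ ⊕ q ⊛ q ⊛ Q t ⊛ b O t ℓ
b-back zero    zero    = solve 1 (λ q → q :* q :* con 0 := q :* q :* con 0 :+ q :* con 1 :* con 0 :+ q :* q :* con 1 :* con 0) ≈-refl q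
b-back zero    (suc ℓ) = solve 1 (λ q → q :* q :* con 0 := q :* q :* con 0 :+ q :* con 1 :* con 0 :+ q :* q :* con 1 :* con 0) ≈-refl q
b-back (suc t) ℓ       = solve 5 (λ q x u v r → q :* q :* (u :+ q :* x :* v :+ q :* (q :* x) :* r)
    := q :* q :* u :+ q :* (q :* (q :* x)) :* v :+ q :* q :* (q :* (q :* x)) :* r) ≈-refl
  q (Q t) (b O (suc t) (suc ℓ)) (b O t ℓ) (b O (suc t) ℓ)

-- Splitting off a part 1.
b-ones : ∀ t ℓ → b I (suc t) (suc ℓ) ≈ b O (suc t) (suc ℓ) ⊕ q ⊛ Q ℓ ⊛ b O t ℓ
b-ones zero zero    = solve 1 (λ q → con 0 := con 0 :+ q :* con 1 :* con 0) ≈-refl q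
b-ones zero (suc ℓ) = solve 1 (λ q → con 0 := con 0 :+ q :* con 0) ≈-refl (q ⊛ Q (suc ℓ))
b-ones (suc t) zero = begin
  b I (suc t) 1 ⊕ q ⊛ Q t ⊛ b I t 0 ⊕ Q (suc t) ⊛ b I (suc t) 0
    ≈⟨ ⊕-cong (⊕-cong (b-ones t 0) (⊛-congˡ (q ⊛ Q t) (bI0 t))) (⊛-congˡ (Q (suc t)) (≡⇒≈ (trans (b-zero I t) (sym (b-zero O t))))) ⟩
  u ⊕ q ⊛ I ⊛ b O t 0 ⊕ q ⊛ Q t ⊛ I ⊕ v
    ≈⟨ solve 5 (λ q u x y v → u :+ q :* con 1 :* x :+ q :* y :* con 1 :+ v := u :+ v :+ (q :* x :+ q :* y)) ≈-refl q u (b O t 0) (Q t) v ⟩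
  u ⊕ v ⊕ (q ⊛ b O t 0 ⊕ q ⊛ Q t)
    ≈⟨ ⊕-congˡ (u ⊕ v) (b-zero-mixed t) ⟩
  u ⊕ v ⊕ (q ⊛ Q t ⊛ b O t 0 ⊕ q)
    ≈⟨ solve 4 (λ u v x q → u :+ v :+ (x :+ q) := u :+ x :+ v :+ q :* con 1 :* con 1) ≈-refl u v (q ⊛ Q t ⊛ b O t 0) q ⟩
  u ⊕ q ⊛ Q t ⊛ b O t 0 ⊕ v ⊕ q ⊛ I ⊛ I
    ≈⟨ ⊕-congˡ (u ⊕ q ⊛ Q t ⊛ b O t 0 ⊕ v) (⊛-congˡ (q ⊛ I) (≡⇒≈ (sym (b-zero O t)))) ⟩
  b O (suc (suc t)) 1 ⊕ q ⊛ Q 0 ⊛ b O (suc t) 0 ∎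
  where
  open ≈R
  u = b O (suc t) 1
  v = Q (suc t) ⊛ b O (suc t) 0
  bI0 : ∀ t → b I t 0 ≈ I
  bI0 zero    = ≈-refl
  bI0 (suc t) = ≡⇒≈ (b-zero I t)
b-ones (suc t) (suc ℓ) = begin
  b I (suc t) (2 + ℓ) ⊕ q ⊛ T ⊛ b I t (suc ℓ) ⊕ Q (suc t) ⊛ b I (suc t) (suc ℓ)
    ≈⟨ ⊕-cong (⊕-cong (b-ones t (suc ℓ)) (⊛-congˡ (q ⊛ T) (prev t))) (⊛-congˡ (Q (suc t)) (b-ones t ℓ)) ⟩
  (u ⊕ q ⊛ (q ⊛ (q ⊛ M)) ⊛ v) ⊕ q ⊛ T ⊛ (v ⊕ q ⊛ M ⊛ z) ⊕ q ⊛ (q ⊛ T) ⊛ (r ⊕ q ⊛ M ⊛ x)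
    ≈⟨ solve 8 (λ q T M u v z r x →
         (u :+ q :* (q :* (q :* M)) :* v) :+ q :* T :* (v :+ q :* M :* z) :+ q :* (q :* T) :* (r :+ q :* M :* x)
         := u :+ q :* T :* v :+ q :* (q :* T) :* r :+ q :* M :* (q :* q :* v :+ q :* T :* z :+ q :* q :* T :* x)) ≈-refl q T M u v z r x ⟩
  u ⊕ q ⊛ T ⊛ v ⊕ q ⊛ (q ⊛ T) ⊛ r ⊕ q ⊛ M ⊛ (q ⊛ q ⊛ v ⊕ q ⊛ T ⊛ z ⊕ q ⊛ q ⊛ T ⊛ x)
    ≈⟨ ⊕-congˡ (u ⊕ q ⊛ T ⊛ v ⊕ q ⊛ (q ⊛ T) ⊛ r) (⊛-congˡ (q ⊛ M) (≈-sym (b-back t ℓ))) ⟩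
  u ⊕ q ⊛ T ⊛ v ⊕ q ⊛ (q ⊛ T) ⊛ r ⊕ q ⊛ M ⊛ (q ⊛ q ⊛ r)
    ≈⟨ ⊕-congˡ (u ⊕ q ⊛ T ⊛ v ⊕ q ⊛ (q ⊛ T) ⊛ r) (solve 3 (λ q M r → q :* M :* (q :* q :* r) := q :* (q :* (q :* M)) :* r) ≈-refl q M r) ⟩
  b O (suc (suc t)) (suc (suc ℓ)) ⊕ q ⊛ Q (suc ℓ) ⊛ b O (suc t) (suc ℓ) ∎
  where
  open ≈R
  T = Q t
  M = Q ℓ
  u = b O (suc t) (2 + ℓ)
  v = b O t (suc ℓ)
  z = before t ℓ
  r = b O (suc t) (suc ℓ)
  x = b O t ℓ
  prev : ∀ t → b I t (suc ℓ) ≈ b O t (suc ℓ) ⊕ q ⊛ M ⊛ before t ℓ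
  prev zero    = ≈-sym (≈-trans (R.+-identityˡ (q ⊛ M ⊛ O)) (R.zeroʳ (q ⊛ M)))
  prev (suc t) = b-ones t ℓ

-- Removing the smallest part, which is at least 4, or 2, or 3.
b-smallest : ∀ t ℓ → b O (suc (suc t)) (suc ℓ) ≈
  Q (suc ℓ) ⊛ (b O (suc t) (suc ℓ) ⊕ b O (suc t) ℓ) ⊕ q ⊛ q ⊛ q ⊛ Q ℓ ⊛ Q ℓ ⊛ b O t ℓ
b-smallest zero zero    = solve 1 (λ q → con 0 :+ q :* con 1 :* con 0 :+ q :* (q :* con 1) :* con 1
  := q :* (q :* con 1) :* (con 0 :+ con 1) :+ q :* q :* q :* con 1 :* con 1 :* con 0) ≈-refl q
b-smallest zero (suc ℓ) = solve 2 (λ q m → con 0 :+ q :* con 1 :* con 0 :+ q :* (q :* con 1) :* con 0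
  := q :* (q :* m) :* (con 0 :+ con 0) :+ q :* q :* q :* m :* m :* con 0) ≈-refl q (Q (suc ℓ))
b-smallest (suc t) zero = begin
  b O (suc (suc t)) 1 ⊕ q ⊛ Q (suc t) ⊛ b O (suc t) 0 ⊕ Q (suc (suc t)) ⊛ b O (suc (suc t)) 0
    ≈⟨ ⊕-congʳ (Q (suc (suc t)) ⊛ I) (⊕-cong (b-smallest t 0) (⊛-congˡ (q ⊛ Q (suc t)) (≡⇒≈ (b-zero O t)))) ⟩
  Q 1 ⊛ (u ⊕ b O (suc t) 0) ⊕ q ⊛ q ⊛ q ⊛ I ⊛ I ⊛ x ⊕ q ⊛ Q (suc t) ⊛ I ⊕ Q (suc (suc t)) ⊛ I
    ≈⟨ ⊕-congʳ (Q (suc (suc t)) ⊛ I) (⊕-congʳ (q ⊛ Q (suc t) ⊛ I) (⊕-congʳ (q ⊛ q ⊛ q ⊛ I ⊛ I ⊛ x) (⊛-congˡ (Q 1) (⊕-congˡ u (≡⇒≈ (b-zero O t)))))) ⟩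
  Q 1 ⊛ (u ⊕ I) ⊕ q ⊛ q ⊛ q ⊛ I ⊛ I ⊛ x ⊕ q ⊛ Q (suc t) ⊛ I ⊕ Q (suc (suc t)) ⊛ I
    ≈⟨ solve 4 (λ q u x y → q :* (q :* con 1) :* (u :+ con 1) :+ q :* q :* q :* con 1 :* con 1 :* x :+ q :* (q :* (q :* y)) :* con 1 :+ q :* (q :* (q :* (q :* y))) :* con 1
         := q :* q :* (u :+ con 1 :+ q :* (q :* y)) :+ q :* q :* (q :* x :+ q :* y)) ≈-refl q u x (Q t) ⟩
  q ⊛ q ⊛ (u ⊕ I ⊕ q ⊛ (q ⊛ Q t)) ⊕ q ⊛ q ⊛ (q ⊛ x ⊕ q ⊛ Q t)
    ≈⟨ ⊕-congˡ (q ⊛ q ⊛ (u ⊕ I ⊕ q ⊛ (q ⊛ Q t))) (⊛-congˡ (q ⊛ q) (b-zero-mixed t)) ⟩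
  q ⊛ q ⊛ (u ⊕ I ⊕ q ⊛ (q ⊛ Q t)) ⊕ q ⊛ q ⊛ (q ⊛ Q t ⊛ x ⊕ q)
    ≈⟨ solve 4 (λ q u x y → q :* q :* (u :+ con 1 :+ q :* (q :* y)) :+ q :* q :* (q :* y :* x :+ q)
         := q :* (q :* con 1) :* (u :+ q :* y :* x :+ q :* (q :* y) :* con 1 :+ con 1) :+ q :* q :* q :* con 1 :* con 1 :* con 1) ≈-refl q u x (Q t) ⟩
  Q 1 ⊛ (u ⊕ q ⊛ Q t ⊛ x ⊕ Q (suc t) ⊛ I ⊕ I) ⊕ q ⊛ q ⊛ q ⊛ I ⊛ I ⊛ I
    ≈⟨ ⊕-cong (⊛-congˡ (Q 1) (⊕-congʳ I (⊕-congˡ (u ⊕ q ⊛ Q t ⊛ x) (⊛-congˡ (Q (suc t)) (≡⇒≈ (sym (b-zero O t)))))))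
              (⊛-congˡ (q ⊛ q ⊛ q ⊛ I ⊛ I) (≡⇒≈ (sym (b-zero O t)))) ⟩
  Q 1 ⊛ (b O (suc (suc t)) 1 ⊕ b O (suc (suc t)) 0) ⊕ q ⊛ q ⊛ q ⊛ I ⊛ I ⊛ b O (suc t) 0 ∎
  where
  open ≈R
  u = b O (suc t) 1
  x = b O t 0
b-smallest (suc t) (suc ℓ) = begin
  b O (suc (suc t)) (2 + ℓ) ⊕ q ⊛ Q (suc t) ⊛ r ⊕ Q (suc (suc t)) ⊛ b O (suc (suc t)) (suc ℓ)
    ≈⟨ ⊕-cong (⊕-cong (b-smallest t (suc ℓ)) (⊛-congˡ (q ⊛ Q (suc t)) (prev t))) (⊛-congˡ (Q (suc (suc t))) (b-smallest t ℓ)) ⟩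
  (Q (2 + ℓ) ⊛ (u ⊕ r) ⊕ q ⊛ q ⊛ q ⊛ Q (suc ℓ) ⊛ Q (suc ℓ) ⊛ v) ⊕ q ⊛ Q (suc t) ⊛ (Q (suc ℓ) ⊛ (v ⊕ x) ⊕ q ⊛ q ⊛ q ⊛ M ⊛ M ⊛ z)
    ⊕ Q (suc (suc t)) ⊛ (Q (suc ℓ) ⊛ (r ⊕ y) ⊕ q ⊛ q ⊛ q ⊛ M ⊛ M ⊛ x)
    ≈⟨ solve 9 (λ q T M u v z r x y → let M' = q :* (q :* M) ; T' = q :* (q :* T) in
         (q :* (q :* M') :* (u :+ r) :+ q :* q :* q :* M' :* M' :* v) :+ q :* T' :* (M' :* (v :+ x) :+ q :* q :* q :* M :* M :* z)
           :+ q :* (q :* T') :* (M' :* (r :+ y) :+ q :* q :* q :* M :* M :* x)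
         := q :* (q :* M') :* (u :+ q :* T :* v :+ T' :* r :+ (r :+ q :* T :* x :+ T' :* y))
           :+ q :* M' :* M' :* (q :* q :* v :+ q :* T :* z :+ q :* q :* T :* x)) ≈-refl q T M u v z r x y ⟩
  Q (2 + ℓ) ⊛ (u ⊕ q ⊛ T ⊛ v ⊕ Q (suc t) ⊛ r ⊕ (r ⊕ q ⊛ T ⊛ x ⊕ Q (suc t) ⊛ y))
    ⊕ q ⊛ Q (suc ℓ) ⊛ Q (suc ℓ) ⊛ (q ⊛ q ⊛ v ⊕ q ⊛ T ⊛ z ⊕ q ⊛ q ⊛ T ⊛ x)
    ≈⟨ ⊕-congˡ (Q (2 + ℓ) ⊛ (u ⊕ q ⊛ T ⊛ v ⊕ Q (suc t) ⊛ r ⊕ (r ⊕ q ⊛ T ⊛ x ⊕ Q (suc t) ⊛ y)))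
        (≈-trans (⊛-congˡ (q ⊛ Q (suc ℓ) ⊛ Q (suc ℓ)) (≈-sym (b-back t ℓ)))
          (solve 3 (λ q M r → q :* M :* M :* (q :* q :* r) := q :* q :* q :* M :* M :* r) ≈-refl q (Q (suc ℓ)) r)) ⟩
  Q (2 + ℓ) ⊛ (b O (suc (suc t)) (2 + ℓ) ⊕ b O (suc (suc t)) (suc ℓ)) ⊕ q ⊛ q ⊛ q ⊛ Q (suc ℓ) ⊛ Q (suc ℓ) ⊛ r ∎
  where
  open ≈R
  T = Q t
  M = Q ℓ
  u = b O (suc t) (2 + ℓ)
  v = b O t (suc ℓ)
  z = before t ℓ
  r = b O (suc t) (suc ℓ)
  x = b O t ℓ
  y = b O (suc t) ℓ
  prev : ∀ t → b O (suc t) (suc ℓ) ≈ Q (suc ℓ) ⊛ (b O t (suc ℓ) ⊕ b O t ℓ) ⊕ q ⊛ q ⊛ q ⊛ M ⊛ M ⊛ before t ℓ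
  prev (suc t) = b-smallest t ℓ
  prev zero    = ≈-sym (≈-trans (⊕-congʳ (q ⊛ q ⊛ q ⊛ M ⊛ M ⊛ O) (⊛-congˡ (Q (suc ℓ)) (≈-trans (R.+-identityˡ (b O 0 ℓ)) (b00 ℓ))))
    (solve 2 (λ a b → a :* con 0 :+ b :* con 0 := con 0) ≈-refl (Q (suc ℓ)) (q ⊛ q ⊛ q ⊛ M ⊛ M)))
    where
    b00 : ∀ ℓ → b O 0 ℓ ≈ O
    b00 zero    = ≈-refl
    b00 (suc ℓ) = ≈-refl

-- The limits of b O (suc t) ℓ and b I (suc t) ℓ for t → ∞.
noOnes gap : ℕ → Series
noOnes zero    = I
noOnes (suc ℓ) = geo (2 * suc ℓ) ⊛ ((Q (suc ℓ) ⊕ q ⊛ q ⊛ q ⊛ Q ℓ ⊛ Q ℓ) ⊛ noOnes ℓ)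

gap zero    = I
gap (suc ℓ) = noOnes (suc ℓ) ⊕ q ⊛ Q ℓ ⊛ noOnes ℓ

noOnes-unfold : ∀ ℓ → noOnes (suc ℓ) ≈ (Q (suc ℓ) ⊕ q ⊛ q ⊛ q ⊛ Q ℓ ⊛ Q ℓ) ⊛ noOnes ℓ ⊕ X (2 * suc ℓ) ⊛ noOnes (suc ℓ)
noOnes-unfold ℓ = geo-⊛-unfold {2 * suc ℓ} ((Q (suc ℓ) ⊕ q ⊛ q ⊛ q ⊛ Q ℓ ⊛ Q ℓ) ⊛ noOnes ℓ) pos

-- `b-smallest` and `noOnes-unfold` are the same recursion. Every term has a factor q, gaining one
-- degree; the term whose index lags by two has a further q to make up for it.
bO-limit : ∀ t ℓ → b O (suc t) ℓ ≈[ t ] noOnes ℓ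
bO-limit' : ∀ t ℓ → b O t ℓ ≈[ t ∸ 1 ] noOnes ℓ
bO-limit' zero    ℓ = mk[] λ _ ()
bO-limit' (suc t) ℓ = bO-limit t ℓ
bO-limit zero    ℓ       = mk[] λ _ ()
bO-limit (suc t) zero    = []-refl
bO-limit (suc t) (suc ℓ) = []-trans (≈⇒[] (≈-trans (b-smallest t ℓ) (regroup (b O (suc t) (suc ℓ) ⊕ b O (suc t) ℓ) (b O t ℓ))))
  ([]-trans ([]-⊕ ([]-X 1 ([]-⊛ ([]-refl {f = q ⊛ Q ℓ}) ([]-⊕ (bO-limit t (suc ℓ)) (bO-limit t ℓ))))
                  ([]-weaken (lemma t) ([]-X 1 ([]-X 1 ([]-⊛ ([]-refl {f = q ⊛ Q ℓ ⊛ Q ℓ}) (bO-limit' t ℓ))))))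
    (≈⇒[] (≈-trans (≈-sym (regroup (noOnes (suc ℓ) ⊕ noOnes ℓ) (noOnes ℓ))) (≈-sym unfold))))
  where
  lemma : ∀ t → suc t ≤ suc (suc (t ∸ 1))
  lemma zero    = s≤s z≤n
  lemma (suc t) = ≤-refl
  unfold : noOnes (suc ℓ) ≈ Q (suc ℓ) ⊛ (noOnes (suc ℓ) ⊕ noOnes ℓ) ⊕ q ⊛ q ⊛ q ⊛ Q ℓ ⊛ Q ℓ ⊛ noOnes ℓ
  unfold = ≈-trans (noOnes-unfold ℓ) (≈-trans
    (⊕-congˡ ((Q (suc ℓ) ⊕ q ⊛ q ⊛ q ⊛ Q ℓ ⊛ Q ℓ) ⊛ noOnes ℓ) (⊛-congʳ (noOnes (suc ℓ)) (Q≈X (suc ℓ))))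
    (solve 4 (λ a b n n' → (a :+ b) :* n :+ a :* n' := a :* (n' :+ n) :+ b :* n) ≈-refl
      (Q (suc ℓ)) (q ⊛ q ⊛ q ⊛ Q ℓ ⊛ Q ℓ) (noOnes ℓ) (noOnes (suc ℓ))))
  regroup : ∀ f g → Q (suc ℓ) ⊛ f ⊕ q ⊛ q ⊛ q ⊛ Q ℓ ⊛ Q ℓ ⊛ g ≈ q ⊛ (q ⊛ Q ℓ ⊛ f) ⊕ q ⊛ (q ⊛ (q ⊛ Q ℓ ⊛ Q ℓ ⊛ g))
  regroup f g = solve 4 (λ q m f g → q :* (q :* m) :* f :+ q :* q :* q :* m :* m :* g := q :* (q :* m :* f) :+ q :* (q :* (q :* m :* m :* g))) ≈-refl q (Q ℓ) f g

bI-limit : ∀ t ℓ → b I (suc t) ℓ ≈[ t ] gap ℓ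
bI-limit t zero    = ≈⇒[] (≡⇒≈ (b-zero I t))
bI-limit t (suc ℓ) = []-trans (≈⇒[] (≈-trans (b-ones t ℓ) (⊕-congˡ (b O (suc t) (suc ℓ)) (R.*-assoc q (Q ℓ) (b O t ℓ)))))
  ([]-trans ([]-⊕ (bO-limit t (suc ℓ)) ([]-weaken (lemma t) ([]-X 1 ([]-⊛ ([]-refl {f = Q ℓ}) (bO-limit' t ℓ)))))
    (≈⇒[] (⊕-congˡ (noOnes (suc ℓ)) (≈-sym (R.*-assoc q (Q ℓ) (noOnes ℓ))))))
  where
  lemma : ∀ t → t ≤ suc (t ∸ 1)
  lemma zero    = z≤n
  lemma (suc t) = ≤-refl

-- Lebesgue's identity, refined by odd and even parts

antiN : ℕ → (ℕ → ℕ → ℕ) → ℕ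
antiN zero    f = f 0 0
antiN (suc ℓ) f = f 0 (suc ℓ) + antiN ℓ (λ k → f (suc k))

anti : ℕ → (ℕ → ℕ → Series) → Series
anti ℓ F n = antiN ℓ (λ k m → F k m n)

antiN-last : ∀ ℓ f → antiN (suc ℓ) f ≡ antiN ℓ (λ k m → f k (suc m)) + f (suc ℓ) 0
antiN-last zero    f = refl
antiN-last (suc ℓ) f = trans (cong (f 0 (2 + ℓ) +_) (antiN-last ℓ (λ k → f (suc k)))) (sym (+-assoc (f 0 (2 + ℓ)) _ _))

antiN-cong : ∀ ℓ {f g : ℕ → ℕ → ℕ} → (∀ k m → k + m ≡ ℓ → f k m ≡ g k m) → antiN ℓ f ≡ antiN ℓ g
antiN-cong zero    p = p 0 0 refl
antiN-cong (suc ℓ) p = cong₂ _+_ (p 0 (suc ℓ) refl) (antiN-cong ℓ (λ k m e → p (suc k) m (cong suc e)))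

antiN-+ : ∀ ℓ f g → antiN ℓ (λ k m → f k m + g k m) ≡ antiN ℓ f + antiN ℓ g
antiN-+ zero    f g = refl
antiN-+ (suc ℓ) f g = trans (cong (f 0 (suc ℓ) + g 0 (suc ℓ) +_) (antiN-+ ℓ (λ k → f (suc k)) (λ k → g (suc k))))
  (lemma (f 0 (suc ℓ)) (g 0 (suc ℓ)) _ _)
  where
  lemma : ∀ a b c d → a + b + (c + d) ≡ a + c + (b + d)
  lemma = NS.solve-∀

antiN-* : ∀ ℓ c f → antiN ℓ (λ k m → c * f k m) ≡ c * antiN ℓ f
antiN-* zero    c f = refl
antiN-* (suc ℓ) c f = trans (cong (c * f 0 (suc ℓ) +_) (antiN-* ℓ c (λ k → f (suc k)))) (sym (*-distribˡ-+ c (f 0 (suc ℓ)) _))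

anti-cong : ∀ ℓ {F G : ℕ → ℕ → Series} → (∀ k m → k + m ≡ ℓ → F k m ≈ G k m) → anti ℓ F ≈ anti ℓ G
anti-cong ℓ p = mk≈ λ n → antiN-cong ℓ (λ k m e → at (p k m e) n)

anti-⊕ : ∀ ℓ F G → anti ℓ (λ k m → F k m ⊕ G k m) ≈ anti ℓ F ⊕ anti ℓ G
anti-⊕ ℓ F G = mk≈ λ n → antiN-+ ℓ (λ k m → F k m n) (λ k m → G k m n)

anti-last : ∀ ℓ F → anti (suc ℓ) F ≈ anti ℓ (λ k m → F k (suc m)) ⊕ F (suc ℓ) 0
anti-last ℓ F = mk≈ λ n → antiN-last ℓ (λ k m → F k m n)

anti-⊛ : ∀ ℓ f F → anti ℓ (λ k m → f ⊛ F k m) ≈ f ⊛ anti ℓ F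
anti-⊛ zero    f F = ≈-refl
anti-⊛ (suc ℓ) f F = ≈-trans (⊕-congˡ (f ⊛ F 0 (suc ℓ)) (anti-⊛ ℓ f (λ k → F (suc k)))) (≈-sym (R.distribˡ f (F 0 (suc ℓ)) (anti ℓ (λ k → F (suc k)))))

anti-fixed⊛ : ∀ ℓ (c : ℕ → ℕ → Series) f F → (∀ k m → k + m ≡ ℓ → c k m ≈ f) → anti ℓ (λ k m → c k m ⊛ F k m) ≈ f ⊛ anti ℓ F
anti-fixed⊛ ℓ c f F p = ≈-trans (anti-cong ℓ (λ k m e → ⊛-congʳ (F k m) (p k m e))) (anti-⊛ ℓ f F)

-- E k m counts the gap partitions with k odd and m even parts; H k m those without part 1.
E H : ℕ → ℕ → Series
E k m = C k ⊛ eul (2 * suc k) 2 m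
H k m = X (2 * k) ⊛ E k m

-- With `E-unfoldˡ`, these are the analogues of the q-Pascal rules, one for each index.
E-unfoldʳ : ∀ k m → E k (suc m) ≈ X (2 * suc (k + m)) ⊛ E k m ⊕ X (2 * suc m) ⊛ E k (suc m)
E-unfoldʳ k m = begin
  C k ⊛ (x ⊛ (geo dm ⊛ e))  ≈⟨ ⊛-congˡ (C k) (⊛-congˡ x (geo-⊛-unfold {dm} e pos)) ⟩
  C k ⊛ (x ⊛ (e ⊕ X dm ⊛ (geo dm ⊛ e)))  ≈⟨ solve 5 (λ c x e y g → c :* (x :* (e :+ y :* (g :* e))) := x :* (c :* e) :+ y :* (c :* (x :* (g :* e)))) ≈-refl (C k) x e (X dm) (geo dm) ⟩
  x ⊛ E k m ⊕ X dm ⊛ E k (suc m)  ≈⟨ ⊕-congʳ (X dm ⊛ E k (suc m)) (⊛-congʳ (E k m) (≡⇒≈ (cong X (lemma k m)))) ⟩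
  X (2 * suc (k + m)) ⊛ E k m ⊕ X dm ⊛ E k (suc m)  ∎
  where
  open ≈R
  dm = 2 * suc m
  x = X (2 * suc k + 2 * m)
  e = eul (2 * suc k) 2 m
  lemma : ∀ k m → 2 * suc k + 2 * m ≡ 2 * suc (k + m)
  lemma = NS.solve-∀

E-unfoldˡ : ∀ k m → E (suc k) m ≈ X (1 + 4 * k + 2 * m) ⊛ E k m ⊕ X (2 * suc k) ⊛ E (suc k) m
E-unfoldˡ k m = begin
  x ⊛ (g ⊛ C k) ⊛ eul (2 * suc (suc k)) 2 m  ≈⟨ ⊛-cong (⊛-congˡ x (geo-⊛-unfold {2 * suc k} (C k) pos)) scale ⟩
  x ⊛ (C k ⊕ y ⊛ (g ⊛ C k)) ⊛ (z ⊛ e)  ≈⟨ solve 6 (λ x c y g z e → x :* (c :+ y :* (g :* c)) :* (z :* e) := x :* z :* (c :* e) :+ y :* (x :* (g :* c) :* (z :* e))) ≈-refl x (C k) y g z e ⟩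
  x ⊛ z ⊛ E k m ⊕ y ⊛ (x ⊛ (g ⊛ C k) ⊛ (z ⊛ e))  ≈⟨ ⊕-cong (⊛-congʳ (E k m) (≈-sym (X-+ (1 + 4 * k) (2 * m)))) (⊛-congˡ y (⊛-congˡ (C (suc k)) (≈-sym scale))) ⟩
  X (1 + 4 * k + 2 * m) ⊛ E k m ⊕ y ⊛ E (suc k) m  ∎
  where
  open ≈R
  x = X (1 + 4 * k)
  y = X (2 * suc k)
  z = X (2 * m)
  g = geo (2 * suc k)
  e = eul (2 * suc k) 2 m
  lemma : ∀ k → 2 * suc (suc k) ≡ 2 * suc k + 2
  lemma = NS.solve-∀
  scale : eul (2 * suc (suc k)) 2 m ≈ z ⊛ e
  scale = ≈-trans (≡⇒≈ (cong (λ u → eul u 2 m) (lemma k))) (eul-scale (2 * suc k) 2 m)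

-- This is the q-binomial theorem for (-q⁻¹ ; q²)ₗ.
noOnes≈ : ∀ ℓ → noOnes ℓ ≈ anti ℓ H
noOnes≈ zero    = ≈-sym (solve 0 (con 1 :* (con 1 :* con 1) := con 1) ≈-refl)
-- The antidiagonal sum is shown to solve the equation that determines `noOnes (suc ℓ)`. After
-- `stepʳ` and `stepˡ` all coefficients depend on k + m only and leave the sums.
noOnes≈ (suc ℓ) = fix-unique {2 * suc ℓ} pos (noOnes-unfold ℓ) (begin
  anti (suc ℓ) H
    ≈⟨ anti-last ℓ H ⟩
  anti ℓ (λ k m → H k (suc m)) ⊕ H (suc ℓ) 0
    ≈⟨ ⊕-cong (anti-cong ℓ (λ k m _ → stepʳ k m)) (≈-sym (R.*-identityˡ (H (suc ℓ) 0))) ⟩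
  anti ℓ (λ k m → X (2 * suc (k + m)) ⊛ H k m ⊕ X (2 * suc m) ⊛ H k (suc m)) ⊕ X (2 * 0) ⊛ H (suc ℓ) 0
    ≈⟨ ⊕-congʳ (X (2 * 0) ⊛ H (suc ℓ) 0) (anti-⊕ ℓ (λ k m → X (2 * suc (k + m)) ⊛ H k m) (λ k m → X (2 * suc m) ⊛ H k (suc m))) ⟩
  anti ℓ (λ k m → X (2 * suc (k + m)) ⊛ H k m) ⊕ anti ℓ (λ k m → X (2 * suc m) ⊛ H k (suc m)) ⊕ X (2 * 0) ⊛ H (suc ℓ) 0
    ≈⟨ R.+-assoc A₁ (anti ℓ (λ k m → X (2 * suc m) ⊛ H k (suc m))) (X (2 * 0) ⊛ H (suc ℓ) 0) ⟩
  A₁ ⊕ (anti ℓ (λ k m → X (2 * suc m) ⊛ H k (suc m)) ⊕ X (2 * 0) ⊛ H (suc ℓ) 0)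
    ≈⟨ ⊕-cong (anti-fixed⊛ ℓ (λ k m → X (2 * suc (k + m))) (Q (suc ℓ)) H (λ k m e → ≈-trans (≡⇒≈ (cong (λ u → X (2 * suc u)) e)) (Q≈X (suc ℓ))))
              (≈-sym (anti-last ℓ (λ k m → X (2 * m) ⊛ H k m))) ⟩
  Q (suc ℓ) ⊛ anti ℓ H ⊕ (X (2 * suc ℓ) ⊛ H 0 (suc ℓ) ⊕ anti ℓ (λ k m → X (2 * m) ⊛ H (suc k) m))
    ≈⟨ ⊕-congˡ (Q (suc ℓ) ⊛ anti ℓ H) (⊕-congˡ (X (2 * suc ℓ) ⊛ H 0 (suc ℓ)) (≈-trans (anti-cong ℓ (λ k m _ → stepˡ k m))
         (anti-⊕ ℓ (λ k m → X (3 + 4 * (k + m)) ⊛ H k m) (λ k m → X (2 * suc (k + m)) ⊛ H (suc k) m)))) ⟩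
  Q (suc ℓ) ⊛ anti ℓ H ⊕ (X (2 * suc ℓ) ⊛ H 0 (suc ℓ) ⊕ (A₂ ⊕ anti ℓ (λ k m → X (2 * suc (k + m)) ⊛ H (suc k) m)))
    ≈⟨ ⊕-congˡ (Q (suc ℓ) ⊛ anti ℓ H) (⊕-congˡ (X (2 * suc ℓ) ⊛ H 0 (suc ℓ)) (⊕-cong
         (anti-fixed⊛ ℓ (λ k m → X (3 + 4 * (k + m))) (q ⊛ q ⊛ q ⊛ Q ℓ ⊛ Q ℓ) H (λ k m e → ≈-trans (≡⇒≈ (cong (λ u → X (3 + 4 * u)) e)) (cube ℓ)))
         (anti-fixed⊛ ℓ (λ k m → X (2 * suc (k + m))) (X (2 * suc ℓ)) (λ k → H (suc k)) (λ k m e → ≡⇒≈ (cong (λ u → X (2 * suc u)) e))))) ⟩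
  Q (suc ℓ) ⊛ anti ℓ H ⊕ (X (2 * suc ℓ) ⊛ H 0 (suc ℓ) ⊕ (q ⊛ q ⊛ q ⊛ Q ℓ ⊛ Q ℓ ⊛ anti ℓ H ⊕ X (2 * suc ℓ) ⊛ anti ℓ (λ k → H (suc k))))
    ≈⟨ solve 6 (λ a f x h c g → a :* f :+ (x :* h :+ (c :* f :+ x :* g)) := (a :+ c) :* f :+ x :* (h :+ g)) ≈-refl
         (Q (suc ℓ)) (anti ℓ H) (X (2 * suc ℓ)) (H 0 (suc ℓ)) (q ⊛ q ⊛ q ⊛ Q ℓ ⊛ Q ℓ) (anti ℓ (λ k → H (suc k))) ⟩
  (Q (suc ℓ) ⊕ q ⊛ q ⊛ q ⊛ Q ℓ ⊛ Q ℓ) ⊛ anti ℓ H ⊕ X (2 * suc ℓ) ⊛ anti (suc ℓ) H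
    ≈⟨ ⊕-congʳ (X (2 * suc ℓ) ⊛ anti (suc ℓ) H) (⊛-congˡ (Q (suc ℓ) ⊕ q ⊛ q ⊛ q ⊛ Q ℓ ⊛ Q ℓ) (noOnes≈ ℓ)) ⟨
  (Q (suc ℓ) ⊕ q ⊛ q ⊛ q ⊛ Q ℓ ⊛ Q ℓ) ⊛ noOnes ℓ ⊕ X (2 * suc ℓ) ⊛ anti (suc ℓ) H ∎)
  where
  open ≈R
  A₁ = anti ℓ (λ k m → X (2 * suc (k + m)) ⊛ H k m)
  A₂ = anti ℓ (λ k m → X (3 + 4 * (k + m)) ⊛ H k m)
  cube : ∀ ℓ → X (3 + 4 * ℓ) ≈ q ⊛ q ⊛ q ⊛ Q ℓ ⊛ Q ℓ
  cube ℓ = ≈-trans (≡⇒≈ (cong X (lemma ℓ))) (≈-trans (X-+ 1 (1 + (1 + (2 * ℓ + 2 * ℓ)))) (≈-trans (⊛-congˡ q (≈-trans (X-+ 1 (1 + (2 * ℓ + 2 * ℓ)))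
    (⊛-congˡ q (≈-trans (X-+ 1 (2 * ℓ + 2 * ℓ)) (⊛-congˡ q (≈-trans (X-+ (2 * ℓ) (2 * ℓ)) (⊛-cong (Q≈X ℓ) (Q≈X ℓ))))))))
    (solve 2 (λ q m → q :* (q :* (q :* (m :* m))) := q :* q :* q :* m :* m) ≈-refl q (Q ℓ))))
    where
    lemma : ∀ ℓ → 3 + 4 * ℓ ≡ 1 + (1 + (1 + (2 * ℓ + 2 * ℓ)))
    lemma = NS.solve-∀
  stepʳ : ∀ k m → H k (suc m) ≈ X (2 * suc (k + m)) ⊛ H k m ⊕ X (2 * suc m) ⊛ H k (suc m)
  stepʳ k m = ≈-trans (⊛-congˡ (X (2 * k)) (E-unfoldʳ k m))
    (solve 5 (λ x y e z f → x :* (y :* e :+ z :* f) := y :* (x :* e) :+ z :* (x :* f)) ≈-refl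
      (X (2 * k)) (X (2 * suc (k + m))) (E k m) (X (2 * suc m)) (E k (suc m)))
  stepˡ : ∀ k m → X (2 * m) ⊛ H (suc k) m ≈ X (3 + 4 * (k + m)) ⊛ H k m ⊕ X (2 * suc (k + m)) ⊛ H (suc k) m
  stepˡ k m = begin
    X (2 * m) ⊛ (X (2 * suc k) ⊛ E (suc k) m)
      ≈⟨ XX (2 * m) (2 * suc k) (E (suc k) m) (l₁ k m) ⟩
    X (2 * suc (k + m)) ⊛ E (suc k) m
      ≈⟨ ⊛-congˡ (X (2 * suc (k + m))) (E-unfoldˡ k m) ⟩
    X (2 * suc (k + m)) ⊛ (X (1 + 4 * k + 2 * m) ⊛ E k m ⊕ X (2 * suc k) ⊛ E (suc k) m)
      ≈⟨ R.distribˡ (X (2 * suc (k + m))) (X (1 + 4 * k + 2 * m) ⊛ E k m) (X (2 * suc k) ⊛ E (suc k) m) ⟩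
    X (2 * suc (k + m)) ⊛ (X (1 + 4 * k + 2 * m) ⊛ E k m) ⊕ X (2 * suc (k + m)) ⊛ H (suc k) m
      ≈⟨ ⊕-congʳ (X (2 * suc (k + m)) ⊛ H (suc k) m) (≈-trans (XX (2 * suc (k + m)) (1 + 4 * k + 2 * m) (E k m) (l₂ k m)) (≈-sym (XX (3 + 4 * (k + m)) (2 * k) (E k m) refl))) ⟩
    X (3 + 4 * (k + m)) ⊛ H k m ⊕ X (2 * suc (k + m)) ⊛ H (suc k) m ∎
    where
    l₁ : ∀ k m → 2 * m + 2 * suc k ≡ 2 * suc (k + m)
    l₁ = NS.solve-∀
    l₂ : ∀ k m → 2 * suc (k + m) + (1 + 4 * k + 2 * m) ≡ 3 + 4 * (k + m) + 2 * k
    l₂ = NS.solve-∀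

-- The second term of `gap (suc ℓ)` accounts for a part 1. Being odd, it raises k and leaves m
-- unchanged.
gap≈ : ∀ ℓ → gap ℓ ≈ anti ℓ E
gap≈ zero    = ≈-sym (R.*-identityˡ I)
gap≈ (suc ℓ) = ≈-sym (begin
  E 0 (suc ℓ) ⊕ anti ℓ (λ k → E (suc k))
    ≈⟨ ⊕-cong (≈-sym (R.*-identityˡ (E 0 (suc ℓ)))) (≈-trans (anti-cong ℓ step) (anti-⊕ ℓ (λ k → H (suc k)) (λ k m → X (1 + 2 * ℓ) ⊛ H k m))) ⟩
  H 0 (suc ℓ) ⊕ (anti ℓ (λ k → H (suc k)) ⊕ anti ℓ (λ k m → X (1 + 2 * ℓ) ⊛ H k m))
    ≈⟨ R.+-assoc (H 0 (suc ℓ)) (anti ℓ (λ k → H (suc k))) (anti ℓ (λ k m → X (1 + 2 * ℓ) ⊛ H k m)) ⟨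
  anti (suc ℓ) H ⊕ anti ℓ (λ k m → X (1 + 2 * ℓ) ⊛ H k m)
    ≈⟨ ⊕-cong (≈-sym (noOnes≈ (suc ℓ))) (≈-trans (anti-⊛ ℓ (X (1 + 2 * ℓ)) H) (⊛-cong (≈-trans (X-+ 1 (2 * ℓ)) (⊛-congˡ q (Q≈X ℓ))) (≈-sym (noOnes≈ ℓ)))) ⟩
  noOnes (suc ℓ) ⊕ q ⊛ Q ℓ ⊛ noOnes ℓ ∎)
  where
  open ≈R
  lemma : ∀ k m → 1 + 4 * k + 2 * m ≡ 1 + 2 * (k + m) + 2 * k
  lemma = NS.solve-∀
  step : ∀ k m → k + m ≡ ℓ → E (suc k) m ≈ H (suc k) m ⊕ X (1 + 2 * ℓ) ⊛ H k m
  step k m refl = ≈-trans (E-unfoldˡ k m) (≈-trans (R.+-comm (X (1 + 4 * k + 2 * m) ⊛ E k m) (H (suc k) m))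
    (⊕-congˡ (H (suc k) m) (≈-sym (XX (1 + 2 * (k + m)) (2 * k) (E k m) (sym (lemma k m))))))

C⊛-ord : ∀ k {m f} → f ≈[ m ] O → C k ⊛ f ≈[ k + m ] O
C⊛-ord zero    {m} {f} o = []-trans (≈⇒[] (R.*-identityˡ f)) o
C⊛-ord (suc k) {m} {f} o = []-trans (≈⇒[] (solve 4 (λ x g c f → x :* (g :* c) :* f := x :* (g :* (c :* f))) ≈-refl (X (1 + 4 * k)) (geo (2 * suc k)) (C k) f))
  (ord-X {a = 1 + 4 * k} pos (ord-⊛ (C k ⊛ f) (geo (2 * suc k)) (C⊛-ord k o)))

E-ord : ∀ k m → E k m ≈[ k + m ] O
E-ord k m = C⊛-ord k (eul-ord {2 * suc k} 2 pos m)

gap-small : Small gap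
gap-small ℓ n n<ℓ = trans (at (gap≈ ℓ) n) (trans
  (antiN-cong ℓ (λ k m e → upTo (E-ord k m) n (<-≤-trans n<ℓ (≤-reflexive (sym e))))) (vanish ℓ))
  where
  vanish : ∀ ℓ → antiN ℓ (λ _ _ → 0) ≡ 0
  vanish zero    = refl
  vanish (suc ℓ) = vanish ℓ

triangle : ∀ L e → Σ< L (λ ℓ → antiN ℓ e) ≡ Σ< L (λ k → Σ< (L ∸ k) (e k))
triangle zero    e = refl
triangle (suc L) e = begin
  Σ< (suc L) (λ ℓ → antiN ℓ e)  ≡⟨ Σ<-head L (λ ℓ → antiN ℓ e) ⟩
  e 0 0 + Σ< L (λ ℓ → e 0 (suc ℓ) + antiN ℓ (λ k → e (suc k)))  ≡⟨ cong (e 0 0 +_) (Σ<-+ L (λ ℓ → e 0 (suc ℓ)) (λ ℓ → antiN ℓ (λ k → e (suc k)))) ⟩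
  e 0 0 + (Σ< L (λ ℓ → e 0 (suc ℓ)) + Σ< L (λ ℓ → antiN ℓ (λ k → e (suc k))))
    ≡⟨ +-assoc (e 0 0) _ _ ⟨
  e 0 0 + Σ< L (λ ℓ → e 0 (suc ℓ)) + Σ< L (λ ℓ → antiN ℓ (λ k → e (suc k)))
    ≡⟨ cong₂ _+_ (sym (Σ<-head L (e 0))) (triangle L (λ k → e (suc k))) ⟩
  Σ< (suc L) (e 0) + Σ< L (λ k → Σ< (L ∸ k) (e (suc k)))  ≡⟨ Σ<-head L (λ k → Σ< (suc L ∸ k) (e k)) ⟨
  Σ< (suc L) (λ k → Σ< (suc L ∸ k) (e k))  ∎
  where open ≡.≡-Reasoning

-- The square exceeds the triangle only by entries with k + m ≥ L.
square : ∀ L e → (∀ k m → L ≤ k + m → e k m ≡ 0) → Σ< L (λ ℓ → antiN ℓ e) ≡ Σ< L (λ k → Σ< L (e k))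
square L e v = trans (triangle L e) (Σ<-cong L (λ k _ → sym (Σ<-stable (e k) (m∸n≤m L k) (λ m l → v k m (≤-trans (m≤n+m∸n L k) (+-monoʳ-≤ k l))))))

private
  E-vanish : ∀ n k m → suc n ≤ k + m → E k m n ≡ 0
  E-vanish n k m l = upTo (E-ord k m) n l

  row : ∀ k n → Σ< (suc n) (λ m → E k m n) ≡ (C k ⊛ tailDist k) n
  row k n = at (Σ∞-⊛ˡ (eul-small {2 * suc k} 2 pos) (C k)) n

  rowLen : ∀ k n → Σ< (suc n) (λ m → m * E k m n) ≡ (C k ⊛ tailLen k) n
  rowLen k n = trans (Σ<-cong (suc n) (λ m _ → sym (at (⊛-· m (C k) (eul (2 * suc k) 2 m)) n)))
    (at (Σ∞-⊛ˡ (small-· (eul-small {2 * suc k} 2 pos)) (C k)) n)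

Σgap≈P : Σ∞ gap ≈ P
Σgap≈P = mk≈ λ n → begin
  Σ< (suc n) (λ ℓ → gap ℓ n)  ≡⟨ Σ<-cong (suc n) (λ ℓ _ → at (gap≈ ℓ) n) ⟩
  Σ< (suc n) (λ ℓ → antiN ℓ (λ k m → E k m n))  ≡⟨ square (suc n) (λ k m → E k m n) (E-vanish n) ⟩
  Σ< (suc n) (λ k → Σ< (suc n) (λ m → E k m n))  ≡⟨ Σ<-cong (suc n) (λ k _ → trans (row k n) (at (CtailDist≈ k) n)) ⟩
  Σ∞ (λ k → B k ⊛ Even) n  ≡⟨ at (Σ∞-⊛ B-small Even) n ⟨
  P n  ∎
  where open ≡.≡-Reasoning

Σℓgap≈D : Σ∞ (λ ℓ → ℓ · gap ℓ) ≈ D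
Σℓgap≈D = mk≈ λ n → begin
  Σ< (suc n) (λ ℓ → ℓ * gap ℓ n)  ≡⟨ Σ<-cong (suc n) (λ ℓ _ → weigh ℓ n) ⟩
  Σ< (suc n) (λ ℓ → antiN ℓ (λ k m → (k + m) * E k m n))  ≡⟨ square (suc n) (λ k m → (k + m) * E k m n) (λ k m l → trans (cong ((k + m) *_) (E-vanish n k m l)) (*-zeroʳ (k + m))) ⟩
  Σ< (suc n) (λ k → Σ< (suc n) (λ m → (k + m) * E k m n))  ≡⟨ Σ<-cong (suc n) (λ k _ → split k n) ⟩
  D n  ∎
  where
  open ≡.≡-Reasoning
  weigh : ∀ ℓ n → ℓ * gap ℓ n ≡ antiN ℓ (λ k m → (k + m) * E k m n)
  weigh ℓ n = trans (cong (ℓ *_) (at (gap≈ ℓ) n)) (trans (sym (antiN-* ℓ ℓ (λ k m → E k m n)))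
    (antiN-cong ℓ (λ k m e → cong (_* E k m n) (sym e))))
  split : ∀ k n → Σ< (suc n) (λ m → (k + m) * E k m n) ≡ Dterm k n
  split k n = begin
    Σ< (suc n) (λ m → (k + m) * E k m n)  ≡⟨ Σ<-cong (suc n) (λ m _ → *-distribʳ-+ (E k m n) k m) ⟩
    Σ< (suc n) (λ m → k * E k m n + m * E k m n)  ≡⟨ Σ<-+ (suc n) (λ m → k * E k m n) (λ m → m * E k m n) ⟩
    Σ< (suc n) (λ m → k * E k m n) + Σ< (suc n) (λ m → m * E k m n)  ≡⟨ cong₂ _+_ (Σ<-* (suc n) k (λ m → E k m n)) (rowLen k n) ⟩
    k * Σ< (suc n) (λ m → E k m n) + (C k ⊛ tailLen k) n  ≡⟨ cong (λ u → k * u + (C k ⊛ tailLen k) n) (row k n) ⟩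
    Dterm k n  ∎

-- Generating functions of the enumerated partitions

≤ᵇ-true : ∀ {m n} → m ≤ n → (m ≤ᵇ n) ≡ true
≤ᵇ-true {m} {n} l with m ≤ᵇ n | ≤⇒≤ᵇ l
... | true | _ = refl

≤ᵇ-true⇒≤ : ∀ {m n} → (m ≤ᵇ n) ≡ true → m ≤ n
≤ᵇ-true⇒≤ {m} {n} e = ≤ᵇ⇒≤ m n (subst Bool.T (sym e) tt)

≤ᵇ-false : ∀ {m n} → n < m → (m ≤ᵇ n) ≡ false
≤ᵇ-false {m} {n} l with m ≤ᵇ n | ≤ᵇ⇒≤ m n
... | true  | p = ⊥-elim (<⇒≱ l (p tt))
... | false | _ = refl

-- Every recursive call lowers m + n, so fuel m + n never runs out.
fuel-irrelevant : ∀ f f' m n → m + n ≤ f → m + n ≤ f' → partsBounded f m n ≡ partsBounded f' m n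
fuel-irrelevant zero    zero     m       n       _       _       = refl
fuel-irrelevant zero    (suc f') zero    zero    _       _       = refl
fuel-irrelevant (suc f) zero     zero    zero    _       _       = refl
fuel-irrelevant (suc f) (suc f') m       zero    _       _       = refl
fuel-irrelevant (suc f) (suc f') zero    (suc n) _       _       = refl
fuel-irrelevant (suc f) (suc f') (suc m) (suc n) (s≤s l) (s≤s l') = cong₂ (λ xs ys → (if suc m ≤ᵇ suc n then map (suc m ∷_) xs else []) ++ ys)
  (fuel-irrelevant f f' (suc m) (n ∸ m) (shrink f l) (shrink f' l')) (fuel-irrelevant f f' m (suc n) l l')
  where
  shrink : ∀ f → m + suc n ≤ f → suc m + (n ∸ m) ≤ f
  shrink f l = ≤-trans (s≤s (+-monoʳ-≤ m (m∸n≤m n m))) (≤-trans (≤-reflexive (sym (+-suc m n))) l)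

tot : (List ℕ → ℕ) → ℕ → Series
tot F m n = sum (map F (partsBounded (m + n) m n))

partsBounded-zero : ∀ f m → partsBounded f m 0 ≡ [] ∷ []
partsBounded-zero zero    m = refl
partsBounded-zero (suc f) m = refl

tot-at-0 : ∀ F m → tot F m 0 ≡ F []
tot-at-0 F m = trans (cong (λ xs → sum (map F xs)) (partsBounded-zero (m + 0) m)) (+-identityʳ (F []))

tot-0 : ∀ F → F [] ≡ 1 → tot F 0 ≈ I
tot-0 F e = mk≈ λ { zero → trans (+-identityʳ (F [])) e ; (suc n) → refl }

tot-suc : ∀ F m → tot F (suc m) ≈ tot F m ⊕ X (suc m) ⊛ tot (λ λs → F (suc m ∷ λs)) (suc m)
tot-suc F m = mk≈ go
  where
  F' = λ λs → F (suc m ∷ λs)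
  go : ∀ n → tot F (suc m) n ≡ tot F m n + (X (suc m) ⊛ tot F' (suc m)) n
  go zero    = trans (tot-at-0 F (suc m)) (sym (trans (+-identityʳ _) (tot-at-0 F m)))
  go (suc n) = begin
    sum (map F ((if suc m ≤ᵇ suc n then map (suc m ∷_) big else []) ++ small))
      ≡⟨ cong sum (map-++ F (if suc m ≤ᵇ suc n then map (suc m ∷_) big else []) small) ⟩
    sum (map F (if suc m ≤ᵇ suc n then map (suc m ∷_) big else []) ++ map F small)
      ≡⟨ sum-++ (map F (if suc m ≤ᵇ suc n then map (suc m ∷_) big else [])) (map F small) ⟩
    sum (map F (if suc m ≤ᵇ suc n then map (suc m ∷_) big else [])) + tot F m (suc n)
      ≡⟨ +-comm _ (tot F m (suc n)) ⟩
    tot F m (suc n) + sum (map F (if suc m ≤ᵇ suc n then map (suc m ∷_) big else []))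
      ≡⟨ cong (tot F m (suc n) +_) (first (≤-<-connex (suc m) (suc n))) ⟩
    tot F m (suc n) + (X (suc m) ⊛ tot F' (suc m)) (suc n) ∎
    where
    open ≡.≡-Reasoning
    big = partsBounded (m + suc n) (suc m) (n ∸ m)
    small = partsBounded (m + suc n) m (suc n)
    first : (suc m ≤ suc n) ⊎ (suc n < suc m) →
      sum (map F (if suc m ≤ᵇ suc n then map (suc m ∷_) big else [])) ≡ (X (suc m) ⊛ tot F' (suc m)) (suc n)
    first (inj₁ l) = begin
      sum (map F (if suc m ≤ᵇ suc n then map (suc m ∷_) big else [])) ≡⟨ cong (λ c → sum (map F (if c then map (suc m ∷_) big else []))) (≤ᵇ-true l) ⟩
      sum (map F (map (suc m ∷_) big))  ≡⟨ cong sum (map-∘ big) ⟨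
      sum (map F' big)  ≡⟨ cong (λ xs → sum (map F' xs)) (fuel-irrelevant (m + suc n) (suc m + (n ∸ m)) (suc m) (n ∸ m)
                                                                           (≤-trans (s≤s (+-monoʳ-≤ m (m∸n≤m n m))) (≤-reflexive (sym (+-suc m n)))) ≤-refl) ⟩
      tot F' (suc m) (n ∸ m)  ≡⟨ X-at-≤ (suc m) (tot F' (suc m)) (suc n) l ⟨
      (X (suc m) ⊛ tot F' (suc m)) (suc n)  ∎
    first (inj₂ l) = trans (cong (λ c → sum (map F (if c then map (suc m ∷_) big else []))) (≤ᵇ-false l))
      (sym (X-low (suc m) (tot F' (suc m)) (suc n) l))

tot-stable : ∀ F {n} m → n ≤ m → tot F m n ≡ tot F n n
tot-stable F {n} zero    z≤n = refl
tot-stable F {n} (suc m) n≤m with m≤n⇒m<n∨m≡n n≤m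
... | inj₂ refl = refl
... | inj₁ (s≤s n≤m') = trans (at (tot-suc F m) n)
  (trans (cong (tot F m n +_) (X-low (suc m) (tot (λ λs → F (suc m ∷ λs)) (suc m)) n (s≤s n≤m')))
  (trans (+-identityʳ _) (tot-stable F m n≤m')))

Bounded : ℕ → List ℕ → Set
Bounded m []       = ⊤
Bounded m (p ∷ λs) = 0 < p × p ≤ m × Bounded p λs

bounded-weaken : ∀ {m m'} λs → m ≤ m' → Bounded m λs → Bounded m' λs
bounded-weaken []       l _             = tt
bounded-weaken (p ∷ λs) l (p>0 , p≤m , v) = p>0 , ≤-trans p≤m l , v

all-bounded : ∀ f m n → All (Bounded m) (partsBounded f m n)
all-bounded zero    m       zero    = tt ∷ []
all-bounded zero    m       (suc n) = []
all-bounded (suc f) m       zero    = tt ∷ []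
all-bounded (suc f) zero    (suc n) = []
all-bounded (suc f) (suc m) (suc n) = ++⁺ (first (suc m ≤ᵇ suc n)) (All.map (λ {λs} → bounded-weaken λs (n≤1+n m)) (all-bounded f m (suc n)))
  where
  first : ∀ c → All (Bounded (suc m)) (if c then map (suc m ∷_) (partsBounded f (suc m) (suc n ∸ suc m)) else [])
  first true  = map⁺ (All.map (λ v → s≤s z≤n , ≤-refl , v) (all-bounded f (suc m) (n ∸ m)))
  first false = []

tot-mono : ∀ {F G} m → (∀ λs → Bounded m λs → F λs ≤ G λs) → tot F m ≼ tot G m
tot-mono {F} {G} m p = mk≼ λ n → go (all-bounded (m + n) m n)
  where
  go : ∀ {xs} → All (Bounded m) xs → sum (map F xs) ≤ sum (map G xs)
  go []       = z≤n
  go (v ∷ vs) = +-mono-≤ (p _ v) (go vs)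

tot-cong : ∀ {F G} m → (∀ λs → Bounded m λs → F λs ≡ G λs) → tot F m ≈ tot G m
tot-cong m p = ≼-antisym (tot-mono m (λ λs v → ≤-reflexive (p λs v))) (tot-mono m (λ λs v → ≤-reflexive (sym (p λs v))))

tot-⊕ : ∀ F G m → tot (λ λs → F λs + G λs) m ≈ tot F m ⊕ tot G m
tot-⊕ F G m = mk≈ λ n → go (partsBounded (m + n) m n)
  where
  go : ∀ xs → sum (map (λ λs → F λs + G λs) xs) ≡ sum (map F xs) + sum (map G xs)
  go []       = refl
  go (x ∷ xs) = trans (cong (F x + G x +_) (go xs)) (lemma (F x) (G x) _ _)
    where
    lemma : ∀ a b c d → a + b + (c + d) ≡ a + c + (b + d)
    lemma = NS.solve-∀

tot-O : ∀ {F} m → (∀ λs → Bounded m λs → F λs ≡ 0) → tot F m ≈ O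
tot-O m p = ≈-trans (tot-cong m p) (mk≈ λ n → go (partsBounded (m + n) m n))
  where
  go : ∀ (xs : List (List ℕ)) → sum (map (λ _ → 0) xs) ≡ 0
  go []       = refl
  go (x ∷ xs) = go xs

tot-restrict : ∀ {F} k c → (∀ x λs → c < x → x ≤ k + c → Bounded x λs → F (x ∷ λs) ≡ 0) → tot F (k + c) ≈ tot F c
tot-restrict     zero    c p = ≈-refl
tot-restrict {F} (suc k) c p = ≈-trans (tot-suc F (k + c)) (≈-trans (⊕-cong (tot-restrict k c (λ x λs l l' → p x λs l (m≤n⇒m≤1+n l')))
  (≈-trans (⊛-congˡ (X (suc (k + c))) (tot-O (suc (k + c)) (λ λs v → p (suc (k + c)) λs (s≤s (m≤n+m c k)) ≤-refl v))) (R.zeroʳ (X (suc (k + c))))))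
  (R.+-identityʳ (tot F c)))

on : (Partition → Bool) → (Partition → ℕ) → Partition → ℕ
on c f λs = if c λs then f λs else 0

on-filter : ∀ c f xs → sum (map f (filter (λ λs → T? (c λs)) xs)) ≡ sum (map (on c f) xs)
on-filter c f []       = refl
on-filter c f (x ∷ xs) with c x
... | true  = cong (f x +_) (on-filter c f xs)
... | false = on-filter c f xs

partitions≡ : ∀ n → partitions n ≡ partsBounded (n + n) n n
partitions≡ n = fuel-irrelevant (n + n + 1) (n + n) n n (m≤m+n (n + n) 1) ≤-refl

g₁≡ : ∀ t n → g₁ t n ≡ tot (on cond1 (numHooks t)) n n
g₁≡ t n = trans (on-filter cond1 (numHooks t) (partitions n)) (cong (λ xs → sum (map (on cond1 (numHooks t)) xs)) (partitions≡ n))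

g₂≡ : ∀ t n → g₂ t n ≡ tot (on cond2 (numHooks t)) n n
g₂≡ t n = trans (on-filter cond2 (numHooks t) (partitions n)) (cong (λ xs → sum (map (on cond2 (numHooks t)) xs)) (partitions≡ n))

-- Gap partitions by largest part

gapTot : (Partition → ℕ) → ℕ → Series
gapTot f m = tot (on cond1 f) m

gapOK-odd : ∀ t x → gapOK (suc (t * 2)) x ≡ (x + 3 ≤ᵇ suc (t * 2))
gapOK-odd t x = cong (λ u → if u ≡ᵇ 1 then (x + 3 ≤ᵇ suc (t * 2)) else (x + 2 ≤ᵇ suc (t * 2))) ([m+kn]%n≡m%n 1 t 2)

gapOK-even : ∀ t x → gapOK (suc (suc (t * 2))) x ≡ (x + 2 ≤ᵇ suc (suc (t * 2)))
gapOK-even t x = cong (λ u → if u ≡ᵇ 1 then (x + 3 ≤ᵇ suc (suc (t * 2))) else (x + 2 ≤ᵇ suc (suc (t * 2)))) ([m+kn]%n≡m%n 2 t 2)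

-- Used with k = 2 below an even part, k = 3 below an odd one, and k = 1, c = 0 below the part 1.
gap-cons : ∀ f k c → (∀ x → 0 < x → c < x → gapOK (k + c) x ≡ false) → (∀ x → 0 < x → x ≤ c → gapOK (k + c) x ≡ true) →
  tot (λ λs → on cond1 f (k + c ∷ λs)) (k + c) ≈ gapTot (λ λs → f (k + c ∷ λs)) c
gap-cons f k c no yes = ≈-trans (tot-restrict k c far) (tot-cong c near)
  where
  far : ∀ x λs → c < x → x ≤ k + c → Bounded x λs → on cond1 f (k + c ∷ x ∷ λs) ≡ 0
  far x λs c<x _ _ = cong (λ u → if u ∧ cond1 (x ∷ λs) then f (k + c ∷ x ∷ λs) else 0) (no x (≤-trans (s≤s z≤n) c<x) c<x)
  near : ∀ λs → Bounded c λs → on cond1 f (k + c ∷ λs) ≡ on cond1 (λ λs → f (k + c ∷ λs)) λs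
  near []       _               = refl
  near (x ∷ λs) (x>0 , x≤c , _) = cong (λ u → if u ∧ cond1 (x ∷ λs) then f (k + c ∷ x ∷ λs) else 0) (yes x x>0 x≤c)

gapTot-even : ∀ f t → gapTot f (suc t * 2) ≈ gapTot f (suc (t * 2)) ⊕ X (2 + t * 2) ⊛ gapTot (λ λs → f (2 + t * 2 ∷ λs)) (t * 2)
gapTot-even f t = ≈-trans (tot-suc (on cond1 f) (suc (t * 2))) (⊕-congˡ (gapTot f (suc (t * 2))) (⊛-congˡ (X (2 + t * 2)) (gap-cons f 2 (t * 2)
  (λ x _ l → trans (gapOK-even t x) (≤ᵇ-false (≤-trans (s≤s (s≤s l)) (≤-reflexive (+-comm 2 x)))))
  (λ x _ l → trans (gapOK-even t x) (≤ᵇ-true (≤-trans (≤-reflexive (+-comm x 2)) (s≤s (s≤s l))))))))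

gapTot-odd : ∀ f t → gapTot f (suc (suc t * 2)) ≈ gapTot f (suc t * 2) ⊕ X (1 + suc t * 2) ⊛ gapTot (λ λs → f (1 + suc t * 2 ∷ λs)) (t * 2)
gapTot-odd f t = ≈-trans (tot-suc (on cond1 f) (suc t * 2)) (⊕-congˡ (gapTot f (suc t * 2)) (⊛-congˡ (X (1 + suc t * 2)) (gap-cons f 3 (t * 2)
  (λ x _ l → trans (gapOK-odd (suc t) x) (≤ᵇ-false (≤-trans (s≤s (s≤s (s≤s l))) (≤-reflexive (+-comm 3 x)))))
  (λ x _ l → trans (gapOK-odd (suc t) x) (≤ᵇ-true (≤-trans (≤-reflexive (+-comm x 3)) (s≤s (s≤s (s≤s l)))))))))

gapTot-one : ∀ f → gapTot f 1 ≈ gapTot f 0 ⊕ X 1 ⊛ gapTot (λ λs → f (1 ∷ λs)) 0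
gapTot-one f = ≈-trans (tot-suc (on cond1 f) 0) (⊕-congˡ (gapTot f 0) (⊛-congˡ (X 1) (gap-cons f 1 0
  (λ x _ l → trans (gapOK-odd 0 x) (≤ᵇ-false (≤-trans (s≤s (s≤s z≤n)) (m≤n+m 3 x))))
  (λ { (suc x) _ () }))))

count : Partition → ℕ
count _ = 1

-- gapTot count and gapTot length at t - 1, with the conventions of b at index 0.
gapCount gapLength : ℕ → Series
gapCount zero     = I
gapCount (suc t)  = gapTot count (t * 2)
gapLength zero    = O
gapLength (suc t) = gapTot length (t * 2)

Q≈X' : ∀ t → X (t * 2) ≈ Q t
Q≈X' t = ≈-trans (≡⇒≈ (cong X (*-comm t 2))) (Q≈X t)

oddX : ∀ t → X (1 + t * 2) ≈ q ⊛ Q t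
oddX t = ≈-trans (X-+ 1 (t * 2)) (⊛-congˡ q (Q≈X' t))

gapCount-suc : ∀ t → gapCount (2 + t) ≈ gapCount (1 + t) ⊕ q ⊛ Q t ⊛ gapCount t ⊕ Q (suc t) ⊛ gapCount (1 + t)
gapCount-suc t = ≈-trans (gapTot-even count t) (⊕-cong (odd t) (⊛-congʳ (gapCount (1 + t)) (Q≈X' (suc t))))
  where
  odd : ∀ t → gapTot count (suc (t * 2)) ≈ gapCount (1 + t) ⊕ q ⊛ Q t ⊛ gapCount t
  odd zero    = ≈-trans (gapTot-one count) (⊕-congˡ (gapCount 1) (⊛-cong (oddX 0) (tot-0 (on cond1 count) refl)))
  odd (suc t) = ≈-trans (gapTot-odd count t) (⊕-congˡ (gapCount (2 + t)) (⊛-congʳ (gapCount (1 + t)) (oddX (suc t))))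

gapTot-suc : ∀ m → gapTot (λ λs → suc (length λs)) m ≈ gapTot count m ⊕ gapTot length m
gapTot-suc m = ≈-trans (tot-cong m (λ λs _ → split (cond1 λs) (length λs))) (tot-⊕ (on cond1 count) (on cond1 length) m)
  where
  split : ∀ c u → (if c then suc u else 0) ≡ (if c then 1 else 0) + (if c then u else 0)
  split true  u = refl
  split false u = refl

gapLength-0 : gapTot length 0 ≈ O
gapLength-0 = tot-O 0 (λ { [] _ → refl ; (x ∷ λs) (x>0 , x≤0 , _) → ⊥-elim (<⇒≱ x>0 x≤0) })

gapLength-suc : ∀ t → gapLength (2 + t) ≈ gapLength (1 + t) ⊕ q ⊛ Q t ⊛ (gapCount t ⊕ gapLength t) ⊕ Q (suc t) ⊛ (gapCount (1 + t) ⊕ gapLength (1 + t))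
gapLength-suc t = ≈-trans (gapTot-even length t) (⊕-cong (odd t) (⊛-cong (Q≈X' (suc t)) (gapTot-suc (t * 2))))
  where
  odd : ∀ t → gapTot length (suc (t * 2)) ≈ gapLength (1 + t) ⊕ q ⊛ Q t ⊛ (gapCount t ⊕ gapLength t)
  odd zero    = ≈-trans (gapTot-one length) (⊕-congˡ (gapLength 1) (⊛-cong (oddX 0) (≈-trans (gapTot-suc 0) (⊕-cong (tot-0 (on cond1 count) refl) gapLength-0))))
  odd (suc t) = ≈-trans (gapTot-odd length t) (⊕-congˡ (gapLength (2 + t)) (⊛-cong (oddX (suc t)) (gapTot-suc (t * 2))))

ΣS-head : ∀ L F → ΣS (suc L) F ≈ F 0 ⊕ ΣS L (λ ℓ → F (suc ℓ))
ΣS-head L F = mk≈ λ n → Σ<-head L (λ ℓ → F ℓ n)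

ΣS-⊛ˡ : ∀ L f F → ΣS L (λ ℓ → f ⊛ F ℓ) ≈ f ⊛ ΣS L F
ΣS-⊛ˡ L f F = ≈-trans (ΣS-cong L (λ ℓ → R.*-comm f (F ℓ))) (≈-trans (≈-sym (ΣS-⊛ L F f)) (R.*-comm (ΣS L F) f))

Σb : ℕ → ℕ → Series
Σb t L = ΣS L (b I t)

Σℓb : ℕ → ℕ → Series
Σℓb t L = ΣS L (λ ℓ → ℓ · b I t ℓ)

ΣS-O : ∀ L {F} → (∀ ℓ → F ℓ ≈ O) → ΣS L F ≈ O
ΣS-O L p = ≈-trans (ΣS-cong L p) (mk≈ λ n → Σ<-zero L)

Σb-suc : ∀ t L → Σb (2 + t) (suc L) ≈ Σb (1 + t) (suc L) ⊕ q ⊛ Q t ⊛ Σb t L ⊕ Q (suc t) ⊛ Σb (1 + t) L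
Σb-suc t L = begin
  Σb (2 + t) (suc L)  ≈⟨ ΣS-head L (b I (2 + t)) ⟩
  I ⊕ ΣS L (λ ℓ → u ℓ ⊕ q ⊛ Q t ⊛ b I t ℓ ⊕ Q (suc t) ⊛ b I (1 + t) ℓ)  ≈⟨ ⊕-cong (≡⇒≈ (sym (b-zero I t))) (ΣS-⊕ L (λ ℓ → u ℓ ⊕ q ⊛ Q t ⊛ b I t ℓ) (λ ℓ → Q (suc t) ⊛ b I (1 + t) ℓ)) ⟩
  b I (1 + t) 0 ⊕ (ΣS L (λ ℓ → u ℓ ⊕ q ⊛ Q t ⊛ b I t ℓ) ⊕ ΣS L (λ ℓ → Q (suc t) ⊛ b I (1 + t) ℓ))
    ≈⟨ ⊕-congˡ (b I (1 + t) 0) (⊕-cong (≈-trans (ΣS-⊕ L u (λ ℓ → q ⊛ Q t ⊛ b I t ℓ)) (⊕-congˡ (ΣS L u) (ΣS-⊛ˡ L (q ⊛ Q t) (b I t)))) (ΣS-⊛ˡ L (Q (suc t)) (b I (1 + t)))) ⟩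
  b I (1 + t) 0 ⊕ (ΣS L u ⊕ q ⊛ Q t ⊛ Σb t L ⊕ Q (suc t) ⊛ Σb (1 + t) L)
    ≈⟨ solve 4 (λ a b c d → a :+ (b :+ c :+ d) := a :+ b :+ c :+ d) ≈-refl (b I (1 + t) 0) (ΣS L u) (q ⊛ Q t ⊛ Σb t L) (Q (suc t) ⊛ Σb (1 + t) L) ⟩
  b I (1 + t) 0 ⊕ ΣS L u ⊕ q ⊛ Q t ⊛ Σb t L ⊕ Q (suc t) ⊛ Σb (1 + t) L
    ≈⟨ ⊕-congʳ (Q (suc t) ⊛ Σb (1 + t) L) (⊕-congʳ (q ⊛ Q t ⊛ Σb t L) (ΣS-head L (b I (1 + t)))) ⟨
  Σb (1 + t) (suc L) ⊕ q ⊛ Q t ⊛ Σb t L ⊕ Q (suc t) ⊛ Σb (1 + t) L ∎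
  where
  open ≈R
  u : ℕ → Series
  u ℓ = b I (1 + t) (suc ℓ)

Σℓb-suc : ∀ t L → Σℓb (2 + t) (suc L) ≈ Σℓb (1 + t) (suc L) ⊕ q ⊛ Q t ⊛ (Σb t L ⊕ Σℓb t L) ⊕ Q (suc t) ⊛ (Σb (1 + t) L ⊕ Σℓb (1 + t) L)
Σℓb-suc t L = begin
  Σℓb (2 + t) (suc L)  ≈⟨ ≈-trans (ΣS-head L (λ ℓ → ℓ · b I (2 + t) ℓ)) (R.+-identityˡ (ΣS L (λ ℓ → suc ℓ · b I (2 + t) (suc ℓ)))) ⟩
  ΣS L (λ ℓ → suc ℓ · b I (2 + t) (suc ℓ))  ≈⟨ ΣS-cong L term ⟩
  ΣS L (λ ℓ → u ℓ ⊕ q ⊛ Q t ⊛ (b I t ℓ ⊕ ℓ · b I t ℓ) ⊕ Q (suc t) ⊛ (b I (1 + t) ℓ ⊕ ℓ · b I (1 + t) ℓ))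
    ≈⟨ ΣS-⊕ L (λ ℓ → u ℓ ⊕ q ⊛ Q t ⊛ (b I t ℓ ⊕ ℓ · b I t ℓ)) (λ ℓ → Q (suc t) ⊛ (b I (1 + t) ℓ ⊕ ℓ · b I (1 + t) ℓ)) ⟩
  ΣS L (λ ℓ → u ℓ ⊕ q ⊛ Q t ⊛ (b I t ℓ ⊕ ℓ · b I t ℓ)) ⊕ ΣS L (λ ℓ → Q (suc t) ⊛ (b I (1 + t) ℓ ⊕ ℓ · b I (1 + t) ℓ))
    ≈⟨ ⊕-cong (≈-trans (ΣS-⊕ L u (λ ℓ → q ⊛ Q t ⊛ (b I t ℓ ⊕ ℓ · b I t ℓ))) (⊕-cong (≈-sym (≈-trans (ΣS-head L (λ ℓ → ℓ · b I (1 + t) ℓ)) (R.+-identityˡ (ΣS L u))))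
         (pull (q ⊛ Q t) t))) (pull (Q (suc t)) (1 + t)) ⟩
  Σℓb (1 + t) (suc L) ⊕ q ⊛ Q t ⊛ (Σb t L ⊕ Σℓb t L) ⊕ Q (suc t) ⊛ (Σb (1 + t) L ⊕ Σℓb (1 + t) L) ∎
  where
  open ≈R
  u : ℕ → Series
  u ℓ = suc ℓ · b I (1 + t) (suc ℓ)
  pull : ∀ f s → ΣS L (λ ℓ → f ⊛ (b I s ℓ ⊕ ℓ · b I s ℓ)) ≈ f ⊛ (Σb s L ⊕ Σℓb s L)
  pull f s = ≈-trans (ΣS-⊛ˡ L f (λ ℓ → b I s ℓ ⊕ ℓ · b I s ℓ)) (⊛-congˡ f (ΣS-⊕ L (b I s) (λ ℓ → ℓ · b I s ℓ)))
  term : ∀ ℓ → suc ℓ · b I (2 + t) (suc ℓ) ≈ u ℓ ⊕ q ⊛ Q t ⊛ (b I t ℓ ⊕ ℓ · b I t ℓ) ⊕ Q (suc t) ⊛ (b I (1 + t) ℓ ⊕ ℓ · b I (1 + t) ℓ)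
  term ℓ = ≈-trans (mk≈ λ n → distrib (suc ℓ) (b I (1 + t) (suc ℓ) n) _ _) (⊕-cong (⊕-congˡ (u ℓ) (≈-sym (⊛-· (suc ℓ) (q ⊛ Q t) (b I t ℓ)))) (≈-sym (⊛-· (suc ℓ) (Q (suc t)) (b I (1 + t) ℓ))))
    where
    distrib : ∀ c x y z → c * (x + y + z) ≡ c * x + c * y + c * z
    distrib = NS.solve-∀

bI-0 : ∀ L → Σb 0 (suc L) ≈ I
bI-0 L = ≈-trans (ΣS-head L (b I 0)) (≈-trans (⊕-congˡ I (ΣS-O L {λ ℓ → b I 0 (suc ℓ)} (λ ℓ → ≈-refl))) (R.+-identityʳ I))

bI-1 : ∀ L → Σb 1 (suc L) ≈ I
bI-1 L = ≈-trans (ΣS-head L (b I 1)) (≈-trans (⊕-congˡ I (ΣS-O L {λ ℓ → b I 1 (suc ℓ)} (λ ℓ → ≈-refl))) (R.+-identityʳ I))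

-- A gap partition with parts at most 2(t - 1) has at most t - 1 parts, so the range ℓ ≤ L misses
-- none.
Σb≈ : ∀ t L → t ≤ suc L → Σb t (suc L) ≈ gapCount t
Σb≈ zero          L       _       = bI-0 L
Σb≈ (suc zero)    L       _       = ≈-trans (bI-1 L) (≈-sym (tot-0 (on cond1 count) refl))
Σb≈ (suc (suc t)) (suc L) (s≤s l) = ≈-trans (Σb-suc t (suc L)) (≈-trans
  (⊕-cong (⊕-cong (Σb≈ (suc t) (suc L) (m≤n⇒m≤1+n l)) (⊛-congˡ (q ⊛ Q t) (Σb≈ t L (≤-trans (n≤1+n t) l)))) (⊛-congˡ (Q (suc t)) (Σb≈ (suc t) L l)))
  (≈-sym (gapCount-suc t)))
Σb≈ (suc (suc t)) zero    (s≤s ())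

Σℓb≈ : ∀ t L → t ≤ suc L → Σℓb t (suc L) ≈ gapLength t
Σℓb≈ zero          L       _       = ≈-trans (ΣS-head L (λ ℓ → ℓ · b I 0 ℓ)) (≈-trans (R.+-identityˡ (ΣS L (λ ℓ → suc ℓ · O))) (ΣS-O L (λ ℓ → mk≈ λ n → *-zeroʳ (suc ℓ))))
Σℓb≈ (suc zero)    L       _       = ≈-trans (≈-trans (ΣS-head L (λ ℓ → ℓ · b I 1 ℓ)) (≈-trans (R.+-identityˡ (ΣS L (λ ℓ → suc ℓ · O))) (ΣS-O L (λ ℓ → mk≈ λ n → *-zeroʳ (suc ℓ)))))
                                       (≈-sym gapLength-0)
Σℓb≈ (suc (suc t)) (suc L) (s≤s l) = ≈-trans (Σℓb-suc t (suc L)) (≈-trans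
  (⊕-cong (⊕-cong (Σℓb≈ (suc t) (suc L) (m≤n⇒m≤1+n l)) (⊛-congˡ (q ⊛ Q t) (⊕-cong (Σb≈ t L (≤-trans (n≤1+n t) l)) (Σℓb≈ t L (≤-trans (n≤1+n t) l)))))
    (⊛-congˡ (Q (suc t)) (⊕-cong (Σb≈ (suc t) L l) (Σℓb≈ (suc t) L l))))
  (≈-sym (gapLength-suc t)))
Σℓb≈ (suc (suc t)) zero    (s≤s ())

-- The bound on the parts is raised from n to 2(n + 1), which admits no new partition of n and puts
-- degree n within the range where `b I` has reached its limit.
gapLength≡D : ∀ n → gapTot length n n ≡ D n
gapLength≡D n = begin
  gapTot length n n  ≡⟨ tot-stable (on cond1 length) (suc n * 2) (≤-trans (n≤1+n n) (m≤m*n (suc n) 2)) ⟨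
  gapLength (2 + n) n  ≡⟨ at (Σℓb≈ (2 + n) (1 + n) ≤-refl) n ⟨
  Σ< (2 + n) (λ ℓ → ℓ * b I (2 + n) ℓ n)  ≡⟨ Σ<-cong (2 + n) (λ ℓ _ → cong (ℓ *_) (upTo (bI-limit (1 + n) ℓ) n ≤-refl)) ⟩
  Σ< (2 + n) (λ ℓ → ℓ * gap ℓ n)  ≡⟨ Σ∞-at (small-· gap-small) (n≤1+n (suc n)) ⟩
  Σ∞ (λ ℓ → ℓ · gap ℓ) n  ≡⟨ at Σℓgap≈D n ⟩
  D n  ∎
  where open ≡.≡-Reasoning

-- Hooks of length 1 and 2, row by row

conjPart-accept : ∀ {p j} ps → j ≤ p → conjPart (p ∷ ps) j ≡ suc (conjPart ps j)
conjPart-accept {p} {j} ps l = cong length (filter-accept (j ≤?_) {p} {ps} l)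

conjPart-reject : ∀ {m j} ps → Bounded m ps → m < j → conjPart ps j ≡ 0
conjPart-reject []       _               _   = refl
conjPart-reject {m} {j} (p ∷ ps) (_ , p≤m , v) m<j = trans
  (cong length (filter-reject (j ≤?_) {p} {ps} (<⇒≱ (≤-<-trans p≤m m<j))))
  (conjPart-reject ps v (≤-<-trans p≤m m<j))

-- The hook lengths of a row depend only on the rows below it.
rowHook : ℕ → List ℕ → ℕ → ℕ
rowHook p ps j = (p + conjPart (p ∷ ps) (suc j)) ∸ suc j

rows : List ℕ → List ℕ
rows []       = []
rows (p ∷ ps) = applyUpTo (rowHook p ps) p ++ rows ps

applyUpTo-cong : ∀ {f g : ℕ → ℕ} n → (∀ i → i < n → f i ≡ g i) → applyUpTo f n ≡ applyUpTo g n
applyUpTo-cong zero    e = refl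
applyUpTo-cong (suc n) e = cong₂ _∷_ (e 0 (s≤s z≤n)) (applyUpTo-cong n (λ i l → e (suc i) (s≤s l)))

-- The hypothesis says that the k rows already passed reach every column still in use. They add k to
-- the column length, which the row index subtracts again.
hooksFrom≡rows : ∀ λs k {m} ps → Bounded m ps → (∀ j → j ≤ m → conjPart λs j ≡ k + conjPart ps j) →
  hooksFrom λs (suc k) ps ≡ rows ps
hooksFrom≡rows λs k []       _                 _ = refl
hooksFrom≡rows λs k (p ∷ ps) (p>0 , p≤m , v) e = cong₂ _++_
  (applyUpTo-cong p λ j j<p → begin
    (p + conjPart λs (suc j) + 1) ∸ (suc k + suc j)  ≡⟨ cong (λ c → (p + c + 1) ∸ (suc k + suc j)) (e (suc j) (≤-trans j<p p≤m)) ⟩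
    (p + (k + conjPart (p ∷ ps) (suc j)) + 1) ∸ (suc k + suc j)  ≡⟨ cong (_∸ (suc k + suc j)) (regroup p k (conjPart (p ∷ ps) (suc j))) ⟩
    (suc k + (p + conjPart (p ∷ ps) (suc j))) ∸ (suc k + suc j)  ≡⟨ [m+n]∸[m+o]≡n∸o (suc k) (p + conjPart (p ∷ ps) (suc j)) (suc j) ⟩
    rowHook p ps j  ∎)
  (hooksFrom≡rows λs (suc k) ps v λ j j≤p →
    trans (e j (≤-trans j≤p p≤m)) (trans (cong (k +_) (conjPart-accept ps j≤p)) (+-suc k _)))
  where
  open ≡.≡-Reasoning
  regroup : ∀ p k c → p + (k + c) + 1 ≡ suc k + (p + c)
  regroup = NS.solve-∀

occurrences : ℕ → List ℕ → ℕ
occurrences t hs = length (filter (λ h → h ≟ t) hs)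

δ : ℕ → ℕ → ℕ
δ t h = occurrences t (h ∷ [])

δ-yes : ∀ {t h} → h ≡ t → δ t h ≡ 1
δ-yes {t} {h} e = cong length (filter-accept (λ h → h ≟ t) {h} {[]} e)

δ-no : ∀ {t h} → ¬ (h ≡ t) → δ t h ≡ 0
δ-no {t} {h} e = cong length (filter-reject (λ h → h ≟ t) {h} {[]} e)

δ≤1 : ∀ t h → δ t h ≤ 1
δ≤1 t h = length-filter (λ h → h ≟ t) (h ∷ [])

occurrences-++ : ∀ t xs ys → occurrences t (xs ++ ys) ≡ occurrences t xs + occurrences t ys
occurrences-++ t xs ys = trans (cong length (filter-++ (λ h → h ≟ t) xs ys)) (length-++ (filter (λ h → h ≟ t) xs))

rowCount : ℕ → ℕ → List ℕ → ℕ
rowCount t p ps = occurrences t (applyUpTo (rowHook p ps) p)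

rowCounts : ℕ → List ℕ → ℕ
rowCounts t []       = 0
rowCounts t (p ∷ ps) = rowCount t p ps + rowCounts t ps

numHooks≡rowCounts : ∀ t {m} λs → Bounded m λs → numHooks t λs ≡ rowCounts t λs
numHooks≡rowCounts t λs v = trans (cong (occurrences t) (hooksFrom≡rows λs 0 λs v (λ _ _ → refl))) (go λs)
  where
  go : ∀ ps → occurrences t (rows ps) ≡ rowCounts t ps
  go []       = refl
  go (p ∷ ps) = trans (occurrences-++ t (applyUpTo (rowHook p ps) p) (rows ps)) (cong (rowCount t p ps +_) (go ps))

occurrences-suc : ∀ t f n → occurrences t (applyUpTo f (suc n)) ≡ occurrences t (applyUpTo f n) + δ t (f n)
occurrences-suc t f n = trans (cong (occurrences t) (sym (applyUpTo-∷ʳ f n))) (occurrences-++ t (applyUpTo f n) (f n ∷ []))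

occurrences-none : ∀ t f n → (∀ i → i < n → t < f i) → occurrences t (applyUpTo f n) ≡ 0
occurrences-none t f zero    _ = refl
occurrences-none t f (suc n) e = trans (occurrences-suc t f n) (cong₂ _+_
  (occurrences-none t f n (λ i l → e i (m≤n⇒m≤1+n l))) (δ-no (λ f≡t → <-irrefl (sym f≡t) (e n ≤-refl))))

rowHook≡ : ∀ m d ps → rowHook (suc (d + m)) ps m ≡ suc (d + conjPart ps (suc m))
rowHook≡ m d ps = begin
  (suc (d + m) + conjPart (suc (d + m) ∷ ps) (suc m)) ∸ suc m  ≡⟨ cong (λ c → (suc (d + m) + c) ∸ suc m) (conjPart-accept ps (s≤s (m≤n+m m d))) ⟩
  (suc (d + m) + suc c) ∸ suc m  ≡⟨ cong (_∸ suc m) (regroup d m c) ⟩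
  (suc m + suc (d + c)) ∸ suc m  ≡⟨ m+n∸m≡n (suc m) (suc (d + c)) ⟩
  suc (d + c)  ∎
  where
  open ≡.≡-Reasoning
  c = conjPart ps (suc m)
  regroup : ∀ d m c → suc (d + m) + suc c ≡ suc m + suc (d + c)
  regroup = NS.solve-∀

-- Column m (from 0) has arm d, so cells to its left have arm above d. Hence only the last t cells
-- of a row can be t-hooks.
rowHook-big : ∀ d m ps i → i < m → suc d < rowHook (suc (d + m)) ps i
rowHook-big d m ps i i<m = subst (λ p → suc d < rowHook p ps i) shape
  (≤-trans (s≤s (s≤s (≤-trans (m≤m+n d (m ∸ suc i)) (m≤m+n (d + (m ∸ suc i)) (conjPart ps (suc i))))))
    (≤-reflexive (sym (rowHook≡ i (suc (d + (m ∸ suc i))) ps))))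
  where
  shape : suc (suc (d + (m ∸ suc i)) + i) ≡ suc (d + m)
  shape = cong suc (trans (trans (cong suc (+-assoc d (m ∸ suc i) i)) (sym (+-suc d (m ∸ suc i + i))))
    (cong (d +_) (trans (sym (+-suc (m ∸ suc i) i)) (m∸n+n≡m i<m))))

rowCount-1 : ∀ p ps → rowCount 1 (suc p) ps ≡ δ 1 (suc (conjPart ps (suc p)))
rowCount-1 p ps = trans (occurrences-suc 1 (rowHook (suc p) ps) p) (cong₂ _+_
  (occurrences-none 1 (rowHook (suc p) ps) p (rowHook-big 0 p ps)) (cong (δ 1) (rowHook≡ p 0 ps)))

rowCount-2 : ∀ p ps → rowCount 2 (suc (suc p)) ps ≡ δ 2 (suc (suc (conjPart ps (suc p)))) + δ 2 (suc (conjPart ps (suc (suc p))))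
rowCount-2 p ps = begin
  rowCount 2 (2 + p) ps  ≡⟨ occurrences-suc 2 f (suc p) ⟩
  occurrences 2 (applyUpTo f (suc p)) + δ 2 (f (suc p))  ≡⟨ cong (_+ δ 2 (f (suc p))) (occurrences-suc 2 f p) ⟩
  occurrences 2 (applyUpTo f p) + δ 2 (f p) + δ 2 (f (suc p))  ≡⟨ cong₂ _+_ (cong₂ _+_ (occurrences-none 2 f p (rowHook-big 1 p ps))
                                                                      (cong (δ 2) (rowHook≡ p 1 ps))) (cong (δ 2) (rowHook≡ (suc p) 0 ps)) ⟩
  δ 2 (suc (suc (conjPart ps (suc p)))) + δ 2 (suc (conjPart ps (suc (suc p)))) ∎
  where
  open ≡.≡-Reasoning
  f = rowHook (2 + p) ps

-- 1 if p does not occur in the list, assumed decreasing with parts at most p; the next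
-- two weights rely on the same convention.
newSize : ℕ → List ℕ → ℕ
newSize p []      = 1
newSize p (x ∷ _) = if x ≡ᵇ p then 0 else 1

-- 1 if p occurs exactly once.
second : ℕ → List ℕ → ℕ
second p []       = 0
second p (x ∷ ps) = if x ≡ᵇ p then newSize p ps else 0

-- 1 if p ≥ 2 and neither p nor p - 1 occurs.
isolated : ℕ → List ℕ → ℕ
isolated p []      = if 2 ≤ᵇ p then 1 else 0
isolated p (x ∷ _) = if x + 2 ≤ᵇ p then 1 else 0

sizes : List ℕ → ℕ
sizes []       = 0
sizes (p ∷ ps) = sizes ps + newSize p ps

-- A 2-hook has either arm 0 and leg 1, counted by `second`, or arm 1 and leg 0, counted by
-- `isolated`.
hooks₂ : List ℕ → ℕ
hooks₂ []       = 0
hooks₂ (p ∷ ps) = hooks₂ ps + (second p ps + isolated p ps)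

≡ᵇ-cases : ∀ x p → (x ≡ p × (x ≡ᵇ p) ≡ true) ⊎ (¬ x ≡ p × (x ≡ᵇ p) ≡ false)
≡ᵇ-cases zero    zero    = inj₁ (refl , refl)
≡ᵇ-cases zero    (suc p) = inj₂ ((λ ()) , refl)
≡ᵇ-cases (suc x) zero    = inj₂ ((λ ()) , refl)
≡ᵇ-cases (suc x) (suc p) with ≡ᵇ-cases x p
... | inj₁ (e , f) = inj₁ (cong suc e , f)
... | inj₂ (e , f) = inj₂ ((λ e' → e (suc-injective e')) , f)

rowCount-1≤ : ∀ p ps → 0 < p → rowCount 1 p ps ≤ newSize p ps
rowCount-1≤ (suc p) []       _ = ≤-trans (≤-reflexive (rowCount-1 p [])) (δ≤1 1 1)
rowCount-1≤ (suc p) (x ∷ ps) _ with ≡ᵇ-cases x (suc p)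
... | inj₁ (refl , e) = ≤-trans (≤-reflexive (trans (rowCount-1 p (x ∷ ps))
        (δ-no {1} (λ d → 0≢1+n (trans (sym (suc-injective d)) (conjPart-accept {suc p} {suc p} ps ≤-refl)))))) z≤n
... | inj₂ (_ , e)    = ≤-trans (≤-reflexive (rowCount-1 p (x ∷ ps))) (≤-trans (δ≤1 1 (suc (conjPart (x ∷ ps) (suc p)))) (≤-reflexive (cong (λ c → if c then 0 else 1) (sym e))))

numHooks-1≤sizes : ∀ {m} λs → Bounded m λs → numHooks 1 λs ≤ sizes λs
numHooks-1≤sizes λs v = ≤-trans (≤-reflexive (numHooks≡rowCounts 1 λs v)) (go λs v)
  where
  go : ∀ {m} ps → Bounded m ps → rowCounts 1 ps ≤ sizes ps
  go []       _             = z≤n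
  go (p ∷ ps) (p>0 , _ , v) = ≤-trans (+-mono-≤ (rowCount-1≤ p ps p>0) (go ps v)) (≤-reflexive (+-comm (newSize p ps) (sizes ps)))

newSize⇒ : ∀ p ps → Bounded p ps → newSize p ps ≡ 0 ⊎ conjPart ps p ≡ 0
newSize⇒ p []       _             = inj₂ refl
newSize⇒ p (x ∷ ps) (x>0 , x≤p , v) with ≡ᵇ-cases x p
... | inj₁ (_ , e) = inj₁ (cong (λ c → if c then 0 else 1) e)
... | inj₂ (d , _) = inj₂ (conjPart-reject (x ∷ ps) (x>0 , ≤-refl , v) (≤∧≢⇒< x≤p d))

newSize≤1 : ∀ p ps → newSize p ps ≤ 1
newSize≤1 p []      = ≤-refl
newSize≤1 p (x ∷ _) with x ≡ᵇ p
... | true  = z≤n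
... | false = ≤-refl

-- The last cell of the row has arm 0, and its leg is the number of later rows of length p.
second≤ : ∀ p ps → Bounded p ps → second p ps ≤ δ 2 (suc (conjPart ps p))
second≤ p []       _             = z≤n
second≤ p (x ∷ ps) (x>0 , x≤p , v) with ≡ᵇ-cases x p
... | inj₂ (_ , e) = ≤-trans (≤-reflexive (cong (λ c → if c then newSize p ps else 0) e)) z≤n
... | inj₁ (refl , e) with newSize⇒ p ps v
...   | inj₁ z = ≤-trans (≤-reflexive (trans (cong (λ c → if c then newSize p ps else 0) e) z)) z≤n
...   | inj₂ z = ≤-trans (≤-reflexive (cong (λ c → if c then newSize p ps else 0) e)) (≤-trans (newSize≤1 p ps)
          (≤-reflexive (sym (δ-yes {2} (cong suc (trans (conjPart-accept ps ≤-refl) (cong suc z)))))))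

-- The last cell but one has arm 1, and it is a 2-hook when no later row reaches its column.
isolated≤ : ∀ p ps → Bounded (suc (suc p)) ps → isolated (suc (suc p)) ps ≤ δ 2 (suc (suc (conjPart ps (suc p))))
isolated≤ p []       _ = ≤-reflexive (sym (δ-yes {2} refl))
isolated≤ p (x ∷ ps) (x>0 , _ , v) with ≤-<-connex (x + 2) (2 + p)
... | inj₁ l = ≤-trans (≤-reflexive (cong (λ c → if c then 1 else 0) (≤ᵇ-true l)))
      (≤-reflexive (sym (δ-yes {2} (cong (λ c → suc (suc c)) (conjPart-reject (x ∷ ps) (x>0 , ≤-refl , v)
        (s≤s (s≤s⁻¹ (s≤s⁻¹ (≤-trans (≤-reflexive (+-comm 2 x)) l)))))))))
... | inj₂ l = ≤-trans (≤-reflexive (cong (λ c → if c then 1 else 0) (≤ᵇ-false l))) z≤n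

isolated-1 : ∀ ps → Bounded 1 ps → isolated 1 ps ≡ 0
isolated-1 []       _ = refl
isolated-1 (x ∷ ps) _ = cong (λ c → if c then 1 else 0) (≤ᵇ-false (≤-trans (s≤s (s≤s z≤n)) (m≤n+m 2 x)))

≤rowCount-2 : ∀ p ps → 0 < p → Bounded p ps → second p ps + isolated p ps ≤ rowCount 2 p ps
≤rowCount-2 (suc zero) ps _ v = ≤-trans (≤-reflexive (trans (cong (second 1 ps +_) (isolated-1 ps v)) (+-identityʳ _)))
  (≤-trans (second≤ 1 ps v) (≤-reflexive (sym (trans (occurrences-suc 2 (rowHook 1 ps) 0) (cong (δ 2) (rowHook≡ 0 0 ps))))))
≤rowCount-2 (suc (suc p)) ps _ v = ≤-trans (+-mono-≤ (second≤ (2 + p) ps v) (isolated≤ p ps v))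
  (≤-reflexive (trans (+-comm (δ 2 (suc (conjPart ps (suc (suc p))))) _) (sym (rowCount-2 p ps))))

hooks₂≤numHooks-2 : ∀ {m} λs → Bounded m λs → hooks₂ λs ≤ numHooks 2 λs
hooks₂≤numHooks-2 λs v = ≤-trans (go λs v) (≤-reflexive (sym (numHooks≡rowCounts 2 λs v)))
  where
  go : ∀ {m} ps → Bounded m ps → hooks₂ ps ≤ rowCounts 2 ps
  go []       _             = z≤n
  go (p ∷ ps) (p>0 , _ , v) = ≤-trans (+-mono-≤ (go ps v) (≤rowCount-2 p ps p>0 v)) (≤-reflexive (+-comm (rowCounts 2 ps) _))

-- In a gap partition every row ends in a corner and has no cell of arm 0 and leg 1.

gapOK⇒< : ∀ a x → gapOK a x ≡ true → x < a
gapOK⇒< a x e with a % 2 ≡ᵇ 1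
... | true  = ≤-trans (m<m+n x (s≤s z≤n)) (≤ᵇ-true⇒≤ {x + 3} e)
... | false = ≤-trans (m<m+n x (s≤s z≤n)) (≤ᵇ-true⇒≤ {x + 2} e)

∧-elim : ∀ a {c} → a ∧ c ≡ true → a ≡ true × c ≡ true
∧-elim true e = refl , e

gap-conjPart : ∀ p ps {m} → Bounded m (p ∷ ps) → cond1 (p ∷ ps) ≡ true → conjPart ps p ≡ 0 × cond1 ps ≡ true
gap-conjPart p []       _                              _ = refl , refl
gap-conjPart p (x ∷ ps) (_ , _ , (x>0 , _ , v)) e with ∧-elim (gapOK p x) e
... | e₁ , e₂ = conjPart-reject (x ∷ ps) (x>0 , ≤-refl , v) (gapOK⇒< p x e₁) , e₂

length≤rowCounts-1 : ∀ {m} ps → Bounded m ps → cond1 ps ≡ true → length ps ≤ rowCounts 1 ps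
length≤rowCounts-1 []           _               _ = z≤n
length≤rowCounts-1 (zero ∷ ps)  (() , _)        _
length≤rowCounts-1 {m} (suc p ∷ ps) (p>0 , l , v) e with gap-conjPart (suc p) ps {m} (p>0 , l , v) e
... | z , e' = +-mono-≤ (≤-reflexive (sym (trans (rowCount-1 p ps) (δ-yes {1} (cong suc z))))) (length≤rowCounts-1 ps v e')

rowCounts-2≤length : ∀ {m} ps → Bounded m ps → cond1 ps ≡ true → rowCounts 2 ps ≤ length ps
rowCounts-2≤length []           _               _ = z≤n
rowCounts-2≤length (zero ∷ ps)  (() , _)        _
rowCounts-2≤length {m} (suc zero ∷ ps) (p>0 , l , v) e with gap-conjPart 1 ps {m} (p>0 , l , v) e
... | z , e' = +-mono-≤ (≤-trans (≤-reflexive (occurrences-suc 2 (rowHook 1 ps) 0)) (δ≤1 2 (rowHook 1 ps 0))) (rowCounts-2≤length ps v e')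
rowCounts-2≤length {m} (suc (suc p) ∷ ps) (p>0 , l , v) e with gap-conjPart (2 + p) ps {m} (p>0 , l , v) e
... | z , e' = +-mono-≤ (≤-trans (≤-reflexive (trans (rowCount-2 p ps) (trans (cong (δ 2 (suc (suc (conjPart ps (suc p)))) +_)
                 (δ-no {2} (λ d → 0≢1+n (trans (sym z) (suc-injective d))))) (+-identityʳ _)))) (δ≤1 2 (suc (suc (conjPart ps (suc p))))))
               (rowCounts-2≤length ps v e')

tot-on-mono : ∀ c f g m → (∀ λs → Bounded m λs → c λs ≡ true → f λs ≤ g λs) → tot (on c f) m ≼ tot (on c g) m
tot-on-mono c f g m p = tot-mono m (λ λs v → go λs (c λs) (p λs v))
  where
  go : ∀ λs e → (e ≡ true → f λs ≤ g λs) → (if e then f λs else 0) ≤ (if e then g λs else 0)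
  go λs true  p = p refl
  go λs false p = z≤n

g₁-1≥ : ∀ n → tot (on cond1 length) n n ≤ g₁ 1 n
g₁-1≥ n = ≤-trans (le (tot-on-mono cond1 length (numHooks 1) n (λ λs v e →
  ≤-trans (length≤rowCounts-1 λs v e) (≤-reflexive (sym (numHooks≡rowCounts 1 λs v))))) n) (≤-reflexive (sym (g₁≡ 1 n)))

g₁-2≤ : ∀ n → g₁ 2 n ≤ tot (on cond1 length) n n
g₁-2≤ n = ≤-trans (≤-reflexive (g₁≡ 2 n)) (le (tot-on-mono cond1 (numHooks 2) length n (λ λs v e →
  ≤-trans (≤-reflexive (numHooks≡rowCounts 2 λs v)) (rowCounts-2≤length λs v e))) n)

g₂-1≤ : ∀ n → g₂ 1 n ≤ tot (on cond2 sizes) n n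
g₂-1≤ n = ≤-trans (≤-reflexive (g₂≡ 1 n)) (le (tot-on-mono cond2 (numHooks 1) sizes n (λ λs v _ → numHooks-1≤sizes λs v)) n)

g₂-2≥ : ∀ n → tot (on cond2 hooks₂) n n ≤ g₂ 2 n
g₂-2≥ n = ≤-trans (le (tot-on-mono cond2 hooks₂ (numHooks 2) n (λ λs v _ → hooks₂≤numHooks-2 λs v)) n) (≤-reflexive (sym (g₂≡ 2 n)))

-- Hook totals of the residue partitions

bool-cases : ∀ (c : Bool) → c ≡ true ⊎ c ≡ false
bool-cases true  = inj₁ refl
bool-cases false = inj₂ refl

if-true : ∀ {A : Set} {c : Bool} (x y : A) → c ≡ true → (if c then x else y) ≡ x
if-true x y refl = refl

if-false : ∀ {A : Set} {c : Bool} (x y : A) → c ≡ false → (if c then x else y) ≡ y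
if-false x y refl = refl

resTot : (Partition → ℕ) → ℕ → Series
resTot f m = tot (on cond2 f) m

R₂ : ℕ → Series
R₂ = resTot count

resTot-yes : ∀ f m → partOK2 (suc m) ≡ true → resTot f (suc m) ≈ resTot f m ⊕ X (suc m) ⊛ resTot (λ λs → f (suc m ∷ λs)) (suc m)
resTot-yes f m ok = ≈-trans (tot-suc (on cond2 f) m) (⊕-congˡ (resTot f m) (⊛-congˡ (X (suc m)) (tot-cong (suc m)
  (λ λs _ → cong (λ c → if c ∧ cond2 λs then f (suc m ∷ λs) else 0) ok))))

resTot-no : ∀ f m → partOK2 (suc m) ≡ false → resTot f (suc m) ≈ resTot f m
resTot-no f m no = ≈-trans (tot-suc (on cond2 f) m) (≈-trans (⊕-congˡ (resTot f m) (≈-trans (⊛-congˡ (X (suc m)) (tot-O (suc m)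
  (λ λs _ → cong (λ c → if c ∧ cond2 λs then f (suc m ∷ λs) else 0) no))) (R.zeroʳ (X (suc m))))) (R.+-identityʳ (resTot f m)))

R₂-yes : ∀ m → partOK2 (suc m) ≡ true → R₂ (suc m) ≈ geo (suc m) ⊛ R₂ m
R₂-yes m ok = geo-solves {suc m} pos (resTot-yes count m ok)

R₂-no : ∀ m → partOK2 (suc m) ≡ false → R₂ (suc m) ≈ R₂ m
R₂-no m no = resTot-no count m no

resFactor-yes : ∀ m → partOK2 m ≡ true → resFactor m ≈ geo m
resFactor-yes m ok = ≡⇒≈ (if-true (geo m) I ok)

resFactor-no : ∀ m → partOK2 m ≡ false → resFactor m ≈ I
resFactor-no m no = ≡⇒≈ (if-false (geo m) I no)

-- `R₂ m` contains the factors for parts up to m, and the infinite product contains the others.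
R₂⊛≈P : ∀ m → R₂ m ⊛ Res.Pr∞ (suc m) 1 ≈ P
R₂⊛≈P zero    = ≈-trans (⊛-congʳ (Res.Pr∞ 1 1) (tot-0 (on cond2 count) refl)) (≈-trans (R.*-identityˡ (Res.Pr∞ 1 1)) (≈-sym P≈Res))
R₂⊛≈P (suc m) = ≈-trans (≈-sym (≈-trans (⊛-congˡ (R₂ m) (next pos)) (go (bool-cases (partOK2 (suc m)))))) (R₂⊛≈P m)
  where
  F = Res.Pr∞ (2 + m) 1
  go : partOK2 (suc m) ≡ true ⊎ partOK2 (suc m) ≡ false → R₂ m ⊛ (resFactor (suc m) ⊛ F) ≈ R₂ (suc m) ⊛ F
  go (inj₁ ok) = ≈-trans (⊛-congˡ (R₂ m) (⊛-congʳ F (resFactor-yes (suc m) ok)))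
    (≈-trans (solve 3 (λ r g f → r :* (g :* f) := g :* r :* f) ≈-refl (R₂ m) (geo (suc m)) F) (⊛-congʳ F (≈-sym (R₂-yes m ok))))
  go (inj₂ no) = ≈-trans (⊛-congˡ (R₂ m) (≈-trans (⊛-congʳ F (resFactor-no (suc m) no)) (R.*-identityˡ F))) (⊛-congʳ F (≈-sym (R₂-no m no)))

R₂≈[]P : ∀ m → R₂ m ≈[ suc m ] P
R₂≈[]P m = []-trans ([]-sym ([]-trans ([]-⊛ ([]-refl {f = R₂ m}) (Res.Pr∞≈[]I pos pos)) (≈⇒[] (R.*-identityʳ (R₂ m))))) (≈⇒[] (R₂⊛≈P m))

≡ᵇ-refl : ∀ n → (n ≡ᵇ n) ≡ true
≡ᵇ-refl zero    = refl
≡ᵇ-refl (suc n) = ≡ᵇ-refl n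

≡ᵇ-< : ∀ {x p} → x < p → (x ≡ᵇ p) ≡ false
≡ᵇ-< {zero}  {suc p} _       = refl
≡ᵇ-< {suc x} {suc p} (s≤s l) = ≡ᵇ-< l

on-zero : ∀ f λs → f λs ≡ 0 → on cond2 f λs ≡ 0
on-zero f λs e = go (cond2 λs)
  where
  go : ∀ c → (if c then f λs else 0) ≡ 0
  go true  = e
  go false = refl

on-cong : ∀ {f g} λs → f λs ≡ g λs → on cond2 f λs ≡ on cond2 g λs
on-cong λs e = cong (λ u → if cond2 λs then u else 0) e

resTot-⊕ : ∀ f g m → resTot (λ λs → f λs + g λs) m ≈ resTot f m ⊕ resTot g m
resTot-⊕ f g m = ≈-trans (tot-cong m (λ λs _ → go (cond2 λs) (f λs) (g λs))) (tot-⊕ (on cond2 f) (on cond2 g) m)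
  where
  go : ∀ c u v → (if c then u + v else 0) ≡ (if c then u else 0) + (if c then v else 0)
  go true  u v = refl
  go false u v = refl

newSize-small : ∀ {m} λs → Bounded m λs → newSize (suc m) λs ≡ 1
newSize-small []       _               = refl
newSize-small (x ∷ λs) (_ , x≤m , _) = if-false 0 1 (≡ᵇ-< (s≤s x≤m))

resTot-newSize : ∀ m → resTot (newSize (suc m)) (suc m) ≈ R₂ m
resTot-newSize m = ≈-trans (tot-restrict 1 m far) (tot-cong m (λ λs v → on-cong {newSize (suc m)} {count} λs (newSize-small λs v)))
  where
  far : ∀ x λs → m < x → x ≤ suc m → Bounded x λs → on cond2 (newSize (suc m)) (x ∷ λs) ≡ 0
  far x λs l l' _ = on-zero (newSize (suc m)) (x ∷ λs)
    (if-true 0 1 (trans (cong (_≡ᵇ suc m) (≤-antisym l' l)) (≡ᵇ-refl (suc m))))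

resTot-second : ∀ m → partOK2 (suc m) ≡ true → resTot (second (suc m)) (suc m) ≈ X (suc m) ⊛ R₂ m
resTot-second m ok = ≈-trans (resTot-yes (second (suc m)) m ok) (≈-trans (⊕-cong (tot-O m small) (⊛-congˡ (X (suc m))
  (≈-trans (tot-cong (suc m) (λ λs _ → on-cong {λ λs → second (suc m) (suc m ∷ λs)} {newSize (suc m)} λs (if-true (newSize (suc m) λs) 0 (≡ᵇ-refl (suc m))))) (resTot-newSize m))))
  (R.+-identityˡ (X (suc m) ⊛ R₂ m)))
  where
  small : ∀ λs → Bounded m λs → on cond2 (second (suc m)) λs ≡ 0
  small []       _             = refl
  small (x ∷ λs) (_ , x≤m , _) = on-zero (second (suc m)) (x ∷ λs) (if-false (newSize (suc m) λs) 0 (≡ᵇ-< (s≤s x≤m)))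

below : ℕ → Series
below zero    = O
below (suc m) = R₂ m

resTot-isolated : ∀ m → resTot (isolated (suc m)) (suc m) ≈ below m
resTot-isolated zero    = tot-O 1 (λ λs v → on-zero (isolated 1) λs (isolated-1 λs v))
resTot-isolated (suc m) = ≈-trans (tot-restrict 2 m far) (tot-cong m (λ λs v → on-cong {isolated (2 + m)} {count} λs (near λs v)))
  where
  far : ∀ x λs → m < x → x ≤ 2 + m → Bounded x λs → on cond2 (isolated (2 + m)) (x ∷ λs) ≡ 0
  far x λs l _ _ = on-zero (isolated (2 + m)) (x ∷ λs) (if-false 1 0 (≤ᵇ-false (≤-trans (s≤s (s≤s l)) (≤-reflexive (+-comm 2 x)))))
  near : ∀ λs → Bounded m λs → isolated (2 + m) λs ≡ 1
  near []       _             = refl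
  near (x ∷ λs) (_ , x≤m , _) = if-true 1 0 (≤ᵇ-true (≤-trans (≤-reflexive (+-comm x 2)) (s≤s (s≤s x≤m))))

-- The generating function of the numbers j p with p ≡ 1, 5, 6 mod 8, p ≤ m.
sel : ℕ → ℕ → Series
sel j zero    = O
sel j (suc m) = if partOK2 (suc m) then sel j m ⊕ X (j * suc m) else sel j m

sel-yes : ∀ j m → partOK2 (suc m) ≡ true → sel j (suc m) ≈ sel j m ⊕ X (j * suc m)
sel-yes j m ok = ≡⇒≈ (if-true (sel j m ⊕ X (j * suc m)) (sel j m) ok)

sel-no : ∀ j m → partOK2 (suc m) ≡ false → sel j (suc m) ≈ sel j m
sel-no j m no = ≡⇒≈ (if-false (sel j m ⊕ X (j * suc m)) (sel j m) no)

X1* : ∀ p → X (1 * p) ≈ X p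
X1* p = ≡⇒≈ (cong X (*-identityˡ p))

X2* : ∀ p → X (2 * p) ≈ X p ⊛ X p
X2* p = ≈-trans (≡⇒≈ (cong (λ u → X (p + u)) (+-identityʳ p))) (X-+ p p)

-- Removing one copy of p turns the partitions containing p into all of them, so each admissible
-- size p contributes qᵖ `R₂`.
sizes≈ : ∀ m → resTot sizes m ≈ sel 1 m ⊛ R₂ m
sizes≈ zero    = ≈-trans (tot-O 0 (λ { [] _ → refl ; (x ∷ λs) (x>0 , x≤0 , _) → ⊥-elim (<⇒≱ x>0 x≤0) })) (≈-sym (R.zeroˡ (R₂ 0)))
sizes≈ (suc m) = go (bool-cases (partOK2 (suc m)))
  where
  p = suc m
  go : partOK2 p ≡ true ⊎ partOK2 p ≡ false → resTot sizes p ≈ sel 1 p ⊛ R₂ p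
  go (inj₂ no) = ≈-trans (resTot-no sizes m no) (≈-trans (sizes≈ m) (⊛-cong (≈-sym (sel-no 1 m no)) (≈-sym (R₂-no m no))))
  go (inj₁ ok) = begin
    resTot sizes p  ≈⟨ geo-solves {p} pos rec ⟩
    geo p ⊛ (resTot sizes m ⊕ X p ⊛ R₂ m)  ≈⟨ ⊛-congˡ (geo p) (⊕-congʳ (X p ⊛ R₂ m) (sizes≈ m)) ⟩
    geo p ⊛ (sel 1 m ⊛ R₂ m ⊕ X p ⊛ R₂ m)  ≈⟨ solve 4 (λ g s r x → g :* (s :* r :+ x :* r) := (s :+ x) :* (g :* r)) ≈-refl (geo p) (sel 1 m) (R₂ m) (X p) ⟩
    (sel 1 m ⊕ X p) ⊛ (geo p ⊛ R₂ m)  ≈⟨ ⊛-cong (≈-trans (⊕-congˡ (sel 1 m) (≈-sym (X1* p))) (≈-sym (sel-yes 1 m ok))) (≈-sym (R₂-yes m ok)) ⟩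
    sel 1 p ⊛ R₂ p  ∎
    where
    open ≈R
    rec : resTot sizes p ≈ (resTot sizes m ⊕ X p ⊛ R₂ m) ⊕ X p ⊛ resTot sizes p
    rec = ≈-trans (resTot-yes sizes m ok) (≈-trans (⊕-congˡ (resTot sizes m) (⊛-congˡ (X p) (≈-trans (resTot-⊕ sizes (newSize p) p) (⊕-congˡ (resTot sizes p) (resTot-newSize m)))))
      (solve 4 (λ a x b r → a :+ x :* (b :+ r) := a :+ x :* r :+ x :* b) ≈-refl (resTot sizes m) (X p) (resTot sizes p) (R₂ m)))

hooks₂-yes : ∀ m → partOK2 (suc m) ≡ true → resTot hooks₂ (suc m) ≈ geo (suc m) ⊛ (resTot hooks₂ m ⊕ X (suc m) ⊛ (X (suc m) ⊛ R₂ m ⊕ below m))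
hooks₂-yes m ok = geo-solves {suc m} pos (≈-trans (resTot-yes hooks₂ m ok) (≈-trans (⊕-congˡ (resTot hooks₂ m) (⊛-congˡ (X p)
    (≈-trans (resTot-⊕ hooks₂ (λ λs → second p λs + isolated p λs) p) (⊕-congˡ (resTot hooks₂ p)
      (≈-trans (resTot-⊕ (second p) (isolated p) p) (⊕-cong (resTot-second m ok) (resTot-isolated m)))))))
  (solve 4 (λ a x b r → a :+ x :* (b :+ r) := a :+ x :* r :+ x :* b) ≈-refl (resTot hooks₂ m) (X p) (resTot hooks₂ p) (X p ⊛ R₂ m ⊕ below m))))
  where p = suc m

-- Corrects for the part 1 and for the pairs of part sizes p - 1, p.
nb : ℕ → Series
nb zero    = X 1
nb (suc m) = if partOK2 (suc m) ∧ partOK2 m then nb m ⊕ X (m + suc m) else nb m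

nb-yes : ∀ m → partOK2 (suc m) ≡ true → partOK2 m ≡ true → nb (suc m) ≈ nb m ⊕ X (m + suc m)
nb-yes m ok ok' = ≡⇒≈ (if-true (nb m ⊕ X (m + suc m)) (nb m) (cong₂ _∧_ ok ok'))

nb-no : ∀ m → (partOK2 (suc m) ∧ partOK2 m) ≡ false → nb (suc m) ≈ nb m
nb-no m no = ≡⇒≈ (if-false (nb m ⊕ X (m + suc m)) (nb m) no)

-- A size p yields one 2-hook if it is repeated, contributing q²ᵖ, and another if p ≥ 2 and p - 1 is
-- absent, contributing qᵖ less q^(2p-1) when p - 1 is admissible. The terms to be subtracted are
-- gathered in `nb`.
hooks₂≽ : ∀ m → (sel 1 m ⊕ sel 2 m) ⊛ R₂ m ≼ resTot hooks₂ m ⊕ nb m ⊛ R₂ m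
hooks₂≽ zero    = ≼-trans (≈⇒≼ (≈-trans (⊛-congʳ (R₂ 0) (R.+-identityˡ O)) (R.zeroˡ (R₂ 0)))) (mk≼ λ n → z≤n)
hooks₂≽ (suc m) = go (bool-cases (partOK2 (suc m)))
  where
  p = suc m
  r = R₂ p
  v = resTot hooks₂ m
  M = sel 1 m ⊕ sel 2 m
  -- Partitions containing p are split according to whether they contain p - 1.
  step : partOK2 p ≡ true → nb m ⊛ r ⊕ X p ⊛ r ≼ geo p ⊛ (X p ⊛ below m) ⊕ nb p ⊛ r →
    (sel 1 p ⊕ sel 2 p) ⊛ r ≼ resTot hooks₂ p ⊕ nb p ⊛ r
  step ok l = begin
    (sel 1 p ⊕ sel 2 p) ⊛ r
      ≈⟨ ⊛-congʳ r (⊕-cong (≈-trans (sel-yes 1 m ok) (⊕-congˡ (sel 1 m) (X1* p))) (≈-trans (sel-yes 2 m ok) (⊕-congˡ (sel 2 m) (X2* p)))) ⟩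
    (sel 1 m ⊕ X p ⊕ (sel 2 m ⊕ X p ⊛ X p)) ⊛ r
      ≈⟨ solve 4 (λ a x b r → (a :+ x :+ (b :+ x :* x)) :* r := (a :+ b) :* r :+ (x :* r :+ x :* x :* r)) ≈-refl (sel 1 m) (X p) (sel 2 m) r ⟩
    M ⊛ r ⊕ (X p ⊛ r ⊕ X p ⊛ X p ⊛ r)
      ≈⟨ ⊕-cong (≈-trans (⊛-congˡ M (R₂-yes m ok)) (solve 3 (λ a g r → a :* (g :* r) := g :* (a :* r)) ≈-refl M (geo p) (R₂ m)))
                (⊕-congˡ (X p ⊛ r) (⊛-congˡ (X p ⊛ X p) (R₂-yes m ok))) ⟩
    geo p ⊛ (M ⊛ R₂ m) ⊕ (X p ⊛ r ⊕ X p ⊛ X p ⊛ (geo p ⊛ R₂ m))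
      ≤⟨ ⊕-mono (⊛-monoʳ (geo p) (hooks₂≽ m)) (≼-refl {X p ⊛ r ⊕ X p ⊛ X p ⊛ (geo p ⊛ R₂ m)}) ⟩
    geo p ⊛ (v ⊕ nb m ⊛ R₂ m) ⊕ (X p ⊛ r ⊕ X p ⊛ X p ⊛ (geo p ⊛ R₂ m))
      ≈⟨ solve 6 (λ g v n r x y → g :* (v :+ n :* r) :+ (y :+ x :* x :* (g :* r)) := g :* v :+ x :* x :* (g :* r) :+ (n :* (g :* r) :+ y)) ≈-refl (geo p) v (nb m) (R₂ m) (X p) (X p ⊛ r) ⟩
    geo p ⊛ v ⊕ X p ⊛ X p ⊛ (geo p ⊛ R₂ m) ⊕ (nb m ⊛ (geo p ⊛ R₂ m) ⊕ X p ⊛ r)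
      ≈⟨ ⊕-congˡ (geo p ⊛ v ⊕ X p ⊛ X p ⊛ (geo p ⊛ R₂ m)) (⊕-congʳ (X p ⊛ r) (⊛-congˡ (nb m) (≈-sym (R₂-yes m ok)))) ⟩
    geo p ⊛ v ⊕ X p ⊛ X p ⊛ (geo p ⊛ R₂ m) ⊕ (nb m ⊛ r ⊕ X p ⊛ r)
      ≤⟨ ⊕-mono (≼-refl {geo p ⊛ v ⊕ X p ⊛ X p ⊛ (geo p ⊛ R₂ m)}) l ⟩
    geo p ⊛ v ⊕ X p ⊛ X p ⊛ (geo p ⊛ R₂ m) ⊕ (geo p ⊛ (X p ⊛ below m) ⊕ nb p ⊛ r)
      ≈⟨ solve 6 (λ g v x r c n → g :* v :+ x :* x :* (g :* r) :+ (g :* (x :* c) :+ n) := g :* (v :+ x :* (x :* r :+ c)) :+ n) ≈-refl (geo p) v (X p) (R₂ m) (below m) (nb p ⊛ r) ⟩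
    geo p ⊛ (v ⊕ X p ⊛ (X p ⊛ R₂ m ⊕ below m)) ⊕ nb p ⊛ r
      ≈⟨ ⊕-congʳ (nb p ⊛ r) (hooks₂-yes m ok) ⟨
    resTot hooks₂ p ⊕ nb p ⊛ r ∎
    where open ≼R
  pair : ∀ m' → m ≡ suc m' → partOK2 p ≡ true → partOK2 m ≡ true ⊎ partOK2 m ≡ false →
    nb m ⊛ r ⊕ X p ⊛ r ≼ geo p ⊛ (X p ⊛ below m) ⊕ nb p ⊛ r
  pair m' refl ok (inj₁ ok') = ≈⇒≼ (begin
    nb m ⊛ r ⊕ X p ⊛ r
      ≈⟨ ⊕-congˡ (nb m ⊛ r) (⊛-congˡ (X p) (≈-trans (R₂-yes m ok) (⊛-congˡ (geo p) (resTot-yes count m' ok')))) ⟩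
    nb m ⊛ r ⊕ X p ⊛ (geo p ⊛ (R₂ m' ⊕ X m ⊛ R₂ m))
      ≈⟨ solve 6 (λ n x g a y c → n :+ x :* (g :* (a :+ y :* c)) := g :* (x :* a) :+ (n :+ y :* x :* (g :* c))) ≈-refl (nb m ⊛ r) (X p) (geo p) (R₂ m') (X m) (R₂ m) ⟩
    geo p ⊛ (X p ⊛ R₂ m') ⊕ (nb m ⊛ r ⊕ X m ⊛ X p ⊛ (geo p ⊛ R₂ m))
      ≈⟨ ⊕-congˡ (geo p ⊛ (X p ⊛ R₂ m')) (≈-trans (⊕-congˡ (nb m ⊛ r) (⊛-cong (≈-sym (X-+ m p)) (≈-sym (R₂-yes m ok))))
           (≈-trans (≈-sym (R.distribʳ r (nb m) (X (m + p)))) (⊛-congʳ r (≈-sym (nb-yes m ok ok'))))) ⟩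
    geo p ⊛ (X p ⊛ R₂ m') ⊕ nb p ⊛ r ∎)
    where open ≈R
  pair m' refl ok (inj₂ no) = ≈⇒≼ (begin
    nb m ⊛ r ⊕ X p ⊛ r
      ≈⟨ ⊕-cong (⊛-congʳ r (≈-sym (nb-no m (trans (cong (_∧ partOK2 m) ok) no)))) (⊛-congˡ (X p) (≈-trans (R₂-yes m ok) (⊛-congˡ (geo p) (R₂-no m' no)))) ⟩
    nb p ⊛ r ⊕ X p ⊛ (geo p ⊛ R₂ m')
      ≈⟨ solve 4 (λ n x g a → n :+ x :* (g :* a) := g :* (x :* a) :+ n) ≈-refl (nb p ⊛ r) (X p) (geo p) (R₂ m') ⟩
    geo p ⊛ (X p ⊛ R₂ m') ⊕ nb p ⊛ r ∎)
    where open ≈R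
  first : m ≡ 0 → (sel 1 p ⊕ sel 2 p) ⊛ r ≼ resTot hooks₂ p ⊕ nb p ⊛ r
  -- The part 1 has no cell of arm 1; the initial term q of `nb` makes up for it.
  first refl = begin
    (O ⊕ X 1 ⊕ (O ⊕ X 2)) ⊛ R₂ 1  ≈⟨ ⊛-congʳ (R₂ 1) (⊕-congˡ (O ⊕ X 1) (⊕-congˡ O (X2* 1))) ⟩
    (O ⊕ X 1 ⊕ (O ⊕ X 1 ⊛ X 1)) ⊛ R₂ 1  ≈⟨ solve 2 (λ x r → (con 0 :+ x :+ (con 0 :+ x :* x)) :* r := x :* x :* r :+ x :* r) ≈-refl (X 1) (R₂ 1) ⟩
    X 1 ⊛ X 1 ⊛ R₂ 1 ⊕ X 1 ⊛ R₂ 1  ≤⟨ ⊕-mono lower (≼-refl {X 1 ⊛ R₂ 1}) ⟩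
    resTot hooks₂ 1 ⊕ X 1 ⊛ R₂ 1  ∎
    where
    open ≼R
    lower : X 1 ⊛ X 1 ⊛ R₂ 1 ≼ resTot hooks₂ 1
    lower = begin
      X 1 ⊛ X 1 ⊛ R₂ 1  ≈⟨ ⊛-congˡ (X 1 ⊛ X 1) (R₂-yes 0 refl) ⟩
      X 1 ⊛ X 1 ⊛ (geo 1 ⊛ R₂ 0)  ≈⟨ solve 3 (λ x g r → x :* x :* (g :* r) := g :* (x :* (x :* r :+ con 0))) ≈-refl (X 1) (geo 1) (R₂ 0) ⟩
      geo 1 ⊛ (X 1 ⊛ (X 1 ⊛ R₂ 0 ⊕ O))  ≤⟨ ⊛-monoʳ (geo 1) (≼-⊕ˡ (resTot hooks₂ 0) (X 1 ⊛ (X 1 ⊛ R₂ 0 ⊕ O))) ⟩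
      geo 1 ⊛ (resTot hooks₂ 0 ⊕ X 1 ⊛ (X 1 ⊛ R₂ 0 ⊕ O)) ≈⟨ hooks₂-yes 0 refl ⟨
      resTot hooks₂ 1  ∎
  split : ∀ m' → m ≡ m' → partOK2 p ≡ true → (sel 1 p ⊕ sel 2 p) ⊛ r ≼ resTot hooks₂ p ⊕ nb p ⊛ r
  split zero     e ok = first e
  split (suc m') e ok = step ok (pair m' e ok (bool-cases (partOK2 m)))
  go : partOK2 p ≡ true ⊎ partOK2 p ≡ false → (sel 1 p ⊕ sel 2 p) ⊛ r ≼ resTot hooks₂ p ⊕ nb p ⊛ r
  go (inj₁ ok) = split m refl ok
  go (inj₂ no) = ≼-trans (≈⇒≼ (⊛-cong (⊕-cong (sel-no 1 m no) (sel-no 2 m no)) (R₂-no m no))) (≼-trans (hooks₂≽ m)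
    (≈⇒≼ (⊕-cong (≈-sym (resTot-no hooks₂ m no)) (⊛-cong (≈-sym (nb-no m (cong (_∧ partOK2 m) no))) (≈-sym (R₂-no m no))))))

-- The limit of `sel j`: the sum of qʲᵖ over all p congruent to 1, 5 or 6 modulo 8.
ap : ℕ → Series
ap j = X (j * 1) ⊛ geo (j * 8) ⊕ X (j * 5) ⊛ geo (j * 8) ⊕ X (j * 6) ⊛ geo (j * 8)

module _ (j : ℕ) where
  private
    k = suc j
    s = sel k

  ap-unfold : ap k ≈ X (k * 1) ⊕ X (k * 5) ⊕ X (k * 6) ⊕ X (k * 8) ⊛ ap k
  ap-unfold = ≈-trans (solve 4 (λ x y z g → x :* g :+ y :* g :+ z :* g := (x :+ y :+ z) :* g) ≈-refl x₁ x₅ x₆ g)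
    (≈-trans (⊛-congˡ (x₁ ⊕ x₅ ⊕ x₆) (geo-unfold {k * 8} pos))
    (solve 5 (λ x y z w g → (x :+ y :+ z) :* (con 1 :+ w :* g) := x :+ y :+ z :+ w :* (x :* g :+ y :* g :+ z :* g)) ≈-refl x₁ x₅ x₆ (X (k * 8)) g))
    where
    x₁ = X (k * 1)
    x₅ = X (k * 5)
    x₆ = X (k * 6)
    g = geo (k * 8)

  private
    no : ∀ r t → partOK2 (suc r) ≡ false → s (suc r + t * 8) ≈ s (r + t * 8)
    no r t e = sel-no k (r + t * 8) (trans (partOK2-periodic (suc r) t) e)
    yes : ∀ r t → partOK2 (suc r) ≡ true → s (suc r + t * 8) ≈ s (r + t * 8) ⊕ X (k * (t * 8)) ⊛ X (k * suc r)
    yes r t e = ≈-trans (sel-yes k (r + t * 8) (trans (partOK2-periodic (suc r) t) e))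
      (⊕-congˡ (s (r + t * 8)) (≈-trans (≡⇒≈ (cong X (trans (*-distribˡ-+ k (suc r) (t * 8)) (+-comm (k * suc r) (k * (t * 8)))))) (X-+ (k * (t * 8)) (k * suc r))))

  sel-block : ∀ t → s (suc t * 8) ≈ s (t * 8) ⊕ X (k * (t * 8)) ⊛ (X (k * 1) ⊕ X (k * 5) ⊕ X (k * 6))
  sel-block t = ≈-trans (no 7 t refl) (≈-trans (no 6 t refl) (≈-trans (yes 5 t refl) (≈-trans (⊕-congʳ (y ⊛ X (k * 6))
    (≈-trans (yes 4 t refl) (⊕-congʳ (y ⊛ X (k * 5)) (≈-trans (no 3 t refl) (≈-trans (no 2 t refl) (≈-trans (no 1 t refl) (yes 0 t refl)))))))
    (solve 5 (λ a y u v w → a :+ y :* u :+ y :* v :+ y :* w := a :+ y :* (u :+ v :+ w)) ≈-refl (s (t * 8)) y (X (k * 1)) (X (k * 5)) (X (k * 6))))))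
    where y = X (k * (t * 8))

  sel⊕≈ap : ∀ t → s (t * 8) ⊕ X (k * (t * 8)) ⊛ ap k ≈ ap k
  sel⊕≈ap zero    = ≈-trans (R.+-identityˡ (X (k * 0) ⊛ ap k)) (≈-trans (⊛-congʳ (ap k) (≡⇒≈ (cong X (*-zeroʳ k)))) (R.*-identityˡ (ap k)))
  sel⊕≈ap (suc t) = begin
    s (suc t * 8) ⊕ X (k * (8 + t * 8)) ⊛ ap k
      ≈⟨ ⊕-cong (sel-block t) (⊛-congʳ (ap k) (≈-trans (≡⇒≈ (cong X (trans (*-distribˡ-+ k 8 (t * 8)) (+-comm (k * 8) (k * (t * 8)))))) (X-+ (k * (t * 8)) (k * 8)))) ⟩
    s (t * 8) ⊕ y ⊛ (X (k * 1) ⊕ X (k * 5) ⊕ X (k * 6)) ⊕ y ⊛ X (k * 8) ⊛ ap k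
      ≈⟨ solve 5 (λ a y u w p → a :+ y :* u :+ y :* w :* p := a :+ y :* (u :+ w :* p)) ≈-refl (s (t * 8)) y (X (k * 1) ⊕ X (k * 5) ⊕ X (k * 6)) (X (k * 8)) (ap k) ⟩
    s (t * 8) ⊕ y ⊛ (X (k * 1) ⊕ X (k * 5) ⊕ X (k * 6) ⊕ X (k * 8) ⊛ ap k)
      ≈⟨ ⊕-congˡ (s (t * 8)) (⊛-congˡ y (≈-sym ap-unfold)) ⟩
    s (t * 8) ⊕ y ⊛ ap k
      ≈⟨ sel⊕≈ap t ⟩
    ap k ∎
    where
    open ≈R
    y = X (k * (t * 8))

  sel≼ap : ∀ t → s (t * 8) ≼ ap k
  sel≼ap t = ≼-trans (≼-⊕ʳ (s (t * 8)) (X (k * (t * 8)) ⊛ ap k)) (≈⇒≼ (sel⊕≈ap t))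

  sel≈[]ap : ∀ t → s (t * 8) ≈[ t ] ap k
  sel≈[]ap t = []-trans (≈⇒[] (≈-sym (R.+-identityʳ (s (t * 8))))) ([]-trans ([]-⊕ ([]-refl {f = s (t * 8)})
    ([]-sym ([]-weaken (≤-trans (m≤m*n t 8) (m≤n*m (t * 8) k)) (X≈[]O (k * (t * 8)) (ap k))))) (≈⇒[] (sel⊕≈ap t)))

-- The consecutive admissible numbers are 8t + 5 and 8t + 6, with sum 16t + 11.
pairs : Series
pairs = X 11 ⊛ geo 16

nb-block : ∀ t → nb (suc t * 8) ≈ nb (t * 8) ⊕ X (t * 16) ⊛ X 11
nb-block t = ≈-trans (no 7 refl) (≈-trans (no 6 refl) (≈-trans
    (≈-trans (nb-yes (5 + t * 8) (partOK2-periodic 6 t) (partOK2-periodic 5 t)) (⊕-congˡ (nb (5 + t * 8)) (≈-trans (≡⇒≈ (cong X (lemma t))) (X-+ (t * 16) 11))))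
    (⊕-congʳ (X (t * 16) ⊛ X 11) (≈-trans (no 4 refl) (≈-trans (no 3 refl) (≈-trans (no 2 refl) (≈-trans (no 1 refl) (no 0 refl))))))))
  where
  no : ∀ r → (partOK2 (suc r) ∧ partOK2 r) ≡ false → nb (suc r + t * 8) ≈ nb (r + t * 8)
  no r e = nb-no (r + t * 8) (trans (cong₂ _∧_ (partOK2-periodic (suc r) t) (partOK2-periodic r t)) e)
  lemma : ∀ t → 5 + t * 8 + suc (5 + t * 8) ≡ t * 16 + 11
  lemma = NS.solve-∀

nb⊕≈ : ∀ t → nb (t * 8) ⊕ X (t * 16) ⊛ pairs ≈ X 1 ⊕ pairs
nb⊕≈ zero    = ⊕-congˡ (X 1) (R.*-identityˡ pairs)
nb⊕≈ (suc t) = begin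
  nb (suc t * 8) ⊕ X (16 + t * 16) ⊛ pairs  ≈⟨ ⊕-cong (nb-block t) (⊛-congʳ pairs (≈-trans (≡⇒≈ (cong X (+-comm 16 (t * 16)))) (X-+ (t * 16) 16))) ⟩
  nb (t * 8) ⊕ y ⊛ X 11 ⊕ y ⊛ X 16 ⊛ (X 11 ⊛ geo 16)  ≈⟨ solve 5 (λ a y u w g → a :+ y :* u :+ y :* w :* (u :* g) := a :+ y :* (u :* (con 1 :+ w :* g))) ≈-refl (nb (t * 8)) y (X 11) (X 16) (geo 16) ⟩
  nb (t * 8) ⊕ y ⊛ (X 11 ⊛ (I ⊕ X 16 ⊛ geo 16))  ≈⟨ ⊕-congˡ (nb (t * 8)) (⊛-congˡ y (⊛-congˡ (X 11) (≈-sym (geo-unfold {16} pos)))) ⟩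
  nb (t * 8) ⊕ y ⊛ pairs  ≈⟨ nb⊕≈ t ⟩
  X 1 ⊕ pairs  ∎
  where
  open ≈R
  y = X (t * 16)

nb≼ : ∀ t → nb (t * 8) ≼ X 1 ⊕ pairs
nb≼ t = ≼-trans (≼-⊕ʳ (nb (t * 8)) (X (t * 16) ⊛ pairs)) (≈⇒≼ (nb⊕≈ t))

g₂-1≤ap : ∀ n → g₂ 1 n ≤ (ap 1 ⊛ P) n
g₂-1≤ap n = begin
  g₂ 1 n  ≤⟨ g₂-1≤ n ⟩
  tot (on cond2 sizes) n n  ≡⟨ tot-stable (on cond2 sizes) m n≤m ⟨
  resTot sizes m n  ≡⟨ at (sizes≈ m) n ⟩
  (sel 1 m ⊛ R₂ m) n  ≤⟨ le (⊛-monoˡ (R₂ m) (sel≼ap 0 (suc n))) n ⟩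
  (ap 1 ⊛ R₂ m) n  ≡⟨ upTo ([]-⊛ ([]-refl {f = ap 1}) (R₂≈[]P m)) n (s≤s n≤m) ⟩
  (ap 1 ⊛ P) n  ∎
  where
  open ≤-Reasoning
  m = suc n * 8
  n≤m : n ≤ m
  n≤m = ≤-trans (n≤1+n n) (m≤m*n (suc n) 8)

g₂-2≥ap : ∀ n → ((ap 1 ⊕ ap 2) ⊛ P) n ≤ g₂ 2 n + ((X 1 ⊕ pairs) ⊛ P) n
g₂-2≥ap n = begin
  ((ap 1 ⊕ ap 2) ⊛ P) n  ≡⟨ upTo ([]-⊛ ([]-⊕ (sel≈[]ap 0 (suc n)) (sel≈[]ap 1 (suc n))) ([]-weaken (s≤s n≤m) (R₂≈[]P m))) n ≤-refl ⟨
  ((sel 1 m ⊕ sel 2 m) ⊛ R₂ m) n  ≤⟨ le (hooks₂≽ m) n ⟩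
  resTot hooks₂ m n + (nb m ⊛ R₂ m) n  ≤⟨ +-mono-≤ (≤-reflexive (tot-stable (on cond2 hooks₂) m n≤m)) (le (⊛-monoˡ (R₂ m) (nb≼ (suc n))) n) ⟩
  tot (on cond2 hooks₂) n n + ((X 1 ⊕ pairs) ⊛ R₂ m) n ≤⟨ +-mono-≤ (g₂-2≥ n) (≤-reflexive (upTo ([]-⊛ ([]-refl {f = X 1 ⊕ pairs}) (R₂≈[]P m)) n (s≤s n≤m))) ⟩
  g₂ 2 n + ((X 1 ⊕ pairs) ⊛ P) n  ∎
  where
  open ≤-Reasoning
  m = suc n * 8
  n≤m : n ≤ m
  n≤m = ≤-trans (n≤1+n n) (m≤m*n (suc n) 8)

-- S outgrows every multiple of P

comb≤1 : ∀ a c n → comb a c n ≤ 1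
comb≤1 a zero    zero    = ≤-refl
comb≤1 a zero    (suc n) = comb≤1 a a n
comb≤1 a (suc c) zero    = z≤n
comb≤1 a (suc c) (suc n) = comb≤1 a c n

geo-1≡1 : ∀ n → geo 1 n ≡ 1
geo-1≡1 zero    = refl
geo-1≡1 (suc n) = geo-1≡1 n

geo≼geo1 : ∀ a → geo (suc a) ≼ geo 1
geo≼geo1 a = mk≼ λ n → ≤-trans (comb≤1 a 0 n) (≤-reflexive (sym (geo-1≡1 n)))

P>0 : ∀ n → 0 < P n
P>0 n = ≤-trans (≤-reflexive (sym (trans (at (R.*-identityʳ (geo 1)) n) (geo-1≡1 n))))
  (≤-trans (le (⊛-monoʳ (geo 1) I≼noOnes) n) (≤-reflexive (sym (at P≈geo1 n))))
  where
  I≼noOnes : I ≼ P-noOnes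
  I≼noOnes = ≼-trans (≈⇒≼ (≈-sym (solve 0 (con 1 :* con 1 :* con 1 := con 1) ≈-refl)))
    (⊛-mono (⊛-mono (I≼ {8} (Geo.Pr∞≈[]I {9} {8} pos pos)) (I≼ {4} (Geo.Pr∞≈[]I {5} {8} pos pos))) (I≼ {5} (Geo.Pr∞≈[]I {6} {8} pos pos)))

Q-mono : ∀ t {f} → Mono f → Q t ⊛ f ≼ f
Q-mono zero    {f} m = ≈⇒≼ (R.*-identityˡ f)
Q-mono (suc t) {f} m = ≼-trans (≈⇒≼ (solve 3 (λ q x f → q :* (q :* x) :* f := q :* (q :* (x :* f))) ≈-refl q (Q t) f))
  (≼-trans (⊛-monoʳ q (≼-trans (⊛-monoʳ q (Q-mono t m)) m)) m)

-- The denominator has ℓ factors 1 - q²ⁱ, each inverse being at most 1/(1 - q); monotonicity removes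
-- the monomials of the numerator.
noOnes≼U : ∀ ℓ → ∃[ c ] noOnes ℓ ≼ c · U ℓ
noOnes≼U zero    = 1 , (mk≼ λ n → ≤-reflexive (sym (+-identityʳ _)))
noOnes≼U (suc ℓ) = c + c , (begin
  geo (2 * suc ℓ) ⊛ ((Q (suc ℓ) ⊕ q ⊛ q ⊛ q ⊛ Q ℓ ⊛ Q ℓ) ⊛ noOnes ℓ)
    ≤⟨ ⊛-mono (geo≼geo1 (ℓ + suc (ℓ + 0))) (⊛-monoʳ (Q (suc ℓ) ⊕ q ⊛ q ⊛ q ⊛ Q ℓ ⊛ Q ℓ) (proj₂ (noOnes≼U ℓ))) ⟩
  geo 1 ⊛ ((Q (suc ℓ) ⊕ q ⊛ q ⊛ q ⊛ Q ℓ ⊛ Q ℓ) ⊛ (c · U ℓ))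
    ≈⟨ ≈-trans (⊛-congˡ (geo 1) (⊛-· c (Q (suc ℓ) ⊕ q ⊛ q ⊛ q ⊛ Q ℓ ⊛ Q ℓ) (U ℓ))) (⊛-· c (geo 1) ((Q (suc ℓ) ⊕ q ⊛ q ⊛ q ⊛ Q ℓ ⊛ Q ℓ) ⊛ U ℓ)) ⟩
  c · (geo 1 ⊛ ((Q (suc ℓ) ⊕ q ⊛ q ⊛ q ⊛ Q ℓ ⊛ Q ℓ) ⊛ U ℓ))
    ≈⟨ ·-cong c (solve 5 (λ g x q y u → g :* ((x :+ q :* q :* q :* y :* y) :* u) := x :* (g :* u) :+ q :* (q :* (q :* (y :* (y :* (g :* u)))))) ≈-refl (geo 1) (Q (suc ℓ)) q (Q ℓ) (U ℓ)) ⟩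
  c · (Q (suc ℓ) ⊛ V ⊕ q ⊛ (q ⊛ (q ⊛ (Q ℓ ⊛ (Q ℓ ⊛ V)))))
    ≤⟨ ·-mono c (⊕-mono (Q-mono (suc ℓ) m) (drop (drop (drop (≼-trans (⊛-monoʳ (Q ℓ) (Q-mono ℓ m)) (Q-mono ℓ m)))))) ⟩
  c · (V ⊕ V)
    ≈⟨ mk≈ (λ n → lemma c (V n)) ⟩
  (c + c) · V ∎)
  where
  open ≼R
  c = proj₁ (noOnes≼U ℓ)
  V = geo 1 ⊛ U ℓ
  m : Mono V
  m = Mono-geo1 (U ℓ)
  drop : ∀ {f} → f ≼ V → q ⊛ f ≼ V
  drop l = ≼-trans (⊛-monoʳ q l) m
  lemma : ∀ c v → c * (v + v) ≡ (c + c) * v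
  lemma = NS.solve-∀

U-step : ∀ r → U r ≼ U (suc r)
U-step r = ≼-trans (≈⇒≼ (≈-sym (R.*-identityˡ (U r)))) (⊛-monoˡ (U r) (I≼geo {1} pos))

gap≼U : ∀ ℓ → ∃[ c ] gap ℓ ≼ c · U ℓ
gap≼U zero    = 1 , (mk≼ λ n → ≤-reflexive (sym (+-identityʳ _)))
gap≼U (suc ℓ) = c + d , (begin
  noOnes (suc ℓ) ⊕ q ⊛ Q ℓ ⊛ noOnes ℓ  ≤⟨ ⊕-mono (proj₂ (noOnes≼U (suc ℓ))) (⊛-monoʳ (q ⊛ Q ℓ) (≼-trans (proj₂ (noOnes≼U ℓ)) (·-mono d (U-step ℓ)))) ⟩
  c · V ⊕ q ⊛ Q ℓ ⊛ (d · V)  ≈⟨ ⊕-congˡ (c · V) (≈-trans (⊛-· d (q ⊛ Q ℓ) V) (·-cong d (R.*-assoc q (Q ℓ) V))) ⟩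
  c · V ⊕ d · (q ⊛ (Q ℓ ⊛ V))  ≤⟨ ⊕-mono (≼-refl {c · V}) (·-mono d (≼-trans (⊛-monoʳ q (Q-mono ℓ m)) m)) ⟩
  c · V ⊕ d · V  ≈⟨ mk≈ (λ n → *-distribʳ-+ (V n) c d) ⟨
  (c + d) · V  ∎)
  where
  open ≼R
  c = proj₁ (noOnes≼U (suc ℓ))
  d = proj₁ (noOnes≼U ℓ)
  V = U (suc ℓ)
  m : Mono V
  m = Mono-geo1 (U ℓ)

ΣS-gap≼U : ∀ K → ∃[ c ] ΣS K gap ≼ c · U K
ΣS-gap≼U zero    = 0 , (mk≼ λ n → z≤n)
ΣS-gap≼U (suc K) = c + d , (mk≼ λ n → ≤-trans (+-mono-≤ (le (proj₂ (ΣS-gap≼U K)) n) (le (proj₂ (gap≼U K)) n))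
  (≤-trans (≤-reflexive (sym (*-distribʳ-+ (U K n) c d))) (*-monoʳ-≤ (c + d) (le (U-step K) n))))
  where
  c = proj₁ (ΣS-gap≼U K)
  d = proj₁ (gap≼U K)

-- Partitions with at least K parts have weight at least K in the first sum on the right; the second
-- covers the others.
fewParts : ∀ K L n → Σ< L (λ ℓ → K * gap ℓ n) ≤ Σ< L (λ ℓ → ℓ * gap ℓ n) + K * Σ< K (λ ℓ → gap ℓ n)
fewParts K zero    n = z≤n
fewParts K (suc L) n = go (≤-<-connex K L)
  where
  open ≤-Reasoning
  go : K ≤ L ⊎ L < K → Σ< (suc L) (λ ℓ → K * gap ℓ n) ≤ Σ< (suc L) (λ ℓ → ℓ * gap ℓ n) + K * Σ< K (λ ℓ → gap ℓ n)
  go (inj₁ K≤L) = begin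
    Σ< L (λ ℓ → K * gap ℓ n) + K * gap L n  ≤⟨ +-mono-≤ (fewParts K L n) (*-monoˡ-≤ (gap L n) K≤L) ⟩
    Σ< L (λ ℓ → ℓ * gap ℓ n) + K * Σ< K (λ ℓ → gap ℓ n) + L * gap L n  ≡⟨ lemma (Σ< L (λ ℓ → ℓ * gap ℓ n)) (K * Σ< K (λ ℓ → gap ℓ n)) (L * gap L n) ⟩
    Σ< L (λ ℓ → ℓ * gap ℓ n) + L * gap L n + K * Σ< K (λ ℓ → gap ℓ n)  ∎
    where
    lemma : ∀ a b c → a + b + c ≡ a + c + b
    lemma = NS.solve-∀
  go (inj₂ L<K) = begin
    Σ< (suc L) (λ ℓ → K * gap ℓ n)  ≡⟨ Σ<-* (suc L) K (λ ℓ → gap ℓ n) ⟩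
    K * Σ< (suc L) (λ ℓ → gap ℓ n)  ≤⟨ *-monoʳ-≤ K (widen (suc L) (K ∸ suc L)) ⟩
    K * Σ< (K ∸ suc L + suc L) (λ ℓ → gap ℓ n) ≡⟨ cong (λ k → K * Σ< k (λ ℓ → gap ℓ n)) (m∸n+n≡m L<K) ⟩
    K * Σ< K (λ ℓ → gap ℓ n)  ≤⟨ m≤n+m _ (Σ< (suc L) (λ ℓ → ℓ * gap ℓ n)) ⟩
    Σ< (suc L) (λ ℓ → ℓ * gap ℓ n) + K * Σ< K (λ ℓ → gap ℓ n) ∎
    where
    widen : ∀ m k → Σ< m (λ ℓ → gap ℓ n) ≤ Σ< (k + m) (λ ℓ → gap ℓ n)
    widen m zero    = ≤-refl
    widen m (suc k) = ≤-trans (widen m k) (m≤m+n _ (gap (k + m) n))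

-- Gap partitions with fewer than K parts are negligible, so D eventually exceeds (K - 1) P.
D-large : ∀ K → ∃[ N ] (∀ n → n ≥ N → K * P n ≤ D n + P n)
D-large K = proj₁ rare , λ n l → begin
  K * P n  ≡⟨ cong (K *_) (at Σgap≈P n) ⟨
  K * Σ< (suc n) (λ ℓ → gap ℓ n)  ≡⟨ Σ<-* (suc n) K (λ ℓ → gap ℓ n) ⟨
  Σ< (suc n) (λ ℓ → K * gap ℓ n)  ≤⟨ fewParts K (suc n) n ⟩
  Σ< (suc n) (λ ℓ → ℓ * gap ℓ n) + K * Σ< K (λ ℓ → gap ℓ n)  ≤⟨ +-mono-≤ (≤-reflexive (at Σℓgap≈D n)) (*-monoʳ-≤ K (le (proj₂ (ΣS-gap≼U K)) n)) ⟩
  D n + K * (c * U K n)  ≡⟨ cong (D n +_) (*-assoc K c (U K n)) ⟨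
  D n + K * c * U K n  ≤⟨ +-monoʳ-≤ (D n) (proj₂ rare n l) ⟩
  D n + P n  ∎
  where
  open ≤-Reasoning
  c = proj₁ (ΣS-gap≼U K)
  rare = U≪P K (K * c)

-- Numerical estimates in units of 1/s

module Estimates (s : ℕ) where

  open Asymptotic s

  -- `D` exceeds every multiple of `P` and is at most a multiple of `S` plus O(P). The bound is
  -- taken for K + 1, which makes the inequality strict because `P` is positive.
  growth : ∀ a → 0 < s → D ≲ suc a → ∀ K → ∃[ N ] (∀ n → n ≥ N → K * P n < S n)
  growth a s>0 (by C p) K = proj₁ large , λ n l → <-≤-trans (m<n+m (K * P n) (P>0 n)) (*-cancelˡ-≤ (suc a) (+-cancelʳ-≤ (C * P n + P n) _ _ (begin
    suc a * (suc K * P n) + (C * P n + P n)  ≡⟨ lemma (suc a) (suc K) C (P n) ⟩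
    (suc a * suc K + C + 1) * P n  ≤⟨ proj₂ large n l ⟩
    D n + P n  ≤⟨ +-monoˡ-≤ (P n) (≤-trans (m≤n*m (D n) s {{>-nonZero s>0}}) (le p n)) ⟩
    suc a * S n + C * P n + P n  ≡⟨ +-assoc (suc a * S n) (C * P n) (P n) ⟩
    suc a * S n + (C * P n + P n)  ∎)))
    where
    open ≤-Reasoning
    large = D-large (suc a * suc K + C + 1)
    lemma : ∀ a k c p → a * (k * p) + (c * p + p) ≡ (a * k + c + 1) * p
    lemma = NS.solve-∀

  -- The fraction 1/d in units of 1/s, rounded down, and an integer above it.
  low high : (d : ℕ) .{{_ : NonZero d}} → ℕ
  low d  = s / d
  high d = suc (s / d)

  progression≳low : ∀ a d → progression a (suc d) ≳ low (suc d)
  progression≳low a d = progression≳ a (suc d) (s / suc d) pos (m/n*n≤m s (suc d))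

  progression≲high : ∀ a d → progression a (suc d) ≲ high (suc d)
  progression≲high a d = progression≲ a (suc d) (high (suc d)) pos
    (≤-trans (≤-reflexive (m≡m%n+[m/n]*n s (suc d))) (+-monoˡ-≤ (s / suc d * suc d) (<⇒≤ (m%n<n s (suc d)))))

  ≳-Σ : ∀ K {F c} → (∀ i → F i ≳ c i) → ΣS K F ≳ Σ< K c
  ≳-Σ zero    p = by 0 (mk≼ λ n → z≤n)
  ≳-Σ (suc K) {F} p = ≳-⊕ {ΣS K F} {F K} (≳-Σ K p) (p K)

  ≲-Σ : ∀ K {F c} → (∀ i → F i ≲ c i) → ΣS K F ≲ Σ< K c
  ≲-Σ zero    p = by 0 (mk≼ λ n → ≤-trans (≤-reflexive (*-zeroʳ s)) z≤n)
  ≲-Σ (suc K) {F} p = ≲-⊕ {ΣS K F} {F K} (≲-Σ K p) (p K)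

  ≈⇒≼+ : ∀ {f g} → f ≈ g → f ≼ g ⊕ 0 · P
  ≈⇒≼+ {f} {g} e = mk≼ λ n → ≤-trans (≤-reflexive (at e n)) (m≤m+n (g n) 0)

  module _ (d : ℕ) where
    lowOdd highOdd lowEven highEven : ℕ → ℕ
    lowOdd r   = Σ< r (λ i → low ((1 + 2 * i) * suc d))
    highOdd r  = Σ< r (λ i → high ((1 + 2 * i) * suc d))
    lowEven r  = Σ< r (λ i → low ((2 + 2 * i) * suc d))
    highEven r = Σ< r (λ i → high ((2 + 2 * i) * suc d))

    module _ (a : ℕ) where
      terms : ∀ K (m : ℕ → ℕ) → ΣS K (λ i → multiples (m i) a (suc d)) ⊛ P ≈ ΣS K (λ i → progression (m i * a) (m i * suc d))
      terms K m = ≈-trans (ΣS-⊛ K (λ i → multiples (m i) a (suc d)) P)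
        (ΣS-cong K (λ i → R.*-assoc (X (m i * a)) (geo (m i * suc d)) P))

      odds≳ : ∀ r → odds r a (suc d) ⊛ P ≳ lowOdd r
      odds≳ r = ≳-mono 0 (≈⇒≼+ (≈-sym (terms r (λ i → 1 + 2 * i)))) (≳-Σ r (λ i → progression≳low ((1 + 2 * i) * a) (d + (2 * i) * suc d)))

      odds≲ : ∀ r → odds r a (suc d) ⊛ P ≲ highOdd r
      odds≲ r = ≲-mono 0 (≈⇒≼+ (terms r (λ i → 1 + 2 * i))) (≲-Σ r (λ i → progression≲high ((1 + 2 * i) * a) (d + (2 * i) * suc d)))

      evens≳ : ∀ r → evens r a (suc d) ⊛ P ≳ lowEven r
      evens≳ r = ≳-mono 0 (≈⇒≼+ (≈-sym (terms r (λ i → 2 + 2 * i)))) (≳-Σ r (λ i → progression≳low ((2 + 2 * i) * a) (d + (1 + 2 * i) * suc d)))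

      evens≲ : ∀ r → evens r a (suc d) ⊛ P ≲ highEven r
      evens≲ r = ≲-mono 0 (≈⇒≼+ (terms r (λ i → 2 + 2 * i))) (≲-Σ r (λ i → progression≲high ((2 + 2 * i) * a) (d + (1 + 2 * i) * suc d)))

      module _ {A : Series} (a>0 : 0 < a) (A-Dist : A ⊛ Dist a (suc d) ≈ P) where

        private
          swap : ∀ f → A ⊛ (f ⊛ Dist a (suc d)) ≈ f ⊛ P
          swap f = ≈-trans (solve 3 (λ a f d → a :* (f :* d) := f :* (a :* d)) ≈-refl A f (Dist a (suc d))) (⊛-congˡ f A-Dist)

        -- `A` is the complementary factor of `P`. The m-th power sum contributes 1/(m (d + 1)), so
        -- the total tends to log 2/(d + 1), here truncated after 2r terms of the alternating
        -- series; `Len≲` takes one more.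
        Len≳ : ∀ r c → c + highEven r ≤ lowOdd r → A ⊛ Len a (suc d) ≳ c
        Len≳ r c l = ≳-minus {A ⊛ Len a (suc d)} {evens r a (suc d) ⊛ P} {odds r a (suc d) ⊛ P} (highEven r) c
          (≼-trans (≈⇒≼ (≈-sym (swap (odds r a (suc d))))) (≼-trans (⊛-monoʳ A (Alternating.lower r pos a>0))
            (≈⇒≼ (≈-trans (R.distribˡ A (Len a (suc d)) (evens r a (suc d) ⊛ Dist a (suc d))) (⊕-congˡ (A ⊛ Len a (suc d)) (swap (evens r a (suc d))))))))
          (odds≳ r) (evens≲ r) l

        Len≲ : ∀ r c → highOdd (suc r) ≤ c + lowEven r → A ⊛ Len a (suc d) ≲ c
        Len≲ r c l = ≲-minus {A ⊛ Len a (suc d)} {evens r a (suc d) ⊛ P} {odds (suc r) a (suc d) ⊛ P} (lowEven r) c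
          (≼-trans (≈⇒≼ (≈-trans (⊕-congˡ (A ⊛ Len a (suc d)) (≈-sym (swap (evens r a (suc d))))) (≈-sym (R.distribˡ A (Len a (suc d)) (evens r a (suc d) ⊛ Dist a (suc d))))))
            (≼-trans (⊛-monoʳ A (Alternating.upper r pos a>0)) (≈⇒≼ (swap (odds (suc r) a (suc d))))))
          (odds≲ (suc r)) (evens≳ r) l

  Y≳ : ∀ r c → c + highEven 1 r ≤ lowOdd 1 r → Y ≳ c
  Y≳ = Len≳ 1 2 {Dist 1 4} pos ≈-refl

  Y≲ : ∀ r c → highOdd 1 (suc r) ≤ c + lowEven 1 r → Y ≲ c
  Y≲ = Len≲ 1 2 {Dist 1 4} pos ≈-refl

  Z≳ : ∀ r c → c + highEven 3 r ≤ lowOdd 3 r → Z ≳ c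
  Z≳ r c l = ≳-mono {Even ⊛ Len 1 4} 0 (≈⇒≼+ (R.*-comm Even (Len 1 4))) (Len≳ 3 1 {Even} pos (R.*-comm Even (Dist 1 4)) r c l)

  Z≲ : ∀ r c → highOdd 3 (suc r) ≤ c + lowEven 3 r → Z ≲ c
  Z≲ r c l = ≲-mono {Z} {Even ⊛ Len 1 4} 0 (≈⇒≼+ (R.*-comm (Len 1 4) Even)) (Len≲ 3 1 {Even} pos (R.*-comm Even (Dist 1 4)) r c l)

  D≳ : ∀ y z c → Y ≳ y → Z ≳ z → 4 * c ≤ z + 4 * y → D ≳ c
  D≳ y z c Y≳y Z≳z l = ≳-divide {D} 4 c l (≳-mono {Z ⊕ 4 · Y} {4 · D} 1
    (≼-trans Z⊕4Y≼ (mk≼ λ n → +-monoʳ-≤ (4 * D n) (≤-reflexive (sym (+-identityʳ (P n))))))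
    (≳-⊕ {Z} {4 · Y} Z≳z (≳-· {Y} 4 Y≳y))) pos

  -- Without the term `low 4` the constant would be (3/4) log 2 > 1/2. It comes from 8 Λ ≥ S/4 -
  -- O(P).
  D≲ : ∀ y z c → Y ≲ y → Z ≲ z → 8 * (z + y) ≤ 8 * c + low 4 → D ≲ c
  D≲ y z c Y≲y Z≲z l = ≲-divide {D} 8 c ≤-refl (≲-minus {8 · D} {8 · Λ} {8 · (Z ⊕ Y)} (low 4) (8 * c)
    (mk≼ λ n → ≤-reflexive (trans (sym (*-distribˡ-+ 8 (D n) (Λ n))) (cong (8 *_) (at D⊕Λ≈ n))))
    (≲-· {Z ⊕ Y} 8 (≲-⊕ {Z} {Y} Z≲z Y≲y))
    (≳-mono {progression 9 4} {8 · Λ} 2 progression≼8Λ (progression≳low 9 3)) l) pos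

  private
    split-ap : ∀ j → ap j ⊛ P ≈ progression (j * 1) (j * 8) ⊕ progression (j * 5) (j * 8) ⊕ progression (j * 6) (j * 8)
    split-ap j = solve 5 (λ x y z g p → (x :* g :+ y :* g :+ z :* g) :* p := x :* (g :* p) :+ y :* (g :* p) :+ z :* (g :* p)) ≈-refl
      (X (j * 1)) (X (j * 5)) (X (j * 6)) (geo (j * 8)) P

  ap1≲ : ap 1 ⊛ P ≲ high 8 + high 8 + high 8
  ap1≲ = ≲-mono {ap 1 ⊛ P} 0 (≈⇒≼+ (split-ap 1)) (≲-⊕ {progression 1 8 ⊕ progression 5 8} {progression 6 8}
    (≲-⊕ {progression 1 8} {progression 5 8} (progression≲high 1 7) (progression≲high 5 7)) (progression≲high 6 7))

  ap≳ : ∀ j → ap (suc j) ⊛ P ≳ low (suc j * 8) + low (suc j * 8) + low (suc j * 8)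
  ap≳ j = ≳-mono {p 1 ⊕ p 5 ⊕ p 6} {ap (suc j) ⊛ P} 0 (≈⇒≼+ (≈-sym (split-ap (suc j))))
    (≳-⊕ {p 1 ⊕ p 5} {p 6} (≳-⊕ {p 1} {p 5} (p≳ 1) (p≳ 5)) (p≳ 6))
    where
    p : ℕ → Series
    p r = progression (suc j * r) (suc j * 8)
    p≳ : ∀ r → p r ≳ low (suc j * 8)
    p≳ r = progression≳low (suc j * r) (7 + j * 8)

  g₂-1≲ : g₂ 1 ≲ high 8 + high 8 + high 8
  g₂-1≲ = ≲-mono {g₂ 1} {ap 1 ⊛ P} 0 (mk≼ λ n → ≤-trans (g₂-1≤ap n) (m≤m+n _ 0)) ap1≲

  g₂-2≳ : ∀ c → c + high 16 ≤ low 8 + low 8 + low 8 + (low 16 + low 16 + low 16) → g₂ 2 ≳ c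
  g₂-2≳ c l = ≳-minus {g₂ 2} {(X 1 ⊕ pairs) ⊛ P} {(ap 1 ⊕ ap 2) ⊛ P} (high 16) c (mk≼ g₂-2≥ap)
    (≳-mono {ap 1 ⊛ P ⊕ ap 2 ⊛ P} {(ap 1 ⊕ ap 2) ⊛ P} 0 (≈⇒≼+ (≈-sym (R.distribʳ P (ap 1) (ap 2)))) (≳-⊕ {ap 1 ⊛ P} {ap 2 ⊛ P} (ap≳ 0) (ap≳ 1)))
    (≲-mono {(X 1 ⊕ pairs) ⊛ P} {progression 11 16} 1 correction (progression≲high 11 15)) l
    where
    correction : (X 1 ⊕ pairs) ⊛ P ≼ progression 11 16 ⊕ 1 · P
    correction = ≼-trans (≈⇒≼ (solve 4 (λ q x g p → (q :+ x :* g) :* p := x :* (g :* p) :+ q :* p) ≈-refl (X 1) (X 11) (geo 16) P))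
      (⊕-mono (≼-refl {progression 11 16}) (≼-trans P-mono (mk≼ λ n → ≤-reflexive (sym (+-identityʳ (P n))))))

  g₁-1≳ : ∀ {c} → D ≳ c → g₁ 1 ≳ c
  g₁-1≳ = ≳-mono {D} {g₁ 1} 0 (mk≼ λ n → ≤-trans (≤-reflexive (sym (gapLength≡D n))) (≤-trans (g₁-1≥ n) (m≤m+n _ 0)))

  g₁-2≲ : ∀ {c} → D ≲ c → g₁ 2 ≲ c
  g₁-2≲ = ≲-mono {g₁ 2} {D} 0 (mk≼ λ n → ≤-trans (g₁-2≤ n) (≤-trans (≤-reflexive (gapLength≡D n)) (m≤m+n _ 0)))

eventually-both : ∀ {p r : ℕ → Set} → ∃[ N ] (∀ n → n ≥ N → p n) → ∃[ N ] (∀ n → n ≥ N → r n) →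
  ∃[ N ] (∀ n → n ≥ N → p n × r n)
eventually-both (M , f) (N , g) = M + N , λ n l → f n (≤-trans (m≤m+n M N) l) , g n (≤-trans (m≤n+m N M) l)

-- The constants are 10⁶ times rational bounds for (9/16) log 2 > 3/8 and (3/4) log 2 - 1/32 < 1/2,
-- with log 2 estimated by partial sums of 1 - 1/2 + 1/3 - ⋯.
open Estimates 1000000
open Asymptotic 1000000

-- Eighty terms of the series for log 2 exceed 0.686 even after rounding, whence 343000 and 171000;
-- then (171000 + 4 · 343000)/4 > 385000, well above 3/8.
D≳385000 : D ≳ 385000
D≳385000 = D≳ 343000 171000 385000 (Y≳ 40 343000 (≤ᵇ-true⇒≤ refl)) (Z≳ 40 171000 (≤ᵇ-true⇒≤ refl)) (≤ᵇ-true⇒≤ refl)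

-- Eighty-one terms stay below 0.7, whence 350000 and 175000; then 525000 - 250000/8 = 493750.
D≲493750 : D ≲ 493750
D≲493750 = D≲ 350000 175000 493750 (Y≲ 40 350000 (≤ᵇ-true⇒≤ refl)) (Z≲ 40 175000 (≤ᵇ-true⇒≤ refl)) (≤ᵇ-true⇒≤ refl)

S-growth : ∀ K → ∃[ N ] (∀ n → n ≥ N → K * P n < S n)
S-growth = growth 493749 (s≤s z≤n) D≲493750

more-1-hooks : ∃[ N ] (∀ n → n ≥ N → g₁ 1 n > g₂ 1 n)
more-1-hooks = ≳≲⇒> {g₁ 1} {g₂ 1} (g₁-1≳ D≳385000) g₂-1≲ (≤ᵇ-true⇒≤ refl) S-growth

fewer-2-hooks : ∃[ N ] (∀ n → n ≥ N → g₂ 2 n > g₁ 2 n)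
-- The exact value is 3/8 + 3/16 - 1/16 = 1/2; 499000 leaves room for rounding and still exceeds
-- 493750.
fewer-2-hooks = ≳≲⇒> {g₂ 2} {g₁ 2} (g₂-2≳ 499000 (≤ᵇ-true⇒≤ refl)) (g₁-2≲ D≲493750) (≤ᵇ-true⇒≤ refl) S-growth

theorem1p5 : ∃[ N ] ((n : ℕ) → n ≥ N → (g₁ 1 n > g₂ 1 n) × (g₁ 2 n < g₂ 2 n))
theorem1p5 = eventually-both more-1-hooks fewer-2-hooks
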